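{- The following $m$-equivalences between two-element sets of patterns hold (where a chain $P\sim Q\sim R$ means that all the sets listed are pairwise $m$-equivalent): (a) $\{122,1111\}\sim\{212,1111\}$; (b) $\{111,1223\}\sim\{111,1232\}\sim\{111,1322\}\sim\{111,2123\}\sim\{111,2132\}\sim\{111,2213\}$; (c) $\{111,1233\}\sim\{111,2133\}$; (d) $\{111,1234\}\sim\{111,1243\}\sim\{111,1432\}\sim\{111,2134\}\sim\{111,2143\}\sim\{111,3214\}$; (e) $\{123,1111\}\sim\{132,1111\}\sim\{213,1111\}$; (f) $\{123,1112\}\sim\{213,1112\}$; (g) $\{112,1234\}\sim\{112,2134\}\sim\{112,3214\}$; (h) $\{112,2314\}\sim\{112,3124\}$.
   Context: A (finite, reduced) multiset is $S=1^{a_1}2^{a_2}\cdots k^{a_k}$ with $k\ge 1$ and all $a_i\ge 1$, meaning that $i$ occurs with multiplicity $a_i$. A multipermutation of $S$ is a word having exactly $a_i$ occurrences of each letter $i\in[k]=\{1,\dots,k\}$ and no other letters. A word $\pi=\pi_1\cdots\pi_n$ contains a pattern (word) $\rho=\rho_1\cdots\rho_\ell$ if there are indices $i(1)<\cdots<i(\ell)$ such that for all $a,b\in[\ell]$: $\pi_{i(a)}<\pi_{i(b)}$ iff $\rho_a<\rho_b$, and $\pi_{i(a)}>\pi_{i(b)}$ iff $\rho_a>\rho_b$; otherwise $\pi$ avoids $\rho$. For a set $P$ of patterns, $\mathrm{av}(S;P)$ is the number of multipermutations of $S$ that avoid every pattern in $P$. Two sets of patterns $P,Q$ are $m$-equivalent,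 written here $P\sim Q$, if $\mathrm{av}(S;P)=\mathrm{av}(S;Q)$ for every multiset $S$. -}

module Defs where

open import Data.Nat.Base using (ℕ; zero; suc; _≤_; _+_)
import Data.Nat.Base as ℕ
import Data.Nat.Properties as ℕₚ
open import Data.Fin.Base using (Fin; zero; suc; _<_)
import Data.Fin.Properties as Finₚ
open import Data.List.Base
  using (List; []; _∷_; length; lookup; filter; allFin; cartesianProductWith)
open import Data.List.Properties using (∷-injective)
open import Data.List.Membership.Propositional using (_∈_)
open import Data.List.Membership.Propositional.Properties
  using (∈-filter⁺; ∈-filter⁻; ∈-allFin; ∈-cartesianProductWith⁺)
open import Data.List.Relation.Unary.All using (All; all?)
open import Data.List.Relation.Unary.Any using (here)
open import Data.List.Relation.Unary.AllPairs using ([]; _∷_)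
open import Data.List.Relation.Unary.Unique.Propositional using (Unique)
import Data.List.Relation.Unary.All as All
import Data.List.Relation.Unary.Unique.Propositional.Properties as Uniqueₚ
import Data.Vec.Base as Vec
import Data.Vec.Properties as Vecₚ
open import Data.Product.Base using (∃; _×_; _,_; proj₂)
open import Function.Base using (_∘_)
open import Function.Bundles using (_⇔_; mk⇔; Equivalence)
open import Relation.Nullary.Negation using (¬_; contradiction)
open import Relation.Nullary.Decidable
  using (Dec; yes; no; map′; ¬?; _×-dec_; _→-dec_)
open import Relation.Binary.PropositionalEquality
  using (_≡_; refl; sym; trans; cong; cong₂; subst; _≗_)
open import Algebra.Properties.CommutativeMonoid.Sum ℕₚ.+-0-commutativeMonoid
  using (sum; sum-cong-≗; ∑-distrib-+; sum-replicate-zero)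

record Multiset : Set where
  field
    k      : ℕ
    k≥1    : 1 ≤ k
    mult   : Fin k → ℕ
    mult≥1 : ∀ i → 1 ≤ mult i

  size : ℕ
  size = sum mult

open Multiset public

-- The letters 1, …, k are encoded as the elements of Fin k, in the same order.
Word : ℕ → Set
Word k = List (Fin k)

Pattern : Set
Pattern = List ℕ

occurrences : ∀ {k} → Fin k → Word k → ℕ
occurrences i π = length (filter (Finₚ._≟ i) π)

IsMultiperm : (S : Multiset) → Word (k S) → Set
IsMultiperm S π = ∀ i → occurrences i π ≡ mult S i

-- ι selects the positions i(1), …, i(ℓ) of an occurrence of ρ in π.
IsOccurrence : ∀ {k} (π : Word k) (ρ : Pattern) → (Fin (length ρ) → Fin (length π)) → Set
IsOccurrence π ρ ι =
  (∀ a b → a < b → ι a < ι b) ×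
  (∀ a b → (lookup π (ι a) < lookup π (ι b) ⇔ lookup ρ a ℕ.< lookup ρ b) ×
           (lookup π (ι b) < lookup π (ι a) ⇔ lookup ρ b ℕ.< lookup ρ a))

Contains : ∀ {k} → Word k → Pattern → Set
Contains π ρ = ∃ λ ι → IsOccurrence π ρ ι

Avoids : ∀ {k} → Word k → Pattern → Set
Avoids π ρ = ¬ Contains π ρ

AvoidsAll : ∀ {k} → List Pattern → Word k → Set
AvoidsAll P π = All (Avoids π) P

isMultiperm? : ∀ S π → Dec (IsMultiperm S π)
isMultiperm? S π = Finₚ.all? (λ i → occurrences i π ℕₚ.≟ mult S i)

private
  _⇔?_ : ∀ {A B : Set} → Dec A → Dec B → Dec (A ⇔ B)
  A? ⇔? B? = map′ (λ (f , g) → mk⇔ f g)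
                  (λ e → Equivalence.to e , Equivalence.from e)
                  ((A? →-dec B?) ×-dec (B? →-dec A?))

  anyVec? : ∀ {n} ℓ {P : Vec.Vec (Fin n) ℓ → Set} → (∀ v → Dec (P v)) → Dec (∃ P)
  anyVec? zero    P? = map′ (λ p → Vec.[] , p) (λ { (Vec.[] , p) → p }) (P? Vec.[])
  anyVec? (suc ℓ) P? =
    map′ (λ (x , v , p) → x Vec.∷ v , p) (λ { (x Vec.∷ v , p) → x , v , p })
         (Finₚ.any? λ x → anyVec? ℓ λ v → P? (x Vec.∷ v))

isOccurrence? : ∀ {k} (π : Word k) ρ ι → Dec (IsOccurrence π ρ ι)
isOccurrence? π ρ ι =
  (Finₚ.all? λ a → Finₚ.all? λ b → (a Finₚ.<? b) →-dec (ι a Finₚ.<? ι b)) ×-dec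
  (Finₚ.all? λ a → Finₚ.all? λ b →
    ((lookup π (ι a) Finₚ.<? lookup π (ι b)) ⇔? (lookup ρ a ℕₚ.<? lookup ρ b)) ×-dec
    ((lookup π (ι b) Finₚ.<? lookup π (ι a)) ⇔? (lookup ρ b ℕₚ.<? lookup ρ a)))

isOccurrence-resp : ∀ {k} (π : Word k) ρ {ι κ} → ι ≗ κ →
                    IsOccurrence π ρ ι → IsOccurrence π ρ κ
isOccurrence-resp π ρ {ι} {κ} eq (inc , cmp) = inc′ , cmp′
  where
  inc′ : ∀ a b → a < b → κ a < κ b
  inc′ a b rewrite sym (eq a) | sym (eq b) = inc a b
  cmp′ : ∀ a b → (lookup π (κ a) < lookup π (κ b) ⇔ lookup ρ a ℕ.< lookup ρ b) ×
                 (lookup π (κ b) < lookup π (κ a) ⇔ lookup ρ b ℕ.< lookup ρ a)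
  cmp′ a b rewrite sym (eq a) | sym (eq b) = cmp a b

contains? : ∀ {k} (π : Word k) ρ → Dec (Contains π ρ)
contains? π ρ =
  map′ (λ (v , o) → Vec.lookup v , o)
       (λ (ι , o) → Vec.tabulate ι ,
         isOccurrence-resp π ρ (λ a → sym (Vecₚ.lookup∘tabulate ι a)) o)
       (anyVec? (length ρ) λ v → isOccurrence? π ρ (Vec.lookup v))

avoidsAll? : ∀ {k} (P : List Pattern) (π : Word k) → Dec (AvoidsAll P π)
avoidsAll? P π = all? (λ ρ → ¬? (contains? π ρ)) P

words : ∀ k → ℕ → List (Word k)
words k zero    = [] ∷ []
words k (suc n) = cartesianProductWith _∷_ (allFin k) (words k n)

multiperms : (S : Multiset) → List (Word (k S))
multiperms S = filter (isMultiperm? S) (words (k S) (size S))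

av : Multiset → List Pattern → ℕ
av S P = length (filter (avoidsAll? P) (multiperms S))

infix 4 _∼_

_∼_ : List Pattern → List Pattern → Set
P ∼ Q = ∀ S → av S P ≡ av S Q

word₃ : (a b c : ℕ) → Pattern
word₃ a b c = a ∷ b ∷ c ∷ []

word₄ : (a b c d : ℕ) → Pattern
word₄ a b c d = a ∷ b ∷ c ∷ d ∷ []

｛_,_｝ : Pattern → Pattern → List Pattern
｛ ρ , σ ｝ = ρ ∷ σ ∷ []

-- By ∈-multiperms and multiperms-unique below, multiperms S lists every
-- multipermutation of S exactly once.

∈-words : ∀ {k} (π : Word k) → π ∈ words k (length π)
∈-words []      = here refl
∈-words (x ∷ π) = ∈-cartesianProductWith⁺ _∷_ (∈-allFin x) (∈-words π)

words-unique : ∀ k n → Unique (words k n)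
words-unique k zero    = All.[] ∷ []
words-unique k (suc n) =
  Uniqueₚ.cartesianProductWith⁺ _∷_ ∷-injective (Uniqueₚ.allFin⁺ k) (words-unique k n)

private
  δ : ∀ {k} → Fin k → Fin k → ℕ
  δ zero    zero    = 1
  δ zero    (suc i) = 0
  δ (suc x) zero    = 0
  δ (suc x) (suc i) = δ x i

  δ-≡ : ∀ {k} (x : Fin k) → δ x x ≡ 1
  δ-≡ zero    = refl
  δ-≡ (suc x) = δ-≡ x

  δ-≢ : ∀ {k} (x i : Fin k) → ¬ x ≡ i → δ x i ≡ 0
  δ-≢ zero    zero    x≢i = contradiction refl x≢i
  δ-≢ zero    (suc i) x≢i = refl
  δ-≢ (suc x) zero    x≢i = refl
  δ-≢ (suc x) (suc i) x≢i = δ-≢ x i (x≢i ∘ cong suc)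

  sum-δ : ∀ {k} (x : Fin k) → sum (δ x) ≡ 1
  sum-δ {suc k} zero    = cong suc (sum-replicate-zero k)
  sum-δ         (suc x) = sum-δ x

  occurrences-∷ : ∀ {k} (x : Fin k) π i →
                  occurrences i (x ∷ π) ≡ δ x i + occurrences i π
  occurrences-∷ x π i with x Finₚ.≟ i
  ... | yes refl = cong (_+ occurrences i π) (sym (δ-≡ x))
  ... | no x≢i   = cong (_+ occurrences i π) (sym (δ-≢ x i x≢i))

sum-occurrences : ∀ {k} (π : Word k) → sum (λ i → occurrences i π) ≡ length π
sum-occurrences {k} []  = sum-replicate-zero k
sum-occurrences (x ∷ π) =
  trans (sum-cong-≗ (occurrences-∷ x π))
        (trans (∑-distrib-+ (δ x) (λ i → occurrences i π))
               (cong₂ _+_ (sum-δ x) (sum-occurrences π)))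

∈-multiperms : ∀ S π → π ∈ multiperms S ⇔ IsMultiperm S π
∈-multiperms S π = mk⇔ (proj₂ ∘ ∈-filter⁻ (isMultiperm? S) {xs = words (k S) (size S)}) from
  where
  from : IsMultiperm S π → π ∈ multiperms S
  from m = ∈-filter⁺ (isMultiperm? S)
    (subst (λ n → π ∈ words (k S) n)
           (trans (sym (sum-occurrences π)) (sum-cong-≗ m)) (∈-words π)) m

multiperms-unique : ∀ S → Unique (multiperms S)
multiperms-unique S = Uniqueₚ.filter⁺ (isMultiperm? S) (words-unique (k S) (size S))

{-# OPTIONS --safe #-}
module Submission where

-- Call a letter x of a word active if it is followed by an occurrence of τ above x, and let the
-- height at a position be the number of values that would be active there. A word avoids ρ ⊕ τ
-- (the pattern ρ ++ τ with ρ below τ) if and only if at every position the letters read so far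
-- and below the height avoid ρ. The inactive letters alone determine the heights. With these
-- letters and the multiplicities fixed, the words avoiding ρ ⊕ τ are walks on the words avoiding
-- ρ: an active letter is appended (add), and whenever the height drops to h, the letters h, which
-- have to occur m times, are deleted (del m). Read backwards, a walk removes the last letter or
-- inserts m copies of a new maximum. As σ = 1…1 and σ = 1…12 only bound the numbers m, we get
-- {ρ ⊕ τ, σ} ∼ {ρ′ ⊕ τ, σ} as soon as ρ and ρ′ have the same number of backward walks. This is
-- read off a statistic on the states:
--   12, 21 and 122, 212, 221: the length;
--   2132, 2213 (τ empty):     the number of sites where a new maximum can be inserted;
--   231, 312:                 a composition of the length, by components and by runs;
--   123, 213, 321:            a partition with two rows, to which a new maximum adds a horizontal
--                             strip, and from which the removal of a letter removes a box.
-- For 321 the first row is the length of a longest weakly increasing subsequence.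
-- The other patterns are reverse complements of these. States list the last letter first, so
-- that the patterns occur reversed in them.

open import Defs
open import Data.Empty using (⊥)
open import Data.Fin.Base as Fin using (Fin; zero; suc; toℕ; fromℕ<; opposite)
import Data.Fin.Properties as Finₚ
open import Data.List.Base
  using (List; []; _∷_; _++_; map; filter; length; cartesianProductWith; deduplicate; _ʳ++_;
    [_]; reverse; lookup; tabulate; catMaybes; upTo; applyUpTo; allFin; replicate)
open import Data.List.Membership.Propositional using (_∈_; find; lose)
open import Data.List.Membership.Propositional.Properties
  using (∈-deduplicate⁺; ∈-deduplicate⁻; ∈-map⁺; ∈-map⁻; ∈-upTo⁺; ∈-filter⁺; ∈-filter⁻)
open import Data.List.Properties as Listₚ
  using (ʳ++-defn; tabulate-cong; map-tabulate; unfold-reverse; ++-assoc; filter-accept;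
    filter-reject; filter-all; reverse-involutive; ∷-injectiveˡ; ∷-injectiveʳ; ≡-dec;
    applyUpTo-∷ʳ; ++-identityʳ; filter-++; length-map; reverse-++; length-reverse; length-ʳ++;
    length-++; length-replicate; ∷-injective; reverse-map; map-∘; map-cong; map-id)
open import Data.List.Relation.Binary.Pointwise as Pw using (Pointwise; []; _∷_)
open import Data.List.Relation.Binary.Sublist.Propositional
  using (_⊆_; []; _∷_; _∷ʳ_; minimum; ⊆-refl; ⊆-trans; from∈)
import Data.List.Relation.Binary.Sublist.Propositional.Properties as Subₚ
open import Data.List.Relation.Unary.All as All using (All; []; _∷_)
import Data.List.Relation.Unary.All.Properties as Allₚ
open import Data.List.Relation.Unary.AllPairs using ([]; _∷_; AllPairs)
open import Data.List.Relation.Unary.Any as Any using (here; there; Any; any?)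
import Data.List.Relation.Unary.Any.Properties as Anyₚ
open import Data.List.Relation.Unary.Unique.DecPropositional.Properties using (deduplicate-!)
open import Data.List.Relation.Unary.Unique.Propositional using (Unique)
import Data.List.Relation.Unary.Unique.Propositional.Properties as Uniqueₚ
open import Data.Maybe.Base using (Maybe; just; nothing)
import Data.Maybe.Properties as Maybeₚ
open import Data.Nat.Base as ℕ using (ℕ; zero; suc; _+_; _*_; _<_; _≤_; _⊔_; _∸_)
open import Data.Nat.ListAction using (sum)
open import Data.Nat.Properties as ℕₚ
  using (+-assoc; +-comm; +-identityʳ; *-zeroʳ; *-distribˡ-+; *-distribʳ-+; *-identityˡ;
    *-identityʳ; _<?_; _≤?_; _≟_)
open import Data.Nat.Tactic.RingSolver using (solve-∀)
open import Data.Product.Base using (_×_; _,_; ∃; proj₁; proj₂; swap)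
import Data.Product.Properties as Productₚ
open import Data.Sum.Base using (_⊎_; inj₁; inj₂)
open import Data.Unit.Base using (⊤; tt)
open import Function.Base using (_∘_; id)
open import Function.Bundles using (_⇔_; mk⇔; Equivalence)
open import Function.Properties.Equivalence
  using () renaming (refl to ⇔-refl; sym to ⇔-sym; trans to ⇔-trans)
open import Level using (Level)
open import Relation.Binary.Definitions using (DecidableEquality)
open import Relation.Binary.PropositionalEquality hiding ([_])
open import Relation.Nullary.Decidable
  using (Dec; yes; no; _×-dec_; map′; _⊎-dec_; _→-dec_; ¬?; True; toWitness)
open import Relation.Nullary.Negation using (¬_; contradiction)
open import Relation.Unary using (Pred; Decidable)

-- No words are ever matched with one another: every claim is an equality of sums. A step of a walk
-- acts as an operator on functions of the state. Backwards, a deletion turns into the insertion of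
-- a prescribed number of copies, while forwards it may be forbidden by a multiplicity; and a
-- backward walk starts from the empty state. So a removal can be pushed back through the insertions
-- that precede it until it is cancelled or reaches the start. For the patterns with three distinct
-- letters this is the whole argument: patterns whose operators obey the same commutation relations
-- have equally many walks, and for 123 and 213 no partition is ever assigned to a word. The
-- constants come from `σ`. Avoiding 111 leaves at most two copies per insertion, so strips of at
-- most two boxes suffice for 321 and 213. Avoiding 112 leaves at most one active copy of each
-- letter, so states have distinct letters; the compositions for 231 and 312 are tied to this case.

module Sums where

  private variable
    ℓ : Level
    A B C P Q : Set ℓ

  ⟦_⟧ : Dec P → ℕ
  ⟦ yes _ ⟧ = 1
  ⟦ no _ ⟧ = 0

  ⟦⟧-yes : (P? : Dec P) → P → ⟦ P? ⟧ ≡ 1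
  ⟦⟧-yes (yes _) _ = refl
  ⟦⟧-yes (no ¬p) p = contradiction p ¬p

  ⟦⟧-no : (P? : Dec P) → ¬ P → ⟦ P? ⟧ ≡ 0
  ⟦⟧-no (yes p) ¬p = contradiction p ¬p
  ⟦⟧-no (no _) _ = refl

  ⟦⟧-cong : (P? : Dec P) (Q? : Dec Q) → (P → Q) → (Q → P) → ⟦ P? ⟧ ≡ ⟦ Q? ⟧
  ⟦⟧-cong (yes p) Q? f g = sym (⟦⟧-yes Q? (f p))
  ⟦⟧-cong (no ¬p) Q? f g = sym (⟦⟧-no Q? (¬p ∘ g))

  ⟦⟧-× : (P? : Dec P) (Q? : Dec Q) → ⟦ P? ×-dec Q? ⟧ ≡ ⟦ P? ⟧ * ⟦ Q? ⟧
  ⟦⟧-× (yes _) (yes _) = refl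
  ⟦⟧-× (yes _) (no _)  = refl
  ⟦⟧-× (no _)  _       = refl

  ⟦⟧*-cong : (P? : Dec P) {m n : ℕ} → (P → m ≡ n) → ⟦ P? ⟧ * m ≡ ⟦ P? ⟧ * n
  ⟦⟧*-cong (yes p) e = cong (1 *_) (e p)
  ⟦⟧*-cong (no _)  _ = refl

  ∑ : List A → (A → ℕ) → ℕ
  ∑ []       f = 0
  ∑ (x ∷ xs) f = f x + ∑ xs f

  ∑-cong-All : {f g : A → ℕ} (xs : List A) → All (λ x → f x ≡ g x) xs → ∑ xs f ≡ ∑ xs g
  ∑-cong-All []       []       = refl
  ∑-cong-All (x ∷ xs) (e ∷ es) = cong₂ _+_ e (∑-cong-All xs es)

  ∑-cong : {f g : A → ℕ} (xs : List A) → (∀ x → f x ≡ g x) → ∑ xs f ≡ ∑ xs g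
  ∑-cong xs e = ∑-cong-All xs (All.universal e xs)

  ∑-++ : (xs ys : List A) (f : A → ℕ) → ∑ (xs ++ ys) f ≡ ∑ xs f + ∑ ys f
  ∑-++ []       ys f = refl
  ∑-++ (x ∷ xs) ys f = trans (cong (f x +_) (∑-++ xs ys f)) (sym (+-assoc (f x) _ _))

  ∑-map : (g : A → B) (xs : List A) (f : B → ℕ) → ∑ (map g xs) f ≡ ∑ xs (f ∘ g)
  ∑-map g []       f = refl
  ∑-map g (x ∷ xs) f = cong (f (g x) +_) (∑-map g xs f)

  ∑-zero : (xs : List A) → ∑ xs (λ _ → 0) ≡ 0
  ∑-zero []       = refl
  ∑-zero (x ∷ xs) = ∑-zero xs

  ∑-vanish : {f : A → ℕ} (xs : List A) → All (λ x → f x ≡ 0) xs → ∑ xs f ≡ 0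
  ∑-vanish xs z = trans (∑-cong-All xs z) (∑-zero xs)

  ∑-+ : (xs : List A) (f g : A → ℕ) → ∑ xs (λ x → f x + g x) ≡ ∑ xs f + ∑ xs g
  ∑-+ []       f g = refl
  ∑-+ (x ∷ xs) f g rewrite ∑-+ xs f g = lem (f x) (g x) (∑ xs f) (∑ xs g)
    where
    lem : ∀ a b c d → a + b + (c + d) ≡ a + c + (b + d)
    lem = solve-∀

  ∑-*ˡ : (c : ℕ) (xs : List A) (f : A → ℕ) → ∑ xs (λ x → c * f x) ≡ c * ∑ xs f
  ∑-*ˡ c []       f = sym (*-zeroʳ c)
  ∑-*ˡ c (x ∷ xs) f = trans (cong (c * f x +_) (∑-*ˡ c xs f)) (sym (*-distribˡ-+ c (f x) _))

  ∑-*ʳ : (c : ℕ) (xs : List A) (f : A → ℕ) → ∑ xs (λ x → f x * c) ≡ ∑ xs f * c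
  ∑-*ʳ c []       f = refl
  ∑-*ʳ c (x ∷ xs) f = trans (cong (f x * c +_) (∑-*ʳ c xs f)) (sym (*-distribʳ-+ c (f x) _))

  ∑-swap : (xs : List A) (ys : List B) (f : A → B → ℕ) →
           ∑ xs (λ x → ∑ ys (f x)) ≡ ∑ ys (λ y → ∑ xs (λ x → f x y))
  ∑-swap []       ys f = sym (∑-zero ys)
  ∑-swap (x ∷ xs) ys f =
    trans (cong (∑ ys (f x) +_) (∑-swap xs ys f)) (sym (∑-+ ys (f x) _))

  ∑-filter : {P : Pred A ℓ} (P? : Decidable P) (xs : List A) (f : A → ℕ) →
             ∑ (filter P? xs) f ≡ ∑ xs (λ x → ⟦ P? x ⟧ * f x)
  ∑-filter P? []       f = refl
  ∑-filter P? (x ∷ xs) f with P? x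
  ... | yes _ = cong₂ _+_ (sym (*-identityˡ (f x))) (∑-filter P? xs f)
  ... | no  _ = ∑-filter P? xs f

  length-filter : {P : Pred A ℓ} (P? : Decidable P) (xs : List A) →
                  length (filter P? xs) ≡ ∑ xs (λ x → ⟦ P? x ⟧)
  length-filter P? []       = refl
  length-filter P? (x ∷ xs) with P? x
  ... | yes _ = cong suc (length-filter P? xs)
  ... | no  _ = length-filter P? xs

  ∑-cartesianProductWith : (g : A → B → C) (xs : List A) (ys : List B) (f : C → ℕ) →
    ∑ (cartesianProductWith g xs ys) f ≡ ∑ xs (λ x → ∑ ys (f ∘ g x))
  ∑-cartesianProductWith g []       ys f = refl
  ∑-cartesianProductWith g (x ∷ xs) ys f =
    trans (∑-++ (map (g x) ys) _ f)
          (cong₂ _+_ (∑-map (g x) ys f) (∑-cartesianProductWith g xs ys f))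

  module _ (_≟_ : DecidableEquality A) where

    ∑-≟-∉ : (x : A) (f : A → ℕ) (xs : List A) → All (x ≢_) xs → ∑ xs (λ y → ⟦ x ≟ y ⟧ * f y) ≡ 0
    ∑-≟-∉ x f xs x∉ = ∑-vanish xs (All.map (λ {y} ne → cong (_* f y) (⟦⟧-no (x ≟ y) ne)) x∉)

    ∑-≟ : {x : A} (f : A → ℕ) {xs : List A} → Unique xs → x ∈ xs → ∑ xs (λ y → ⟦ x ≟ y ⟧ * f y) ≡ f x
    ∑-≟ {x} f {y ∷ xs} (y∉ ∷ _) (here refl) =
      trans (cong₂ _+_ (trans (cong (_* f x) (⟦⟧-yes (x ≟ x) refl)) (*-identityˡ (f x))) (∑-≟-∉ x f xs y∉))
            (+-identityʳ (f x))
    ∑-≟ {x} f {y ∷ xs} (y∉ ∷ u) (there x∈) =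
      trans (cong (_+ ∑ xs (λ z → ⟦ x ≟ z ⟧ * f z)) (cong (_* f y) (⟦⟧-no (x ≟ y) (λ { refl → All.lookup y∉ x∈ refl }))))
            (∑-≟ f u x∈)

  ∑-by-classes : {K : Set} (_≟_ : DecidableEquality K) (key : A → K) (xs : List A) (f g : A → ℕ) →
    (∀ {x} → x ∈ xs → ∑ xs (λ y → ⟦ key y ≟ key x ⟧ * f y) ≡ ∑ xs (λ y → ⟦ key y ≟ key x ⟧ * g y)) →
    ∑ xs f ≡ ∑ xs g
  ∑-by-classes {K = K} _≟_ key xs f g hyp =
    trans (split f) (trans (∑-cong-All keys (All.tabulate same)) (sym (split g)))
    where
    keys : List K
    keys = deduplicate _≟_ (map key xs)
    keys! : Unique keys
    keys! = deduplicate-! _≟_ (map key xs)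
    split : ∀ h → ∑ xs h ≡ ∑ keys (λ κ → ∑ xs (λ y → ⟦ key y ≟ κ ⟧ * h y))
    split h = trans
      (∑-cong-All xs (All.tabulate λ {y} y∈ →
        sym (∑-≟ _≟_ (λ _ → h y) keys! (∈-deduplicate⁺ _≟_ (∈-map⁺ key y∈)))))
      (∑-swap xs keys _)
    same : ∀ {κ} → κ ∈ keys →
      ∑ xs (λ y → ⟦ key y ≟ κ ⟧ * f y) ≡ ∑ xs (λ y → ⟦ key y ≟ κ ⟧ * g y)
    same κ∈ with ∈-map⁻ key (∈-deduplicate⁻ _≟_ (map key xs) κ∈)
    ... | x , x∈ , refl = hyp x∈

open Sums

-- Pattern containment for lists of numbers.

SameOrder : ℕ → ℕ → ℕ → ℕ → Set
SameOrder x r y s = (x < y ⇔ r < s) × (y < x ⇔ s < r)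

infix 4 _≅_
-- Order isomorphism unfolded along the list, each entry being compared with all later ones; in this
-- form occurrences are cut, joined and reversed by recursion.
data _≅_ : List ℕ → List ℕ → Set where
  []  : [] ≅ []
  _∷_ : ∀ {x r l ρ} → Pointwise (SameOrder x r) l ρ → l ≅ ρ → x ∷ l ≅ r ∷ ρ

Has : List ℕ → List ℕ → Set
Has ρ w = ∃ λ l → l ⊆ w × l ≅ ρ

Av : List ℕ → List ℕ → Set
Av ρ w = ¬ Has ρ w

private
  ⇔? : ∀ {A B : Set} → Dec A → Dec B → Dec (A ⇔ B)
  ⇔? A? B? = map′ (λ (f , g) → mk⇔ f g) (λ e → Equivalence.to e , Equivalence.from e) ((A? →-dec B?) ×-dec (B? →-dec A?))

sameOrder? : ∀ x r y s → Dec (SameOrder x r y s)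
sameOrder? x r y s = ⇔? (x ℕₚ.<? y) (r ℕₚ.<? s) ×-dec ⇔? (y ℕₚ.<? x) (s ℕₚ.<? r)

_≅?_ : ∀ l ρ → Dec (l ≅ ρ)
[]      ≅? []      = yes []
[]      ≅? (_ ∷ _) = no λ ()
(_ ∷ _) ≅? []      = no λ ()
(x ∷ l) ≅? (r ∷ ρ) =
  map′ (λ (a , b) → a ∷ b) (λ { (a ∷ b) → a , b }) (Pw.decidable (sameOrder? x r) l ρ ×-dec (l ≅? ρ))

anySublist? : ∀ {A : Set} {P : List A → Set} → (∀ l → Dec (P l)) → ∀ w → Dec (∃ λ l → l ⊆ w × P l)
anySublist? P? []      = map′ (λ p → [] , [] , p) (λ { ([] , [] , p) → p }) (P? [])
anySublist? P? (x ∷ w) = map′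
  (λ { (inj₁ (l , s , p)) → l , x ∷ʳ s , p ; (inj₂ (l , s , p)) → x ∷ l , refl ∷ s , p })
  (λ { (l , .x ∷ʳ s , p) → inj₁ (l , s , p) ; (.x ∷ l , refl ∷ s , p) → inj₂ (l , s , p) })
  (anySublist? P? w ⊎-dec anySublist? (λ l → P? (x ∷ l)) w)

opaque
  av? : ∀ ρ w → Dec (Av ρ w)
  av? ρ w = ¬? (anySublist? (_≅? ρ) w)

Has-⊆ : ∀ {ρ w w′} → w ⊆ w′ → Has ρ w → Has ρ w′
Has-⊆ s (l , l⊆ , e) = l , ⊆-trans l⊆ s , e

Av-⊆ : ∀ {ρ w w′} → w ⊆ w′ → Av ρ w′ → Av ρ w
Av-⊆ s na h = na (Has-⊆ s h)

Increasing : ∀ {m n} → (Fin m → Fin n) → Set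
Increasing ι = ∀ a b → a Fin.< b → ι a Fin.< ι b

private
  lower : ∀ {m n} (ι : Fin m → Fin (suc n)) → Increasing ι → (∀ a → zero {n} Fin.< ι a) →
          ∃ λ κ → Increasing κ × (∀ a → suc (κ a) ≡ ι a)
  lower {m} {n} ι mono pos = κ , mono′ , κ≡
    where
    pred′ : (i : Fin (suc n)) → zero {n} Fin.< i → ∃ λ j → suc j ≡ i
    pred′ (suc j) _ = j , refl
    κ : Fin m → Fin n
    κ a = proj₁ (pred′ (ι a) (pos a))
    κ≡ : ∀ a → suc (κ a) ≡ ι a
    κ≡ a = proj₂ (pred′ (ι a) (pos a))
    mono′ : Increasing κ
    mono′ a b a<b = ℕ.s<s⁻¹ (subst₂ Fin._<_ (sym (κ≡ a)) (sym (κ≡ b)) (mono a b a<b))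

tabulate-⊆ : ∀ {A : Set} {n} (w : List A) (ι : Fin n → Fin (length w)) → Increasing ι →
             tabulate (lookup w ∘ ι) ⊆ w
tabulate-⊆ {n = zero}  w ι mono = minimum w
tabulate-⊆ {n = suc n} [] ι mono with () ← ι zero
tabulate-⊆ {n = suc n} (x ∷ w) ι mono with ι zero in eq
... | zero =
  let κ , κ-mono , κ≡ = lower (ι ∘ suc) (λ a b a<b → mono (suc a) (suc b) (ℕ.s<s a<b))
                              (λ a → subst (Fin._< ι (suc a)) eq (mono zero (suc a) ℕ.z<s))
  in refl ∷ subst (_⊆ w) (tabulate-cong λ a → cong (lookup (x ∷ w)) (κ≡ a)) (tabulate-⊆ w κ κ-mono)
... | suc j =
  let pos : ∀ a → zero {length w} Fin.< ι a
      pos = λ { zero → subst (zero {length w} Fin.<_) (sym eq) ℕ.z<s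
              ; (suc a) → ℕₚ.≤-<-trans ℕ.z≤n (mono zero (suc a) ℕ.z<s) }
      κ , κ-mono , κ≡ = lower ι mono pos
      eqs : tabulate (lookup w ∘ κ) ≡ lookup w j ∷ tabulate (lookup (x ∷ w) ∘ ι ∘ suc)
      eqs = trans (tabulate-cong λ a → cong (lookup (x ∷ w)) (κ≡ a))
                (cong (λ i → lookup (x ∷ w) i ∷ tabulate (lookup (x ∷ w) ∘ ι ∘ suc)) eq)
  in x ∷ʳ subst (_⊆ w) eqs (tabulate-⊆ w κ κ-mono)

tabulate-≅ : ∀ ρ (f : Fin (length ρ) → ℕ) →
             (∀ a b → SameOrder (f a) (lookup ρ a) (f b) (lookup ρ b)) → tabulate f ≅ ρ
tabulate-≅ []      f so = []
tabulate-≅ (r ∷ ρ) f so = head ρ (f ∘ suc) (λ b → so zero (suc b)) ∷ tabulate-≅ ρ (f ∘ suc) λ a b → so (suc a) (suc b)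
  where
  head : ∀ {x r} ρ (f : Fin (length ρ) → ℕ) → (∀ b → SameOrder x r (f b) (lookup ρ b)) →
         Pointwise (SameOrder x r) (tabulate f) ρ
  head []      f so = []
  head (s ∷ ρ) f so = so zero ∷ head ρ (f ∘ suc) (so ∘ suc)

≅-length : ∀ {A : Set} (f : A → ℕ) (l : List A) ρ → map f l ≅ ρ → length ρ ≡ length l
≅-length f []      []      []      = refl
≅-length f (x ∷ l) (r ∷ ρ) (_ ∷ e) = cong suc (≅-length f l ρ e)

≅-lookup : ∀ {A : Set} (f : A → ℕ) (l : List A) ρ .(eq : length ρ ≡ length l) → map f l ≅ ρ → ∀ a b →
  SameOrder (f (lookup l (Fin.cast eq a))) (lookup ρ a) (f (lookup l (Fin.cast eq b))) (lookup ρ b)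
≅-lookup f (x ∷ l) (r ∷ ρ) eq (h ∷ e) zero zero = no-< , no-<
  where
  no-< : ∀ {m n} → m < m ⇔ n < n
  no-< = mk⇔ (λ lt → contradiction lt (ℕₚ.<-irrefl refl)) (λ lt → contradiction lt (ℕₚ.<-irrefl refl))
≅-lookup f (x ∷ l) (r ∷ ρ) eq (h ∷ e) zero (suc b) = at l ρ (ℕₚ.suc-injective eq) h b
  where
  at : ∀ l ρ .(eq : length ρ ≡ length l) → Pointwise (SameOrder (f x) r) (map f l) ρ →
       ∀ b → SameOrder (f x) r (f (lookup l (Fin.cast eq b))) (lookup ρ b)
  at (y ∷ l) (s ∷ ρ) eq (so ∷ h) zero    = so
  at (y ∷ l) (s ∷ ρ) eq (so ∷ h) (suc b) = at l ρ (ℕₚ.suc-injective eq) h b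
≅-lookup f (x ∷ l) (r ∷ ρ) eq (h ∷ e) (suc a) zero = swap (≅-lookup f (x ∷ l) (r ∷ ρ) eq (h ∷ e) zero (suc a))
≅-lookup f (x ∷ l) (r ∷ ρ) eq (h ∷ e) (suc a) (suc b) = ≅-lookup f l ρ (ℕₚ.suc-injective eq) e a b

⊆-positions : ∀ {A : Set} {l w : List A} → l ⊆ w →
  ∃ λ (ι : Fin (length l) → Fin (length w)) → Increasing ι × (∀ a → lookup w (ι a) ≡ lookup l a)
⊆-positions []       = (λ ()) , (λ ()) , λ ()
⊆-positions (y ∷ʳ s) with ⊆-positions s
... | ι , mono , eq = suc ∘ ι , (λ a b lt → ℕ.s<s (mono a b lt)) , eq
⊆-positions {l = x ∷ l} {w = x ∷ w} (refl ∷ s) with ⊆-positions s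
... | ι , mono , eq = κ , κ-mono , λ { zero → refl ; (suc a) → eq a }
  where
  κ : Fin (suc (length l)) → Fin (suc (length w))
  κ zero    = zero
  κ (suc a) = suc (ι a)
  κ-mono : Increasing κ
  κ-mono zero    (suc b) _  = ℕ.z<s
  κ-mono (suc a) (suc b) lt = ℕ.s<s (mono a b (ℕ.s<s⁻¹ lt))

⊆-map⁻ : ∀ {A B : Set} (f : A → B) {l w} → l ⊆ map f w → ∃ λ l′ → l′ ⊆ w × map f l′ ≡ l
⊆-map⁻ f {w = []}    []         = [] , [] , refl
⊆-map⁻ f {w = x ∷ w} (_ ∷ʳ s)   = let l′ , s′ , e = ⊆-map⁻ f s in l′ , x ∷ʳ s′ , e
⊆-map⁻ f {w = x ∷ w} (refl ∷ s) = let l′ , s′ , e = ⊆-map⁻ f s in x ∷ l′ , refl ∷ s′ , cong (f x ∷_) e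

⊆-++⁻ : ∀ {A : Set} (p : List A) {w l} → l ⊆ p ++ w → ∃ λ l₁ → ∃ λ l₂ → l ≡ l₁ ++ l₂ × l₁ ⊆ p × l₂ ⊆ w
⊆-++⁻ []      sub          = [] , _ , refl , [] , sub
⊆-++⁻ (y ∷ p) (_ ∷ʳ sub)   = let l₁ , l₂ , e , a , b = ⊆-++⁻ p sub in l₁ , l₂ , e , y ∷ʳ a , b
⊆-++⁻ (y ∷ p) (refl ∷ sub) = let l₁ , l₂ , e , a , b = ⊆-++⁻ p sub in y ∷ l₁ , l₂ , cong (y ∷_) e , refl ∷ a , b

∈-ʳ++ : ∀ {A : Set} {x : A} c {w} → x ∈ c → x ∷ w ⊆ c ʳ++ w
∈-ʳ++ (x ∷ c) {w} (here refl) = subst (x ∷ w ⊆_) (sym (ʳ++-defn c)) (Subₚ.++⁺ˡ (reverse c) ⊆-refl)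
∈-ʳ++ (y ∷ c)     (there x∈)  = ⊆-trans (refl ∷ _ ∷ʳ ⊆-refl) (∈-ʳ++ c x∈)

All-ʳ++⁺ : ∀ {A : Set} {P : A → Set} {c w} → All P c → All P w → All P (c ʳ++ w)
All-ʳ++⁺ []        pw = pw
All-ʳ++⁺ (px ∷ pc) pw = All-ʳ++⁺ pc (px ∷ pw)

All-reverse⁺ : ∀ {A : Set} {P : A → Set} {c} → All P c → All P (reverse c)
All-reverse⁺ pc = All-ʳ++⁺ pc []

letters : ∀ {k} → Word k → List ℕ
letters = map toℕ

contains⇒has : ∀ {k} {π : Word k} {ρ} → Contains π ρ → Has ρ (letters π)
contains⇒has {π = π} {ρ} (ι , mono , so) =
  letters l , Subₚ.map⁺ toℕ (tabulate-⊆ π ι mono)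
  , subst (_≅ ρ) (sym (map-tabulate (lookup π ∘ ι) toℕ)) (tabulate-≅ ρ (toℕ ∘ lookup π ∘ ι) so)
  where l = tabulate (lookup π ∘ ι)

has⇒contains : ∀ {k} {π : Word k} {ρ} → Has ρ (letters π) → Contains π ρ
has⇒contains {π = π} {ρ} (l , s , e) with ⊆-map⁻ toℕ s
... | l′ , s′ , refl with ⊆-positions s′
... | ι , mono , eq = ι ∘ c , (λ a b lt → mono (c a) (c b) (c-mono a b lt)) , so
  where
  len = ≅-length toℕ l′ ρ e
  c : Fin (length ρ) → Fin (length l′)
  c = Fin.cast len
  c-mono : Increasing c
  c-mono a b lt = subst₂ _<_ (sym (Finₚ.toℕ-cast len a)) (sym (Finₚ.toℕ-cast len b)) lt
  so : ∀ a b → SameOrder (toℕ (lookup π (ι (c a)))) (lookup ρ a) (toℕ (lookup π (ι (c b)))) (lookup ρ b)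
  so a b rewrite eq (c a) | eq (c b) = ≅-lookup toℕ l′ ρ len e a b

≅-∷ʳ : ∀ {l ρ x r} → l ≅ ρ → Pointwise (λ y s → SameOrder y s x r) l ρ → l ++ [ x ] ≅ ρ ++ [ r ]
≅-∷ʳ []      []        = [] ∷ []
≅-∷ʳ (h ∷ e) (so ∷ sos) = Pw.++⁺ h (so ∷ []) ∷ ≅-∷ʳ e sos

≅-reverse : ∀ {l ρ} → l ≅ ρ → reverse l ≅ reverse ρ
≅-reverse []                        = []
≅-reverse {x ∷ l} {r ∷ ρ} (h ∷ e) =
  subst₂ _≅_ (sym (unfold-reverse x l)) (sym (unfold-reverse r ρ))
         (≅-∷ʳ (≅-reverse e) (Pw.reverse⁺ (Pw.map swap h)))

has-reverse : ∀ {ρ w} → Has ρ w → Has (reverse ρ) (reverse w)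
has-reverse (l , s , e) = reverse l , Subₚ.reverse⁺ s , ≅-reverse e

infix 4 _⋖_
_⋖_ : List ℕ → List ℕ → Set
l ⋖ l′ = All (λ x → All (x <_) l′) l

≅-++⁻ : ∀ {l} ρ {τ} → l ≅ ρ ++ τ → ρ ⋖ τ →
  ∃ λ l₁ → ∃ λ l₂ → l ≡ l₁ ++ l₂ × l₁ ≅ ρ × l₂ ≅ τ × l₁ ⋖ l₂
≅-++⁻ []      {τ} e [] = [] , _ , refl , [] , e , []
≅-++⁻ (r ∷ ρ) {τ} (h ∷ e) (lt ∷ lts) with ≅-++⁻ ρ e lts
... | l₁ , l₂ , refl , e₁ , e₂ , l₁⋖l₂ = _ ∷ l₁ , l₂ , refl , split l₁ e₁ h ∷ e₁ , e₂ , below l₁ e₁ h lt ∷ l₁⋖l₂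
  where
  split : ∀ {x} l₁ {ρ} → l₁ ≅ ρ → Pointwise (SameOrder x r) (l₁ ++ l₂) (ρ ++ τ) → Pointwise (SameOrder x r) l₁ ρ
  split []       []      h       = []
  split (_ ∷ l₁) (_ ∷ e) (p ∷ h) = p ∷ split l₁ e h
  below : ∀ {x} l₁ {ρ} → l₁ ≅ ρ → Pointwise (SameOrder x r) (l₁ ++ l₂) (ρ ++ τ) → All (r <_) τ → All (x <_) l₂
  below (_ ∷ l₁) (_ ∷ e) (_ ∷ h) lt = below l₁ e h lt
  below []       []      h       lt = go h lt
    where
    go : ∀ {x l τ} → Pointwise (SameOrder x r) l τ → All (r <_) τ → All (x <_) l
    go []        []       = []
    go (so ∷ h)  (lt ∷ a) = Equivalence.from (proj₁ so) lt ∷ go h a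

≅-++⁺ : ∀ {l₁ l₂ ρ τ} → l₁ ≅ ρ → l₂ ≅ τ → l₁ ⋖ l₂ → ρ ⋖ τ → l₁ ++ l₂ ≅ ρ ++ τ
≅-++⁺ []      e₂ _          _          = e₂
≅-++⁺ (h ∷ e₁) e₂ (lt ∷ lts) (lt′ ∷ lts′) = Pw.++⁺ h (cross e₂ lt lt′) ∷ ≅-++⁺ e₁ e₂ lts lts′
  where
  cross : ∀ {x r l τ} → l ≅ τ → All (x <_) l → All (r <_) τ → Pointwise (SameOrder x r) l τ
  cross []      []        []         = []
  cross (_ ∷ e) (p ∷ ps) (q ∷ qs) =
    (mk⇔ (λ _ → q) (λ _ → p) , mk⇔ (λ g → contradiction g (ℕₚ.<-asym p)) (λ g → contradiction g (ℕₚ.<-asym q)))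
    ∷ cross e ps qs

-- Active letters, heights and masks.

count : ℕ → List ℕ → ℕ
count x w = ∑ w λ y → ⟦ y ≟ x ⟧

data Op : Set where
  add : Op
  del : ℕ → Op

-- Here the subsequence comes in two pieces and the word gets cut accordingly, at a place between an
-- occurrence of ρ and one of τ.
++-⊆⁻ : ∀ {A : Set} (l₁ : List A) {l₂} w → l₁ ++ l₂ ⊆ w → ∃ λ p → ∃ λ s → w ≡ p ++ s × l₁ ⊆ p × l₂ ⊆ s
++-⊆⁻ []       w       sub          = [] , w , refl , [] , sub
++-⊆⁻ (x ∷ l₁) (y ∷ w) (.y ∷ʳ sub)  = let p , s , eq , a , b = ++-⊆⁻ (x ∷ l₁) w sub
                                      in y ∷ p , s , cong (y ∷_) eq , y ∷ʳ a , b
++-⊆⁻ (x ∷ l₁) (y ∷ w) (refl ∷ sub) = let p , s , eq , a , b = ++-⊆⁻ l₁ w sub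
                                      in y ∷ p , s , cong (y ∷_) eq , refl ∷ a , b

module Live (k : ℕ) (τ : List ℕ) where

  Live : ℕ → List ℕ → Set
  Live x s = ∃ λ l → l ⊆ s × l ≅ τ × All (x <_) l

  live? : ∀ x s → Dec (Live x s)
  live? x = anySublist? λ l → (l ≅? τ) ×-dec All.all? (x <?_) l

  live-↓ : ∀ {x y s} → x ≤ y → Live y s → Live x s
  live-↓ x≤y (l , s , e , a) = l , s , e , All.map (ℕₚ.≤-<-trans x≤y) a

  live-⊆ : ∀ {x s s′} → s ⊆ s′ → Live x s → Live x s′
  live-⊆ s⊆ (l , s , r) = l , ⊆-trans s s⊆ , r

  -- Liveness passes to smaller values (`live-↓`), so the number of live values below `n` is one
  -- more than the largest of them, which a search from the top finds.
  threshold : ℕ → List ℕ → ℕ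
  threshold zero    s = 0
  threshold (suc n) s with live? n s
  ... | yes _ = suc n
  ... | no _  = threshold n s

  threshold-live : ∀ n {x s} → x < threshold n s → Live x s
  threshold-live (suc n) {s = s} x< with live? n s
  ... | yes lv = live-↓ (ℕ.s≤s⁻¹ x<) lv
  ... | no _   = threshold-live n x<

  live-threshold : ∀ n {x s} → x < n → Live x s → x < threshold n s
  live-threshold (suc n) {x} {s} x<n lv with live? n s
  ... | yes _ = x<n
  ... | no ¬l = live-threshold n (ℕₚ.≤∧≢⇒< (ℕ.s≤s⁻¹ x<n) λ { refl → ¬l lv }) lv

  threshold-≤ : ∀ n s → threshold n s ≤ n
  threshold-≤ zero    s = ℕ.z≤n
  threshold-≤ (suc n) s with live? n s
  ... | yes _ = ℕₚ.≤-refl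
  ... | no _  = ℕₚ.m≤n⇒m≤1+n (threshold-≤ n s)

  threshold-mono : ∀ n {s s′} → (∀ {x} → Live x s → Live x s′) → threshold n s ≤ threshold n s′
  threshold-mono n {s} {s′} f with threshold n s in eq
  ... | zero  = ℕ.z≤n
  ... | suc t = live-threshold n (ℕₚ.≤-trans (ℕₚ.≤-reflexive (sym eq)) (threshold-≤ n s))
                  (f (threshold-live n (ℕₚ.≤-reflexive (sym eq))))

  height : List ℕ → ℕ
  height = threshold k

  height-⊆ : ∀ {s s′} → s ⊆ s′ → height s ≤ height s′
  height-⊆ s⊆ = threshold-mono k (live-⊆ s⊆)

  -- If an occurrence of τ above `x` uses the letter `u`, then `x` is below `u`; and `u`, being
  -- active, already has an occurrence above itself in `s`.
  height-active : ∀ {u s} → u < height s → height (u ∷ s) ≡ height s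
  height-active {u} {s} u< = ℕₚ.≤-antisym (threshold-mono k f) (height-⊆ (u ∷ʳ ⊆-refl))
    where
    f : ∀ {x} → Live x (u ∷ s) → Live x s
    f (l , .u ∷ʳ s , r)                = l , s , r
    f (_ , refl ∷ s , _ , x<u ∷ _) = live-↓ (ℕₚ.<⇒≤ x<u) (threshold-live k u<)

  mask : List ℕ → List (Maybe ℕ)
  mask []      = []
  mask (u ∷ s) with u <? height s
  ... | yes _ = nothing ∷ mask s
  ... | no _  = just u ∷ mask s

  visible : List (Maybe ℕ) → List ℕ
  visible = catMaybes

  mask-active : ∀ {u s} → u < height s → mask (u ∷ s) ≡ nothing ∷ mask s
  mask-active {u} {s} u< with u <? height s
  ... | yes _ = refl
  ... | no u≮ = contradiction u< u≮

  mask-inactive : ∀ {u s} → ¬ u < height s → mask (u ∷ s) ≡ just u ∷ mask s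
  mask-inactive {u} {s} u≮ with u <? height s
  ... | yes u< = contradiction u< u≮
  ... | no _   = refl

  visible-⊆ : ∀ s → visible (mask s) ⊆ s
  visible-⊆ []      = []
  visible-⊆ (u ∷ s) with u <? height s
  ... | yes _ = u ∷ʳ visible-⊆ s
  ... | no _  = refl ∷ visible-⊆ s

  private
    -- Any active letter of the subsequence brings along an occurrence of τ above itself, and this
    -- one may replace whatever the subsequence was needed for.
    inactive-or-live : ∀ s {l} → l ⊆ s → l ⊆ visible (mask s) ⊎ (∃ λ y → y ∈ l × Live y s)
    inactive-or-live []      []         = inj₁ []
    inactive-or-live (u ∷ s) (_ ∷ʳ sub) with u <? height s | inactive-or-live s sub
    ... | yes _ | inj₁ sub′           = inj₁ sub′
    ... | no _  | inj₁ sub′           = inj₁ (u ∷ʳ sub′)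
    ... | _     | inj₂ (y , y∈ , lv) = inj₂ (y , y∈ , live-⊆ (u ∷ʳ ⊆-refl) lv)
    inactive-or-live (u ∷ s) (refl ∷ sub) with u <? height s | inactive-or-live s sub
    ... | yes u< | _                   = inj₂ (u , here refl , live-⊆ (u ∷ʳ ⊆-refl) (threshold-live k u<))
    ... | no _   | inj₁ sub′           = inj₁ (refl ∷ sub′)
    ... | no _   | inj₂ (y , y∈ , lv) = inj₂ (y , there y∈ , live-⊆ (u ∷ʳ ⊆-refl) lv)

  -- An occurrence of τ through an active letter y can be replaced by one above y and further
  -- to the right, so the inactive letters alone determine what is live.
  live-visible : ∀ s {x} → Live x s → Live x (visible (mask s))
  live-visible []      lv = lv
  live-visible (u ∷ s) (l , .u ∷ʳ sub , r) with u <? height s | live-visible s (l , sub , r)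
  ... | yes _ | lv = lv
  ... | no _  | lv = live-⊆ (u ∷ʳ ⊆-refl) lv
  live-visible (u ∷ s) (.u ∷ l , refl ∷ sub , e , x<u ∷ x<l) with u <? height s
  ... | yes u< = live-visible s (live-↓ (ℕₚ.<⇒≤ x<u) (threshold-live k u<))
  ... | no _ with inactive-or-live s sub
  ... | inj₁ sub′          = u ∷ l , refl ∷ sub′ , e , x<u ∷ x<l
  ... | inj₂ (y , y∈ , lv) = live-⊆ (u ∷ʳ ⊆-refl) (live-visible s (live-↓ (ℕₚ.<⇒≤ (All.lookup x<l y∈)) lv))

  height-visible : ∀ s → height (visible (mask s)) ≡ height s
  height-visible s = ℕₚ.≤-antisym (height-⊆ (visible-⊆ s)) (threshold-mono k (live-visible s))

  below : ℕ → List ℕ → List ℕ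
  below h = filter (_<? h)

  active : ℕ → List ℕ → ℕ
  active x []      = 0
  active x (u ∷ s) = ⟦ (u ≟ x) ×-dec (u <? height s) ⟧ + active x s

  -- Heights weakly increase towards the left, so a value not below the height of `s` is not below
  -- the height at any position inside `s`.
  active-none : ∀ {x} s → height s ≤ x → active x s ≡ 0
  active-none []      h≤x = refl
  active-none {x} (u ∷ s) h≤x = cong₂ _+_
    (⟦⟧-no ((u ≟ x) ×-dec (u <? height s)) (λ { (refl , u<) → ℕₚ.<⇒≱ u< (ℕₚ.≤-trans (height-⊆ (u ∷ʳ ⊆-refl)) h≤x) }))
    (active-none s (ℕₚ.≤-trans (height-⊆ (u ∷ʳ ⊆-refl)) h≤x))

  count-visible : ∀ x s → count x s ≡ count x (visible (mask s)) + active x s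
  count-visible x []      = refl
  count-visible x (u ∷ s) = go (u <? height s)
    where
    comm : ∀ a b c → a + (b + c) ≡ b + (a + c)
    comm = solve-∀
    go : Dec (u < height s) → count x (u ∷ s) ≡ count x (visible (mask (u ∷ s))) + active x (u ∷ s)
    go (yes u<) rewrite mask-active u< | count-visible x s
                      | ⟦⟧-cong ((u ≟ x) ×-dec (u <? height s)) (u ≟ x) proj₁ (_, u<) =
      comm ⟦ u ≟ x ⟧ (count x (visible (mask s))) (active x s)
    go (no u≮) rewrite mask-inactive u≮ | count-visible x s
                     | ⟦⟧-no ((u ≟ x) ×-dec (u <? height s)) (u≮ ∘ proj₂) =
      sym (ℕₚ.+-assoc ⟦ u ≟ x ⟧ _ _)

  drops : (ℕ → ℕ) → ℕ → ℕ → List Op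
  drops m zero    h′ = []
  drops m (suc h) h′ with h′ ≤? h
  ... | yes _ = del (m h) ∷ drops m h h′
  ... | no _  = []

  -- By `height-visible` the visible letters yield the true heights, so the operations are shared by
  -- all words with the same mask and the same `m`.
  ops : (ℕ → ℕ) → List (Maybe ℕ) → List Op
  -- For nonempty τ the height of the empty word is 0 and nothing remains to be deleted; for empty τ
  -- it is `k`, and all the deletions happen here.
  ops m []            = drops m (height []) 0
  ops m (nothing ∷ κ) = add ∷ ops m κ
  ops m (just x ∷ κ)  = drops m (height (x ∷ visible κ)) (height (visible κ)) ++ ops m κ

  module Avoidance (ρ : List ℕ) (ρ⋖τ : ρ ⋖ τ) (ρ≢[] : ρ ≢ []) where

    has⇒bad : ∀ {w} → All (_< k) w → Has (ρ ++ τ) w →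
      ∃ λ p → ∃ λ s → w ≡ p ++ s × Has ρ (below (height s) p)
    has⇒bad {w} w<k (l , sub , e) with ≅-++⁻ ρ e ρ⋖τ
    ... | l₁ , l₂ , refl , e₁ , e₂ , l₁⋖l₂ with ++-⊆⁻ l₁ w sub
    ... | p , s , refl , l₁⊆p , l₂⊆s = p , s , refl , l₁ , l₁⊆ , e₁
      where
      l₁< : All (_< height s) l₁
      l₁< = All.zipWith (λ (x<k , x<) → live-threshold k x<k (l₂ , l₂⊆s , e₂ , x<))
                        (Subₚ.All-resp-⊆ l₁⊆p (Allₚ.++⁻ˡ p w<k) , l₁⋖l₂)
      l₁⊆ : l₁ ⊆ below (height s) p
      l₁⊆ = subst (_⊆ below (height s) p) (filter-all (_<? height s) l₁<)
                  (Subₚ.filter⁺ (_<? height s) (_<? height s) (λ { refl z → z }) l₁⊆p)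

    -- The value just below the height is live, and one occurrence of τ above it lies above all
    -- letters of the occurrence of ρ at once. A nonempty ρ guarantees that the height is positive.
    bad⇒has : ∀ p s → Has ρ (below (height s) p) → Has (ρ ++ τ) (p ++ s)
    bad⇒has p s ([] , sub , []) = contradiction refl ρ≢[]
    bad⇒has p s (x ∷ l , sub , e) = join (height s) refl (Subₚ.All-resp-⊆ sub (Allₚ.all-filter (_<? height s) p))
      where
      join : ∀ h → h ≡ height s → All (_< h) (x ∷ l) → Has (ρ ++ τ) (p ++ s)
      join zero    eq (() ∷ _)
      join (suc t) eq lt with threshold-live k {t} (ℕₚ.≤-reflexive eq)
      ... | l₂ , sub₂ , e₂ , t<l₂ =
        x ∷ l ++ l₂ , Subₚ.++⁺ (⊆-trans sub (Subₚ.filter-⊆ (_<? height s) p)) sub₂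
        , ≅-++⁺ e e₂ (All.map (λ x<st → All.map (ℕₚ.≤-<-trans (ℕ.s≤s⁻¹ x<st)) t<l₂) lt) ρ⋖τ

-- Walks and their reversal.

module Paths {X O : Set} (_≟_ : DecidableEquality X) where

  paths : (O → X → List X) → List O → X → X → ℕ
  paths step []      x y = ⟦ x ≟ y ⟧
  paths step (o ∷ ω) x y = ∑ (step o x) λ z → paths step ω z y

  module _ (fwd bwd : O → X → List X) (Good : X → Set)
           (fwd-good : ∀ o {x} → Good x → All Good (fwd o x))
           (bwd-good : ∀ o {x} → Good x → All Good (bwd o x))
           (adjoint : ∀ o {x y} → Good x → Good y →
                      ∑ (fwd o x) (λ z → ⟦ z ≟ y ⟧) ≡ ∑ (bwd o y) (λ z → ⟦ x ≟ z ⟧))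
           where

    paths-∷ʳ : ∀ ω o {x y} → Good x → Good y →
               paths fwd (ω ++ [ o ]) x y ≡ ∑ (bwd o y) (λ z → paths fwd ω x z)
    paths-∷ʳ []       o gx gy = adjoint o gx gy
    paths-∷ʳ (o′ ∷ ω) o gx gy =
      trans (∑-cong-All (fwd o′ _) (All.map (λ gz → paths-∷ʳ ω o gz gy) (fwd-good o′ gx)))
            (∑-swap (fwd o′ _) (bwd o _) _)

    -- On the good states, which both preserve, `fwd o` and `bwd o` are transposed matrices;
    -- transposing a product reverses its factors.
    paths-adjoint : ∀ ω {x y} → Good x → Good y → paths fwd (reverse ω) x y ≡ paths bwd ω y x
    paths-adjoint []      {x} {y} gx gy = ⟦⟧-cong (x ≟ y) (y ≟ x) sym sym
    paths-adjoint (o ∷ ω) {x} {y} gx gy rewrite unfold-reverse o ω =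
      trans (paths-∷ʳ (reverse ω) o gx gy)
            (∑-cong-All (bwd o y) (All.map (λ gz → paths-adjoint ω gx gz) (bwd-good o gy)))

∑-upTo : ∀ n (f : ℕ → ℕ) → ∑ (upTo (suc n)) f ≡ ∑ (upTo n) f + f n
∑-upTo n f = trans (cong (λ xs → ∑ xs f) (sym (applyUpTo-∷ʳ id n)))
             (trans (∑-++ (upTo n) [ n ] f) (cong (∑ (upTo n) f +_) (ℕₚ.+-identityʳ (f n))))

∑-allFin : ∀ n (f : ℕ → ℕ) → ∑ (allFin n) (f ∘ toℕ) ≡ ∑ (upTo n) f
∑-allFin n f = go n id id (λ _ → refl)
  where
  go : ∀ n {k} (g : Fin n → Fin k) (h : ℕ → ℕ) → (∀ i → toℕ (g i) ≡ h (toℕ i)) →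
       ∑ (tabulate g) (f ∘ toℕ) ≡ ∑ (applyUpTo h n) f
  go zero    g h eq = refl
  go (suc n) g h eq = cong₂ _+_ (cong f (eq zero)) (go n (g ∘ suc) (h ∘ suc) (eq ∘ suc))

∑-upTo-< : ∀ {h n} (f : ℕ → ℕ) → h ≤ n → ∑ (upTo n) (λ u → ⟦ u <? h ⟧ * f u) ≡ ∑ (upTo h) f
∑-upTo-< {h} {n} f h≤n with n ≟ h
... | yes refl = ∑-cong-All (upTo n) (Allₚ.applyUpTo⁺₁ id n λ {u} u<n →
                   trans (cong (_* f u) (⟦⟧-yes (u <? n) u<n)) (ℕₚ.*-identityˡ (f u)))
∑-upTo-< {h} {zero}  f ℕ.z≤n | no n≢h = contradiction refl n≢h
∑-upTo-< {h} {suc n} f h≤n   | no n≢h =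
  trans (∑-upTo n _)
  (trans (cong (∑ (upTo n) (λ u → ⟦ u <? h ⟧ * f u) +_)
               (cong (_* f n) (⟦⟧-no (n <? h) (ℕₚ.≤⇒≯ h≤n′))))
  (trans (ℕₚ.+-identityʳ _) (∑-upTo-< f h≤n′)))
  where
  h≤n′ : h ≤ n
  h≤n′ = ℕ.s≤s⁻¹ (ℕₚ.≤∧≢⇒< h≤n (n≢h ∘ sym))

count-below : ∀ {x h} w → x < h → count x (filter (_<? h) w) ≡ count x w
count-below {x} {h} []      x<h = refl
count-below {x} {h} (y ∷ w) x<h with y <? h
... | yes y<h rewrite filter-accept (_<? h) {xs = w} y<h = cong (⟦ y ≟ x ⟧ +_) (count-below w x<h)
... | no y≮h rewrite filter-reject (_<? h) {xs = w} y≮h =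
  trans (count-below w x<h) (cong (_+ count x w) (sym (⟦⟧-no (y ≟ x) λ { refl → y≮h x<h })))

count-∉ : ∀ {x} w → All (_< x) w → count x w ≡ 0
count-∉ {x} w w<x = ∑-vanish w (All.map (λ {y} y<x → ⟦⟧-no (y ≟ x) (ℕₚ.<⇒≢ y<x)) w<x)

below-below : ∀ {h′ h} w → h′ ≤ h → filter (_<? h′) (filter (_<? h) w) ≡ filter (_<? h′) w
below-below []      h′≤h = refl
below-below {h′} {h} (y ∷ w) h′≤h with y <? h | y <? h′
... | yes y<h | yes y<h′
  rewrite filter-accept (_<? h) {xs = w} y<h
        | filter-accept (_<? h′) {xs = filter (_<? h) w} y<h′
        | filter-accept (_<? h′) {xs = w} y<h′ = cong (y ∷_) (below-below w h′≤h)
... | yes y<h | no y≮h′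
  rewrite filter-accept (_<? h) {xs = w} y<h
        | filter-reject (_<? h′) {xs = filter (_<? h) w} y≮h′
        | filter-reject (_<? h′) {xs = w} y≮h′ = below-below w h′≤h
... | no y≮h | yes y<h′ = contradiction (ℕₚ.≤-trans y<h′ h′≤h) y≮h
... | no y≮h | no y≮h′
  rewrite filter-reject (_<? h) {xs = w} y≮h
        | filter-reject (_<? h′) {xs = w} y≮h′ = below-below w h′≤h

State : Set
State = ℕ × List ℕ

_≟ˢ_ : DecidableEquality State
_≟ˢ_ = Productₚ.≡-dec _≟_ (≡-dec _≟_)

-- The recursion distinguishes whether the front letter of the result is new or old, so that nothing
-- is listed twice when `v` does not occur in `w`.
ins : ℕ → ℕ → List ℕ → List (List ℕ)
ins zero    v w       = [ w ]
ins (suc m) v []      = map (v ∷_) (ins m v [])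
ins (suc m) v (x ∷ w) = map (v ∷_) (ins m v (x ∷ w)) ++ map (x ∷_) (ins (suc m) v w)

∑-ins-[] : ∀ m v f → ∑ (ins (suc m) v []) f ≡ ∑ (ins m v []) (f ∘ (v ∷_))
∑-ins-[] m v f = ∑-map (v ∷_) (ins m v []) f

∑-ins-∷ : ∀ m v x w f → ∑ (ins (suc m) v (x ∷ w)) f ≡
          ∑ (ins m v (x ∷ w)) (f ∘ (v ∷_)) + ∑ (ins (suc m) v w) (f ∘ (x ∷_))
∑-ins-∷ m v x w f = trans (∑-++ (map (v ∷_) (ins m v (x ∷ w))) _ f)
  (cong₂ _+_ (∑-map (v ∷_) (ins m v (x ∷ w)) f) (∑-map (x ∷_) (ins (suc m) v w) f))

ins-All : ∀ {P : ℕ → Set} m {v} w → P v → All P w → All (All P) (ins m v w)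
ins-All zero    w       pv pw = pw ∷ []
ins-All (suc m) []      pv pw = Allₚ.map⁺ (All.map (pv ∷_) (ins-All m [] pv pw))
ins-All (suc m) (x ∷ w) pv (px ∷ pw) =
  Allₚ.++⁺ (Allₚ.map⁺ (All.map (pv ∷_) (ins-All m (x ∷ w) pv (px ∷ pw))))
           (Allₚ.map⁺ (All.map (px ∷_) (ins-All (suc m) w pv pw)))

module Process {V : List ℕ → Set} (V? : ∀ w → Dec (V w)) (V-⊆ : ∀ {w w′} → w ⊆ w′ → V w′ → V w) where

  open Paths {X = State} {O = Op} _≟ˢ_ public using (paths; paths-adjoint)

  -- At height `suc h` the value to be lost is `h`. Multiplicities are enforced at this moment only,
  -- when no further active copy of `h` can follow.
  fwd : Op → State → List State
  fwd add     (h , w)     = map (λ u → h , u ∷ w) (filter (λ u → V? (u ∷ w)) (upTo h))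
  fwd (del m) (zero , w)  = []
  fwd (del m) (suc h , w) with count h w ≟ m
  ... | yes _ = [ (h , filter (_<? h) w) ]
  ... | no _  = []

  bwd : Op → State → List State
  bwd add     (h , [])    = []
  bwd add     (h , u ∷ w) = [ (h , w) ]
  bwd (del m) (h , w)     = map (suc h ,_) (filter V? (ins m h w))

  -- Outside these states adjointness fails: an old letter `h` could not be told from an inserted
  -- one, and a removed letter not below the height could not be appended again.
  Good : State → Set
  Good (h , w) = All (_< h) w × V w

  fwd-good : ∀ o {x} → Good x → All Good (fwd o x)
  fwd-good add     {h , w} (w<h , _) =
    Allₚ.map⁺ (All.zipWith (λ (v , u<h) → u<h ∷ w<h , v)
      (Allₚ.all-filter (λ u → V? (u ∷ w)) (upTo h)
      , Allₚ.filter⁺ (λ u → V? (u ∷ w)) (Allₚ.applyUpTo⁺₁ id h id)))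
  fwd-good (del m) {zero , w}  g = []
  fwd-good (del m) {suc h , w} (_ , v) with count h w ≟ m
  ... | yes _ = (Allₚ.all-filter (_<? h) w , V-⊆ (Subₚ.filter-⊆ (_<? h) w) v) ∷ []
  ... | no _  = []

  bwd-good : ∀ o {x} → Good x → All Good (bwd o x)
  bwd-good add     {h , []}    g = []
  bwd-good add     {h , u ∷ w} (_ ∷ w<h , v) = (w<h , V-⊆ (u ∷ʳ ⊆-refl) v) ∷ []
  bwd-good (del m) {h , w} (w<h , _) =
    Allₚ.map⁺ (All.zipWith (λ (v , z<h) → z<h , v)
      (Allₚ.all-filter V? (ins m h w)
      , Allₚ.filter⁺ V? (ins-All m w (ℕₚ.n<1+n h) (All.map ℕₚ.m<n⇒m<1+n w<h))))

_≟ᴸ_ : DecidableEquality (List ℕ)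
_≟ᴸ_ = ≡-dec _≟_

≟ᴸ-∷ : ∀ y w x z → ⟦ (y ∷ w) ≟ᴸ (x ∷ z) ⟧ ≡ ⟦ y ≟ x ⟧ * ⟦ w ≟ᴸ z ⟧
≟ᴸ-∷ y w x z =
  trans (⟦⟧-cong ((y ∷ w) ≟ᴸ (x ∷ z)) ((y ≟ x) ×-dec (w ≟ᴸ z))
                 (λ { refl → refl , refl }) (λ { (refl , refl) → refl }))
        (⟦⟧-× (y ≟ x) (w ≟ᴸ z))

count-0⇒< : ∀ {h} w → All (_< suc h) w → count h w ≡ 0 → All (_< h) w
count-0⇒< []          []          eq = []
count-0⇒< {h} (y ∷ w) (y≤h ∷ w≤h) eq with y ≟ h
... | no y≢h = ℕₚ.≤∧≢⇒< (ℕ.s≤s⁻¹ y≤h) y≢h ∷ count-0⇒< w w≤h eq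

-- As `w₂` lies below `h`, the front letter of `w` decides which clause of `ins` may have produced
-- it: an `h` must be inserted, anything else must be the front letter of `w₂`.
ins-multiplicity : ∀ m {h} w w₂ → All (_< suc h) w → All (_< h) w₂ →
  ∑ (ins m h w₂) (λ z → ⟦ w ≟ᴸ z ⟧) ≡ ⟦ count h w ≟ m ⟧ * ⟦ filter (_<? h) w ≟ᴸ w₂ ⟧
ins-multiplicity zero {h} w w₂ w≤h w₂<h =
  trans (ℕₚ.+-identityʳ _)
  (trans (⟦⟧-cong (w ≟ᴸ w₂) ((count h w ≟ 0) ×-dec (filter (_<? h) w ≟ᴸ w₂))
           (λ { refl → count-∉ w₂ w₂<h , filter-all (_<? h) w₂<h })
           (λ (c , e) → trans (sym (filter-all (_<? h) (count-0⇒< w w≤h c))) e))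
         (⟦⟧-× (count h w ≟ 0) (filter (_<? h) w ≟ᴸ w₂)))
ins-multiplicity (suc m) {h} [] [] w≤h w₂<h =
  trans (∑-ins-[] m h _) (∑-zero (ins m h []))
ins-multiplicity (suc m) {h} [] (x ∷ w₂) w≤h w₂<h =
  trans (∑-ins-∷ m h x w₂ _) (cong₂ _+_ (∑-zero (ins m h (x ∷ w₂))) (∑-zero (ins (suc m) h w₂)))
ins-multiplicity (suc m) {h} (y ∷ w) [] (y≤h ∷ w≤h) [] =
  trans (∑-ins-[] m h _)
  (trans (∑-cong (ins m h []) (≟ᴸ-∷ y w h))
  (trans (∑-*ˡ ⟦ y ≟ h ⟧ (ins m h []) _) step))
  where
  step : ⟦ y ≟ h ⟧ * ∑ (ins m h []) (λ z → ⟦ w ≟ᴸ z ⟧) ≡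
         ⟦ count h (y ∷ w) ≟ suc m ⟧ * ⟦ filter (_<? h) (y ∷ w) ≟ᴸ [] ⟧
  step with y ≟ h
  ... | yes refl rewrite filter-reject (_<? h) {xs = w} (ℕₚ.<-irrefl {h} refl) =
    trans (ℕₚ.*-identityˡ _) (trans (ins-multiplicity m w [] w≤h [])
      (cong (_* ⟦ filter (_<? h) w ≟ᴸ [] ⟧)
            (⟦⟧-cong (count h w ≟ m) (suc (count h w) ≟ suc m) (cong suc) ℕₚ.suc-injective)))
  ... | no y≢h rewrite filter-accept (_<? h) {xs = w} (ℕₚ.≤∧≢⇒< (ℕ.s≤s⁻¹ y≤h) y≢h) =
    sym (ℕₚ.*-zeroʳ ⟦ count h w ≟ suc m ⟧)
ins-multiplicity (suc m) {h} (y ∷ w) (x ∷ w₂) (y≤h ∷ w≤h) (x<h ∷ w₂<h) =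
  trans (∑-ins-∷ m h x w₂ _)
  (trans (cong₂ _+_
    (trans (∑-cong (ins m h (x ∷ w₂)) (≟ᴸ-∷ y w h)) (∑-*ˡ ⟦ y ≟ h ⟧ (ins m h (x ∷ w₂)) _))
    (trans (∑-cong (ins (suc m) h w₂) (≟ᴸ-∷ y w x)) (∑-*ˡ ⟦ y ≟ x ⟧ (ins (suc m) h w₂) _)))
    step)
  where
  step : ⟦ y ≟ h ⟧ * ∑ (ins m h (x ∷ w₂)) (λ z → ⟦ w ≟ᴸ z ⟧) +
         ⟦ y ≟ x ⟧ * ∑ (ins (suc m) h w₂) (λ z → ⟦ w ≟ᴸ z ⟧) ≡
         ⟦ count h (y ∷ w) ≟ suc m ⟧ * ⟦ filter (_<? h) (y ∷ w) ≟ᴸ (x ∷ w₂) ⟧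
  step with y ≟ h
  ... | yes refl rewrite ⟦⟧-no (h ≟ x) (λ { refl → ℕₚ.<-irrefl refl x<h })
                       | filter-reject (_<? h) {xs = w} (ℕₚ.<-irrefl {h} refl) =
    trans (ℕₚ.+-identityʳ _) (trans (ℕₚ.*-identityˡ _) (trans (ins-multiplicity m w (x ∷ w₂) w≤h (x<h ∷ w₂<h))
      (cong (_* ⟦ filter (_<? h) w ≟ᴸ (x ∷ w₂) ⟧)
            (⟦⟧-cong (count h w ≟ m) (suc (count h w) ≟ suc m) (cong suc) ℕₚ.suc-injective))))
  ... | no y≢h rewrite filter-accept (_<? h) {xs = w} (ℕₚ.≤∧≢⇒< (ℕ.s≤s⁻¹ y≤h) y≢h)
                     | ≟ᴸ-∷ y (filter (_<? h) w) x w₂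
                     | ins-multiplicity (suc m) w w₂ w≤h w₂<h =
    comm ⟦ y ≟ x ⟧ ⟦ count h w ≟ suc m ⟧ ⟦ filter (_<? h) w ≟ᴸ w₂ ⟧
    where
    comm : ∀ a b c → a * (b * c) ≡ b * (a * c)
    comm = solve-∀

module ProcessAdjoint {V : List ℕ → Set} (V? : ∀ w → Dec (V w)) (V-⊆ : ∀ {w w′} → w ⊆ w′ → V w′ → V w) where

  open Process V? V-⊆ public

  private
    ≟ˢ-, : ∀ h w h′ w′ → ⟦ (h , w) ≟ˢ (h′ , w′) ⟧ ≡ ⟦ h ≟ h′ ⟧ * ⟦ w ≟ᴸ w′ ⟧
    ≟ˢ-, h w h′ w′ =
      trans (⟦⟧-cong ((h , w) ≟ˢ (h′ , w′)) ((h ≟ h′) ×-dec (w ≟ᴸ w′))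
                     (λ { refl → refl , refl }) (λ { (refl , refl) → refl }))
            (⟦⟧-× (h ≟ h′) (w ≟ᴸ w′))

  adjoint : ∀ o {x y} → Good x → Good y →
            ∑ (fwd o x) (λ z → ⟦ z ≟ˢ y ⟧) ≡ ∑ (bwd o y) (λ z → ⟦ x ≟ˢ z ⟧)
  adjoint add {h , w} {h′ , []} gx gy =
    trans (∑-map _ (filter (λ u → V? (u ∷ w)) (upTo h)) _)
          (∑-vanish (filter (λ u → V? (u ∷ w)) (upTo h))
                    (All.universal (λ u → ⟦⟧-no ((h , u ∷ w) ≟ˢ (h′ , [])) λ ()) _))
  adjoint add {h , w} {h′ , v ∷ w′} gx (v<h′ ∷ _ , vw) =
    trans (∑-map _ (filter (λ u → V? (u ∷ w)) (upTo h)) _)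
    (trans (∑-filter (λ u → V? (u ∷ w)) (upTo h) _)
    (trans (∑-cong (upTo h) term)
    (trans (∑-*ˡ ⟦ (h , w) ≟ˢ (h′ , w′) ⟧ (upTo h) _)
    (trans (⟦⟧*-cong ((h , w) ≟ˢ (h′ , w′)) {n = 1} λ { refl →
             trans (∑-≟ _≟_ (λ u → ⟦ V? (u ∷ w) ⟧) (Uniqueₚ.upTo⁺ h) (∈-upTo⁺ v<h′)) (⟦⟧-yes (V? (v ∷ w)) vw) })
           (trans (ℕₚ.*-identityʳ _) (sym (ℕₚ.+-identityʳ _)))))))
    where
    comm : ∀ a b c d → a * (b * (c * d)) ≡ b * d * (c * a)
    comm = solve-∀
    term : ∀ u → ⟦ V? (u ∷ w) ⟧ * ⟦ (h , u ∷ w) ≟ˢ (h′ , v ∷ w′) ⟧ ≡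
                 ⟦ (h , w) ≟ˢ (h′ , w′) ⟧ * (⟦ v ≟ u ⟧ * ⟦ V? (u ∷ w) ⟧)
    term u rewrite ≟ˢ-, h (u ∷ w) h′ (v ∷ w′) | ≟ˢ-, h w h′ w′ | ≟ᴸ-∷ u w v w′
                 | ⟦⟧-cong (v ≟ u) (u ≟ v) sym sym =
      comm ⟦ V? (u ∷ w) ⟧ ⟦ h ≟ h′ ⟧ ⟦ u ≟ v ⟧ ⟦ w ≟ᴸ w′ ⟧
  adjoint (del m) {zero , w} {h′ , w′} gx gy =
    sym (trans (∑-map _ (filter V? (ins m h′ w′)) _)
               (∑-vanish (filter V? (ins m h′ w′))
                  (All.universal (λ z → ⟦⟧-no ((zero , w) ≟ˢ (suc h′ , z)) λ ()) _)))
  adjoint (del m) {suc h , w} {h′ , w′} (w≤h , vw) (w′<h′ , _) =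
    trans left (sym (trans (∑-map _ (filter V? (ins m h′ w′)) _)
    (trans (∑-filter V? (ins m h′ w′) _)
    (trans (∑-cong (ins m h′ w′) term)
    (trans (∑-*ˡ ⟦ h ≟ h′ ⟧ (ins m h′ w′) _)
           (⟦⟧*-cong (h ≟ h′) λ { refl → ins-multiplicity m w w′ w≤h w′<h′ }))))))
    where
    comm : ∀ a b c → c * (a * b) + 0 ≡ a * (c * b)
    comm = solve-∀
    left : ∑ (fwd (del m) (suc h , w)) (λ z → ⟦ z ≟ˢ (h′ , w′) ⟧) ≡
           ⟦ h ≟ h′ ⟧ * (⟦ count h w ≟ m ⟧ * ⟦ filter (_<? h) w ≟ᴸ w′ ⟧)
    left with count h w ≟ m
    ... | yes _ rewrite ≟ˢ-, h (filter (_<? h) w) h′ w′ = comm₁ ⟦ h ≟ h′ ⟧ _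
      where
      comm₁ : ∀ a b → a * b + 0 ≡ a * (1 * b)
      comm₁ = solve-∀
    ... | no _ = sym (ℕₚ.*-zeroʳ ⟦ h ≟ h′ ⟧)
    term : ∀ z → ⟦ V? z ⟧ * ⟦ (suc h , w) ≟ˢ (suc h′ , z) ⟧ ≡ ⟦ h ≟ h′ ⟧ * ⟦ w ≟ᴸ z ⟧
    term z rewrite ≟ˢ-, (suc h) w (suc h′) z
                 | ⟦⟧-cong (suc h ≟ suc h′) (h ≟ h′) ℕₚ.suc-injective (cong suc) with w ≟ᴸ z
    ... | yes refl rewrite ⟦⟧-yes (V? w) vw = ℕₚ.*-identityˡ _
    ... | no _ rewrite ℕₚ.*-zeroʳ ⟦ h ≟ h′ ⟧ = ℕₚ.*-zeroʳ ⟦ V? z ⟧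

  adjointness : ∀ ω {x y} → Good x → Good y → paths fwd ω x y ≡ paths bwd (reverse ω) y x
  adjointness ω gx gy =
    trans (cong (λ ω′ → paths fwd ω′ _ _) (sym (reverse-involutive ω)))
          (paths-adjoint fwd bwd Good fwd-good bwd-good adjoint (reverse ω) gx gy)

-- Words with a prescribed mask as walks.

_≟ᴹ_ : DecidableEquality (List (Maybe ℕ))
_≟ᴹ_ = ≡-dec (Maybeₚ.≡-dec _≟_)

module MaskedWalks (k : ℕ) (τ : List ℕ) {V : List ℕ → Set} (V? : ∀ w → Dec (V w))
            (V-⊆ : ∀ {w w′} → w ⊆ w′ → V w′ → V w) (m : ℕ → ℕ) where

  open Live k τ
  open ProcessAdjoint V? V-⊆

  -- The word s, read after the state w (the letters read so far that are below the current
  -- height, last one first), only runs through states satisfying V.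
  Run : List ℕ → List ℕ → Set
  Run w []      = ⊤
  Run w (u ∷ s) with u <? height s
  ... | yes _ = V (u ∷ w) × Run (u ∷ w) s
  ... | no _  = Run (below (height s) w) s

  run? : ∀ w s → Dec (Run w s)
  run? w []      = yes tt
  run? w (u ∷ s) with u <? height s
  ... | yes _ = V? (u ∷ w) ×-dec run? (u ∷ w) s
  ... | no _  = run? (below (height s) w) s

  run-active : ∀ {w u s} → u < height s → Run w (u ∷ s) ≡ (V (u ∷ w) × Run (u ∷ w) s)
  run-active {w} {u} {s} u< with u <? height s
  ... | yes _ = refl
  ... | no u≮ = contradiction u< u≮

  run-inactive : ∀ {w u s} → ¬ u < height s → Run w (u ∷ s) ≡ Run (below (height s) w) s
  run-inactive {w} {u} {s} u≮ with u <? height s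
  ... | yes u< = contradiction u< u≮
  ... | no _   = refl

  Rows : ℕ → ℕ → List ℕ → Set
  Rows h′ h w = ∀ {y} → y < h → h′ ≤ y → count y w ≡ m y

  opaque
    rows? : ∀ h′ h w → Dec (Rows h′ h w)
    rows? h′ h w = ℕₚ.allUpTo? (λ y → (h′ ≤? y) →-dec (count y w ≟ m y)) h

  -- Successive deletions do not branch: they fail at a wrong multiplicity or leave exactly the
  -- letters below the final height.
  drops-paths : ∀ {h′} h w ω y → h′ ≤ h → All (_< h) w →
    paths fwd (drops m h h′ ++ ω) (h , w) y ≡ ⟦ rows? h′ h w ⟧ * paths fwd ω (h′ , below h′ w) y
  drops-paths {h′} zero [] ω y ℕ.z≤n [] =
    sym (trans (cong (_* paths fwd ω (0 , []) y) (⟦⟧-yes (rows? 0 0 []) λ ())) (ℕₚ.*-identityˡ _))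
  drops-paths {h′} (suc h) w ω y h′≤ w≤h with h′ ≤? h
  ... | no h′≰h with refl ← ℕₚ.≤-antisym h′≤ (ℕₚ.≰⇒> h′≰h) =
    sym (trans (cong (_* paths fwd ω (suc h , below (suc h) w) y)
                     (⟦⟧-yes (rows? (suc h) (suc h) w) λ y< h< → contradiction y< (ℕₚ.≤⇒≯ h<)))
        (trans (ℕₚ.*-identityˡ _) (cong (λ z → paths fwd ω (suc h , z) y) (filter-all (_<? suc h) w≤h))))
  ... | yes h′≤h with count h w ≟ m h
  ...   | no c≢ =
    cong (_* paths fwd ω (h′ , below h′ w) y)
         (sym (⟦⟧-no (rows? h′ (suc h) w) λ r → c≢ (r (ℕₚ.n<1+n h) h′≤h)))
  ...   | yes c≡ =
    trans (ℕₚ.+-identityʳ _)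
    (trans (drops-paths h (below h w) ω y h′≤h (Allₚ.all-filter (_<? h) w))
           (cong₂ _*_ (⟦⟧-cong (rows? h′ h (below h w)) (rows? h′ (suc h) w) down up)
                      (cong (λ z → paths fwd ω (h′ , z) y) (below-below w h′≤h))))
    where
    down : Rows h′ h (below h w) → Rows h′ (suc h) w
    down r {y} y<sh h′≤y with y ≟ h
    ... | yes refl = c≡
    ... | no y≢h   = let y<h = ℕₚ.≤∧≢⇒< (ℕ.s≤s⁻¹ y<sh) y≢h
                     in trans (sym (count-below w y<h)) (r y<h h′≤y)
    up : Rows h′ (suc h) w → Rows h′ h (below h w)
    up r y<h h′≤y = trans (count-below w y<h) (r (ℕₚ.m<n⇒m<1+n y<h) h′≤y)

  -- True of the mask of a word (`mask-consistent`). It ensures that a letter put at a visible place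
  -- of the mask exists in the alphabet and is inactive there.
  Consistent : List (Maybe ℕ) → Set
  Consistent []            = ⊤
  Consistent (nothing ∷ κ) = Consistent κ
  Consistent (just x ∷ κ)  = x < k × ¬ x < height (visible κ) × Consistent κ

  mask-consistent : ∀ {s} → All (_< k) s → Consistent (mask s)
  mask-consistent []                    = tt
  mask-consistent {u ∷ s} (u<k ∷ s<k) with u <? height s
  ... | yes _ = mask-consistent s<k
  ... | no u≮ = u<k , (λ u< → u≮ (subst (u <_) (height-visible s) u<)) , mask-consistent s<k

  -- The condition in the middle of a walk. Of the `m y` active copies of a value below the height,
  -- some are already in the state `w` and the others are still to come in `s`; values not below the
  -- height were deleted, and checked, earlier.
  Accepted : List (Maybe ℕ) → List ℕ → List ℕ → Set
  Accepted κ w s = mask s ≡ κ × Run w s × (∀ {y} → y < height s → count y w + active y s ≡ m y)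

  accepted? : ∀ κ w s → Dec (Accepted κ w s)
  accepted? κ w s =
    (mask s ≟ᴹ κ) ×-dec run? w s ×-dec ℕₚ.allUpTo? (λ y → count y w + active y s ≟ m y) (height s)

  private
    height-mask : ∀ {s κ} → mask s ≡ κ → height s ≡ height (visible κ)
    height-mask {s} refl = sym (height-visible s)

    h+ : ∀ x s → height s ≤ height (x ∷ s)
    h+ x s = height-⊆ (x ∷ʳ ⊆-refl)

  -- An active letter merely moves from the part counted by `active` to the part counted by `count`,
  -- and the height, hence the range of the condition, stays the same.
  accepted-nothing : ∀ κ w u s → ⟦ accepted? (nothing ∷ κ) w (u ∷ s) ⟧ ≡
    ⟦ u <? height (visible κ) ⟧ * (⟦ V? (u ∷ w) ⟧ * ⟦ accepted? κ (u ∷ w) s ⟧)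
  accepted-nothing κ w u s =
    trans (⟦⟧-cong (accepted? (nothing ∷ κ) w (u ∷ s))
                   ((u <? height (visible κ)) ×-dec (V? (u ∷ w) ×-dec accepted? κ (u ∷ w) s)) to from)
          (trans (⟦⟧-× (u <? height (visible κ)) (V? (u ∷ w) ×-dec accepted? κ (u ∷ w) s))
                 (cong (⟦ u <? height (visible κ) ⟧ *_) (⟦⟧-× (V? (u ∷ w)) (accepted? κ (u ∷ w) s))))
    where
    shift : ∀ {y} → u < height s → count y (u ∷ w) + active y s ≡ count y w + active y (u ∷ s)
    shift {y} u< rewrite ⟦⟧-cong ((u ≟ y) ×-dec (u <? height s)) (u ≟ y) proj₁ (_, u<) =
      assoc ⟦ u ≟ y ⟧ (count y w) (active y s)
      where
      assoc : ∀ a b c → a + b + c ≡ b + (a + c)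
      assoc = solve-∀
    to : Accepted (nothing ∷ κ) w (u ∷ s) → u < height (visible κ) × (V (u ∷ w) × Accepted κ (u ∷ w) s)
    to (eq , run , cnt) = go (u <? height s)
      where
      go : Dec (u < height s) → u < height (visible κ) × (V (u ∷ w) × Accepted κ (u ∷ w) s)
      go (no u≮) with () ← ∷-injectiveˡ (trans (sym (mask-inactive u≮)) eq)
      go (yes u<) with eq′ ← ∷-injectiveʳ (trans (sym (mask-active u<)) eq) | v , run′ ← subst id (run-active u<) run =
        subst (u <_) (height-mask eq′) u< , v , eq′ , run′
        , λ y< → trans (shift u<) (cnt (ℕₚ.≤-trans y< (h+ u s)))
    from : u < height (visible κ) × (V (u ∷ w) × Accepted κ (u ∷ w) s) → Accepted (nothing ∷ κ) w (u ∷ s)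
    from (u<′ , v , eq , run , cnt) =
      trans (mask-active u<) (cong (nothing ∷_) eq) , subst id (sym (run-active u<)) (v , run)
      , λ y< → trans (sym (shift u<)) (cnt (subst (_ <_) (height-active u<) y<))
      where u< = subst (u <_) (sym (height-mask eq)) u<′

  -- The values between the new and the old height have no active copies left, so the condition on
  -- them becomes `Rows`; smaller values are not affected by the deletions.
  accepted-just : ∀ {κ x} w u s → Consistent (just x ∷ κ) → ⟦ accepted? (just x ∷ κ) w (u ∷ s) ⟧ ≡
    ⟦ x ≟ u ⟧ * (⟦ rows? (height (visible κ)) (height (x ∷ visible κ)) w ⟧ *
                 ⟦ accepted? κ (below (height (visible κ)) w) s ⟧)
  accepted-just {κ} {x} w u s (x<k , x≮ , _) =
    trans (⟦⟧-cong (accepted? (just x ∷ κ) w (u ∷ s))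
                   ((x ≟ u) ×-dec (R? ×-dec A?)) to from)
          (trans (⟦⟧-× (x ≟ u) (R? ×-dec A?)) (cong (⟦ x ≟ u ⟧ *_) (⟦⟧-× R? A?)))
    where
    H = height (visible κ)
    R? = rows? H (height (x ∷ visible κ)) w
    A? = accepted? κ (below H w) s
    inactive : ∀ {y} → ¬ u < height s → active y (u ∷ s) ≡ active y s
    inactive {y} u≮ = cong (_+ active y s) (⟦⟧-no ((u ≟ y) ×-dec (u <? height s)) (u≮ ∘ proj₂))
    Hx : ¬ x < height s → mask s ≡ κ → height (x ∷ visible κ) ≡ height (x ∷ s)
    Hx x≮s refl = trans (cong (λ κ′ → height (visible κ′)) (sym (mask-inactive x≮s))) (height-visible (x ∷ s))
    to : Accepted (just x ∷ κ) w (u ∷ s) → x ≡ u × (Rows H (height (x ∷ visible κ)) w × Accepted κ (below H w) s)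
    to (eq , run , cnt) = go (u <? height s)
      where
      go : Dec (u < height s) → x ≡ u × (Rows H (height (x ∷ visible κ)) w × Accepted κ (below H w) s)
      go (yes u<) with () ← ∷-injectiveˡ (trans (sym (mask-active u<)) eq)
      go (no u≮) with eq′ ← ∷-injectiveʳ (trans (sym (mask-inactive u≮)) eq)
                    | refl ← Maybeₚ.just-injective (∷-injectiveˡ (trans (sym (mask-inactive u≮)) eq)) =
        refl
        , (λ {y} y< H≤y → trans (sym (ℕₚ.+-identityʳ _))
            (trans (cong (count y w +_) (sym (trans (inactive u≮)
                     (active-none s (subst (_≤ y) (sym (height-mask eq′)) H≤y)))))
                   (cnt (subst (y <_) (Hx u≮ eq′) y<))))
        , eq′ , subst (λ h → Run (below h w) s) (height-mask eq′) (subst id (run-inactive u≮) run)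
        , λ {y} y< → trans (cong (_+ active y s) (count-below w (subst (y <_) (height-mask eq′) y<)))
                           (trans (cong (count y w +_) (sym (inactive u≮))) (cnt (ℕₚ.≤-trans y< (h+ u s))))
    from : x ≡ u × (Rows H (height (x ∷ visible κ)) w × Accepted κ (below H w) s) → Accepted (just x ∷ κ) w (u ∷ s)
    from (refl , rows , eq , run , cnt) =
      trans (mask-inactive u≮) (cong (just x ∷_) eq)
      , subst id (sym (run-inactive u≮)) (subst (λ h → Run (below h w) s) (sym (height-mask eq)) run)
      , λ {y} y< → trans (cong (count y w +_) (inactive u≮)) (counts y y<)
      where
      u≮ : ¬ u < height s
      u≮ u< = x≮ (subst (u <_) (height-mask eq) u<)
      counts : ∀ y → y < height (u ∷ s) → count y w + active y s ≡ m y
      counts y y< with y <? H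
      ... | yes y<H = trans (cong (_+ active y s) (sym (count-below w y<H)))
                            (cnt (subst (y <_) (sym (height-mask eq)) y<H))
      ... | no y≮H  = trans (cong (count y w +_) (active-none s (subst (_≤ y) (sym (height-mask eq)) (ℕₚ.≮⇒≥ y≮H))))
                            (trans (ℕₚ.+-identityʳ _) (rows (subst (y <_) (sym (Hx u≮ eq)) y<) (ℕₚ.≮⇒≥ y≮H)))

  count-accepted : ∀ κ w → Consistent κ → All (_< height (visible κ)) w →
    ∑ (words k (length κ)) (λ π → ⟦ accepted? κ w (letters π) ⟧) ≡
    paths fwd (ops m κ) (height (visible κ) , w) (0 , [])
  count-accepted [] w _ w< =
    trans (ℕₚ.+-identityʳ _)
    (trans (⟦⟧-cong (accepted? [] w []) (rows? 0 (height []) w)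
             (λ (_ , _ , cnt) y< _ → trans (sym (ℕₚ.+-identityʳ _)) (cnt y<))
             (λ rows → refl , tt , λ y< → trans (ℕₚ.+-identityʳ _) (rows y< ℕ.z≤n)))
    (sym (trans (cong (λ ω → paths fwd ω (height [] , w) (0 , [])) (sym (++-identityʳ (drops m (height []) 0))))
         (trans (drops-paths (height []) w [] (0 , []) ℕ.z≤n w<)
         (trans (cong (⟦ rows? 0 (height []) w ⟧ *_) (⟦⟧-yes ((0 , below 0 w) ≟ˢ (0 , [])) (cong (0 ,_) (below-0 w))))
                (ℕₚ.*-identityʳ _))))))
    where
    below-0 : ∀ w → below 0 w ≡ []
    below-0 []      = refl
    below-0 (x ∷ w) = trans (filter-reject (_<? 0) {x} {w} (ℕₚ.≤⇒≯ ℕ.z≤n)) (below-0 w)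
  count-accepted (nothing ∷ κ) w con w< =
    trans (∑-cartesianProductWith _∷_ (allFin k) (words k (length κ)) _)
    (trans (∑-cong (allFin k) λ u → trans (∑-cong (words k (length κ)) λ π → accepted-nothing κ w (toℕ u) (letters π))
      (trans (∑-*ˡ ⟦ toℕ u <? H ⟧ (words k (length κ)) _)
        (cong (⟦ toℕ u <? H ⟧ *_) (∑-*ˡ ⟦ V? (toℕ u ∷ w) ⟧ (words k (length κ)) _))))
    (trans (∑-allFin k _)
    (trans (∑-cong (upTo k) λ u → ⟦⟧*-cong (u <? H) λ u<H →
       cong (⟦ V? (u ∷ w) ⟧ *_) (count-accepted κ (u ∷ w) con (u<H ∷ w<)))
    (trans (∑-upTo-< _ (threshold-≤ k (visible κ)))
    (trans (sym (∑-filter (λ u → V? (u ∷ w)) (upTo H) _))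
           (sym (∑-map (λ u → H , u ∷ w) (filter (λ u → V? (u ∷ w)) (upTo H)) _)))))))
    where H = height (visible κ)
  count-accepted (just x ∷ κ) w con@(x<k , x≮ , con′) w< =
    trans (∑-cartesianProductWith _∷_ (allFin k) (words k (length κ)) _)
    (trans (∑-cong (allFin k) λ u → trans (∑-cong (words k (length κ)) λ π → accepted-just w (toℕ u) (letters π) con)
      (trans (∑-*ˡ ⟦ x ≟ toℕ u ⟧ (words k (length κ)) _)
        (cong (⟦ x ≟ toℕ u ⟧ *_) (∑-*ˡ R (words k (length κ)) _))))
    (trans (∑-allFin k (λ u → ⟦ x ≟ u ⟧ * (R * N)))
    (trans (∑-≟ _≟_ (λ _ → R * N) (Uniqueₚ.upTo⁺ k) (∈-upTo⁺ x<k))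
    (trans (cong (R *_) (count-accepted κ (below H w) con′ (Allₚ.all-filter (_<? H) w)))
           (sym (drops-paths (height (x ∷ visible κ)) w (ops m κ) (0 , []) (h+ x (visible κ)) w<))))))
    where
    H = height (visible κ)
    R = ⟦ rows? H (height (x ∷ visible κ)) w ⟧
    N = ∑ (words k (length κ)) λ π → ⟦ accepted? κ (below H w) (letters π) ⟧

-- Counting the avoiders within a class.

module _ (r : List ℕ) where
  open ProcessAdjoint (av? r) Av-⊆

  backward : List Op → State → State → ℕ
  backward = paths bwd

filter-reverse : ∀ h w → filter (_<? h) (reverse w) ≡ reverse (filter (_<? h) w)
filter-reverse h []      = refl
filter-reverse h (x ∷ w) = begin
  filter (_<? h) (reverse (x ∷ w))                      ≡⟨ cong (filter (_<? h)) (unfold-reverse x w) ⟩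
  filter (_<? h) (reverse w ++ [ x ])                   ≡⟨ filter-++ (_<? h) (reverse w) [ x ] ⟩
  filter (_<? h) (reverse w) ++ filter (_<? h) [ x ]    ≡⟨ cong (_++ filter (_<? h) [ x ]) (filter-reverse h w) ⟩
  reverse (filter (_<? h) w) ++ filter (_<? h) [ x ]    ≡⟨ last (x <? h) ⟩
  reverse (filter (_<? h) (x ∷ w))                      ∎
  where
  open ≡-Reasoning
  last : Dec (x < h) → reverse (filter (_<? h) w) ++ filter (_<? h) [ x ] ≡ reverse (filter (_<? h) (x ∷ w))
  last (yes x<h) rewrite filter-accept (_<? h) {xs = []} x<h | filter-accept (_<? h) {xs = w} x<h =
    sym (unfold-reverse x (filter (_<? h) w))
  last (no x≮h) rewrite filter-reject (_<? h) {xs = []} x≮h | filter-reject (_<? h) {xs = w} x≮h =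
    ++-identityʳ _

letters-< : ∀ {k} (π : Word k) → All (_< k) (letters π)
letters-< []      = []
letters-< (x ∷ π) = Finₚ.toℕ<n x ∷ letters-< π

occurrences≡count : ∀ {k} (i : Fin k) π → occurrences i π ≡ count (toℕ i) (letters π)
occurrences≡count i π =
  trans (length-filter (Finₚ._≟ i) π)
  (trans (∑-cong π λ x → ⟦⟧-cong (x Finₚ.≟ i) (toℕ x ≟ toℕ i) (cong toℕ) Finₚ.toℕ-injective)
         (sym (∑-map toℕ π _)))

length-multiperm : ∀ S {π} → IsMultiperm S π → length π ≡ size S
length-multiperm S {π} mp = trans (sym (sum-occurrences π)) (sum-cong-≗ mp)
  where
  open import Algebra.Properties.CommutativeMonoid.Sum ℕₚ.+-0-commutativeMonoid using (sum-cong-≗)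

module Transfer (k : ℕ) (ρ τ : List ℕ) (ρ⋖τ : ρ ⋖ τ) (ρ≢[] : ρ ≢ []) (m : ℕ → ℕ) where

  open Live k τ
  open Avoidance ρ ρ⋖τ ρ≢[]
  open MaskedWalks k τ (av? (reverse ρ)) Av-⊆ m

  private
    V : List ℕ → Set
    V = Av (reverse ρ)

    reverse≢[] : reverse ρ ≢ []
    reverse≢[] eq = ρ≢[] (trans (sym (reverse-involutive ρ)) (cong reverse eq))

  V-[] : Av (reverse ρ) []
  V-[] = go (reverse ρ) reverse≢[]
    where
    go : ∀ r → r ≢ [] → Av r []
    go []      ne _             = ne refl
    go (_ ∷ _) ne (_ , [] , ())

  private
    -- Here `q` retains all letters read before `s`, whereas the state of `Run` has lost those above
    -- the height; comparing the two shows that a lost letter never matters again, as heights only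
    -- fall.
    Splits : List ℕ → List ℕ → Set
    Splits q s = ∀ p s′ → s ≡ p ++ s′ → V (below (height s′) (p ʳ++ q))

    splits⇒run : ∀ q s → Splits q s → Run (below (height s) q) s
    splits⇒run q []      sp = tt
    splits⇒run q (u ∷ s) sp = go (u <? height s)
      where
      ih : Run (below (height s) (u ∷ q)) s
      ih = splits⇒run (u ∷ q) s λ p s′ eq → sp (u ∷ p) s′ (cong (u ∷_) eq)
      go : Dec (u < height s) → Run (below (height (u ∷ s)) q) (u ∷ s)
      go (yes u<) = subst id (sym (run-active u<))
        ( subst V keep (sp [ u ] s refl) , subst (λ w → Run w s) keep ih )
        where
        keep : below (height s) (u ∷ q) ≡ u ∷ below (height (u ∷ s)) q
        keep = trans (filter-accept (_<? height s) u<) (cong (λ h → u ∷ below h q) (sym (height-active u<)))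
      go (no u≮) = subst id (sym (run-inactive u≮)) (subst (λ w → Run w s) drop ih)
        where
        drop : below (height s) (u ∷ q) ≡ below (height s) (below (height (u ∷ s)) q)
        drop = trans (filter-reject (_<? height s) u≮) (sym (below-below q (height-⊆ (u ∷ʳ ⊆-refl))))

    run⇒splits : ∀ q s → V (below (height s) q) → Run (below (height s) q) s → Splits q s
    run⇒splits q s       v run []       .s refl = v
    run⇒splits q (u ∷ s) v run (.u ∷ p) s′ refl = go (u <? height s)
      where
      go : Dec (u < height s) → V (below (height s′) (p ʳ++ (u ∷ q)))
      go (yes u<) with v′ , run′ ← subst id (run-active u<) run =
        run⇒splits (u ∷ q) s (subst V keep v′) (subst (λ w → Run w s) keep run′) p s′ refl
        where
        keep : u ∷ below (height (u ∷ s)) q ≡ below (height s) (u ∷ q)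
        keep = sym (trans (filter-accept (_<? height s) u<) (cong (λ h → u ∷ below h q) (sym (height-active u<))))
      -- At an inactive letter nothing has to be checked: the next state is contained in the present
      -- one, which avoids the pattern already.
      go (no u≮) = run⇒splits (u ∷ q) s (subst V drop (Av-⊆ (Subₚ.filter-⊆ (_<? height s) _) v))
                     (subst (λ w → Run w s) drop (subst id (run-inactive u≮) run)) p s′ refl
        where
        drop : below (height s) (below (height (u ∷ s)) q) ≡ below (height s) (u ∷ q)
        drop = sym (trans (filter-reject (_<? height s) u≮) (sym (below-below q (height-⊆ (u ∷ʳ ⊆-refl)))))

  av⇒run : ∀ s → Av (ρ ++ τ) s → Run [] s
  av⇒run s a = splits⇒run [] s λ { p s′ refl has → a (bad⇒has p s′
    (subst₂ Has (reverse-involutive ρ) (trans (cong reverse (filter-reverse (height s′) p)) (reverse-involutive _))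
            (has-reverse has))) }

  run⇒av : ∀ {s} → All (_< k) s → Run [] s → Av (ρ ++ τ) s
  run⇒av {s} s<k run has with has⇒bad s<k has
  ... | p , s′ , eq , bad =
    run⇒splits [] s V-[] run p s′ eq
      (subst (Has (reverse ρ)) (sym (filter-reverse (height s′) p)) (has-reverse bad))

module ClassCount (S : Multiset) (ρ τ : List ℕ) (ρ⋖τ : ρ ⋖ τ) (ρ≢[] : ρ ≢ [])
                  (π₀ : Word (k S)) (mp₀ : IsMultiperm S π₀) where

  open Live (k S) τ
  private
    s₀ : List ℕ
    s₀ = letters π₀
    κ : List (Maybe ℕ)
    κ = mask s₀
    m : ℕ → ℕ
    m x = active x s₀
  open MaskedWalks (k S) τ (av? (reverse ρ)) Av-⊆ m
  open ProcessAdjoint (av? (reverse ρ)) Av-⊆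
  open Transfer (k S) ρ τ ρ⋖τ ρ≢[] m

  private
    length-mask : ∀ s → length (mask s) ≡ length s
    length-mask []      = refl
    length-mask (u ∷ s) with u <? height s
    ... | yes _ = cong suc (length-mask s)
    ... | no _  = cong suc (length-mask s)

    length-κ : length κ ≡ size S
    length-κ = trans (length-mask s₀) (trans (length-map toℕ π₀) (length-multiperm S {π₀} mp₀))

    -- A fixed mask fixes the visible copies of every letter, so the right multiplicities amount to
    -- the right numbers of active copies; these vanish for values not below the height, about which
    -- `Accepted` is silent.
    class-accepted : ∀ π →
      ⟦ isMultiperm? S π ⟧ * (⟦ mask (letters π) ≟ᴹ κ ⟧ * ⟦ ¬? (contains? π (ρ ++ τ)) ⟧) ≡
      ⟦ accepted? κ [] (letters π) ⟧
    class-accepted π =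
      trans (cong (⟦ isMultiperm? S π ⟧ *_) (sym (⟦⟧-× K? C?)))
      (trans (sym (⟦⟧-× (isMultiperm? S π) (K? ×-dec C?)))
             (⟦⟧-cong (isMultiperm? S π ×-dec K? ×-dec C?) (accepted? κ [] s) to from))
      where
      s = letters π
      K? = mask s ≟ᴹ κ
      C? = ¬? (contains? π (ρ ++ τ))
      to : IsMultiperm S π × mask s ≡ κ × Avoids π (ρ ++ τ) → Accepted κ [] s
      to (mp , eq , a) = eq , av⇒run s (a ∘ has⇒contains) , λ {y} y<h → rows y (ℕₚ.≤-trans y<h (threshold-≤ (k S) s))
        where
        rows : ∀ y → y < k S → active y s ≡ active y s₀
        rows y y<k = ℕₚ.+-cancelˡ-≡ (count y (visible κ)) _ _ (begin
          count y (visible κ) + active y s        ≡⟨ cong (λ κ′ → count y (visible κ′) + active y s) (sym eq) ⟩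
          count y (visible (mask s)) + active y s ≡⟨ sym (count-visible y s) ⟩
          count y s                               ≡⟨ cong (λ z → count z s) (sym (Finₚ.toℕ-fromℕ< y<k)) ⟩
          count (toℕ i) s                         ≡⟨ sym (occurrences≡count i π) ⟩
          occurrences i π                         ≡⟨ trans (mp i) (sym (mp₀ i)) ⟩
          occurrences i π₀                        ≡⟨ occurrences≡count i π₀ ⟩
          count (toℕ i) s₀                        ≡⟨ cong (λ z → count z s₀) (Finₚ.toℕ-fromℕ< y<k) ⟩
          count y s₀                              ≡⟨ count-visible y s₀ ⟩
          count y (visible κ) + active y s₀       ∎)
          where
          open ≡-Reasoning
          i = fromℕ< y<k
      from : Accepted κ [] s → IsMultiperm S π × mask s ≡ κ × Avoids π (ρ ++ τ)
      from (eq , run , cnt) = mp , eq , (λ c → run⇒av (letters-< π) run (contains⇒has c))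
        where
        heights : height s ≡ height s₀
        heights = trans (sym (height-visible s)) (trans (cong (height ∘ visible) eq) (height-visible s₀))
        rows : ∀ y → active y s ≡ active y s₀
        rows y with y <? height s
        ... | yes y<h = cnt y<h
        ... | no y≮h  = trans (active-none s (ℕₚ.≮⇒≥ y≮h))
                              (sym (active-none s₀ (subst (_≤ y) heights (ℕₚ.≮⇒≥ y≮h))))
        mp : IsMultiperm S π
        mp i = begin
          occurrences i π                                     ≡⟨ occurrences≡count i π ⟩
          count (toℕ i) s                                     ≡⟨ count-visible (toℕ i) s ⟩
          count (toℕ i) (visible (mask s)) + active (toℕ i) s ≡⟨ cong₂ (λ κ′ n → count (toℕ i) (visible κ′) + n) eq (rows (toℕ i)) ⟩
          count (toℕ i) (visible κ) + active (toℕ i) s₀       ≡⟨ sym (count-visible (toℕ i) s₀) ⟩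
          count (toℕ i) s₀                                    ≡⟨ sym (occurrences≡count i π₀) ⟩
          occurrences i π₀                                    ≡⟨ mp₀ i ⟩
          mult S i                                            ∎
          where open ≡-Reasoning

  class-count :
    ∑ (multiperms S) (λ π → ⟦ mask (letters π) ≟ᴹ κ ⟧ * ⟦ ¬? (contains? π (ρ ++ τ)) ⟧) ≡
    backward (reverse ρ) (reverse (ops m κ)) (0 , []) (height (visible κ) , [])
  class-count = begin
    ∑ (multiperms S) (λ π → ⟦ mask (letters π) ≟ᴹ κ ⟧ * ⟦ ¬? (contains? π (ρ ++ τ)) ⟧)
      ≡⟨ ∑-filter (isMultiperm? S) (words (k S) (size S)) _ ⟩
    ∑ (words (k S) (size S)) _
      ≡⟨ ∑-cong (words (k S) (size S)) class-accepted ⟩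
    ∑ (words (k S) (size S)) (λ π → ⟦ accepted? κ [] (letters π) ⟧)
      ≡⟨ cong (λ n → ∑ (words (k S) n) (λ π → ⟦ accepted? κ [] (letters π) ⟧)) (sym length-κ) ⟩
    ∑ (words (k S) (length κ)) (λ π → ⟦ accepted? κ [] (letters π) ⟧)
      ≡⟨ count-accepted κ [] (mask-consistent (letters-< π₀)) [] ⟩
    paths fwd (ops m κ) (height (visible κ) , []) (0 , [])
      ≡⟨ adjointness (ops m κ) ([] , V-[]) ([] , V-[]) ⟩
    backward (reverse ρ) (reverse (ops m κ)) (0 , []) (height (visible κ) , [])
      ∎
    where open ≡-Reasoning

activeOps : ∀ {k} → List ℕ → Word k → List Op
activeOps {k} τ π = reverse (ops (λ x → active x (letters π)) (mask (letters π)))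
  where open Live k τ

SameClass : ∀ {k} → List ℕ → Word k → Word k → Set
SameClass {k} τ π π′ = mask (letters π) ≡ mask (letters π′)
  where open Live k τ

⟦all?⟧-pair : ∀ {A : Set} {P : A → Set} (P? : ∀ x → Dec (P x)) x y → ⟦ All.all? P? (x ∷ y ∷ []) ⟧ ≡ ⟦ P? y ⟧ * ⟦ P? x ⟧
⟦all?⟧-pair P? x y = trans (⟦⟧-cong (All.all? P? (x ∷ y ∷ [])) (P? y ×-dec P? x)
                             (λ { (p ∷ q ∷ []) → q , p }) (λ (q , p) → p ∷ q ∷ []))
                           (⟦⟧-× (P? y) (P? x))

⟦avoids-both⟧ : ∀ {k} ρ σ (π : Word k) →
  ⟦ avoidsAll? ｛ ρ , σ ｝ π ⟧ ≡ ⟦ ¬? (contains? π σ) ⟧ * ⟦ ¬? (contains? π ρ) ⟧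
⟦avoids-both⟧ ρ σ π = ⟦all?⟧-pair (λ ρ → ¬? (contains? π ρ)) ρ σ

-- σ only depends on the class, so within a class either everything is excluded or σ is irrelevant.
⊕-equivalent : ∀ ρ ρ′ τ σ → ρ ⋖ τ → ρ′ ⋖ τ → ρ ≢ [] → ρ′ ≢ [] →
  (∀ S {π π′} → IsMultiperm S π → IsMultiperm S π′ → SameClass τ π π′ → Avoids π σ → Avoids π′ σ) →
  (∀ S {π} → IsMultiperm S π → Avoids π σ → ∀ h →
     backward (reverse ρ) (activeOps τ π) (0 , []) (h , []) ≡
     backward (reverse ρ′) (activeOps τ π) (0 , []) (h , [])) →
  ｛ ρ ++ τ , σ ｝ ∼ ｛ ρ′ ++ τ , σ ｝
⊕-equivalent ρ ρ′ τ σ ρ⋖τ ρ′⋖τ ρ≢[] ρ′≢[] inv same S =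
  trans (length-filter (avoidsAll? _) (multiperms S))
  (trans (∑-by-classes _≟ᴹ_ (mask ∘ letters) (multiperms S) _ _ classes)
         (sym (length-filter (avoidsAll? _) (multiperms S))))
  where
  open Live (k S) τ
  classes : ∀ {π₀} → π₀ ∈ multiperms S →
    ∑ (multiperms S) (λ π → ⟦ mask (letters π) ≟ᴹ mask (letters π₀) ⟧ * ⟦ avoidsAll? ｛ ρ ++ τ , σ ｝ π ⟧) ≡
    ∑ (multiperms S) (λ π → ⟦ mask (letters π) ≟ᴹ mask (letters π₀) ⟧ * ⟦ avoidsAll? ｛ ρ′ ++ τ , σ ｝ π ⟧)
  classes {π₀} π₀∈ = begin
    ∑ (multiperms S) (λ π → ⟦ K? π ⟧ * ⟦ avoidsAll? ｛ ρ ++ τ , σ ｝ π ⟧)         ≡⟨ extract (ρ ++ τ) ⟩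
    ⟦ A? ⟧ * ∑ (multiperms S) (λ π → ⟦ K? π ⟧ * ⟦ ¬? (contains? π (ρ ++ τ)) ⟧)
      ≡⟨ ⟦⟧*-cong A? (λ a → trans (ClassCount.class-count S ρ τ ρ⋖τ ρ≢[] π₀ mp₀)
                           (trans (same S {π₀} mp₀ a (height (visible (mask (letters π₀))))) (sym (ClassCount.class-count S ρ′ τ ρ′⋖τ ρ′≢[] π₀ mp₀)))) ⟩
    ⟦ A? ⟧ * ∑ (multiperms S) (λ π → ⟦ K? π ⟧ * ⟦ ¬? (contains? π (ρ′ ++ τ)) ⟧) ≡⟨ sym (extract (ρ′ ++ τ)) ⟩
    ∑ (multiperms S) (λ π → ⟦ K? π ⟧ * ⟦ avoidsAll? ｛ ρ′ ++ τ , σ ｝ π ⟧)        ∎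
    where
    open ≡-Reasoning
    mp₀ : IsMultiperm S π₀
    mp₀ = Equivalence.to (∈-multiperms S π₀) π₀∈
    K? : ∀ π → Dec (mask (letters π) ≡ mask (letters π₀))
    K? π = mask (letters π) ≟ᴹ mask (letters π₀)
    A? = ¬? (contains? π₀ σ)
    comm : ∀ a b c → a * (b * c) ≡ b * (a * c)
    comm = solve-∀
    extract : ∀ ω → ∑ (multiperms S) (λ π → ⟦ K? π ⟧ * ⟦ avoidsAll? ｛ ω , σ ｝ π ⟧) ≡
                    ⟦ A? ⟧ * ∑ (multiperms S) (λ π → ⟦ K? π ⟧ * ⟦ ¬? (contains? π ω) ⟧)
    extract ω =
      trans (∑-cong-All (multiperms S) (All.tabulate λ {π} π∈ → let mp = Equivalence.to (∈-multiperms S π) π∈ in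
               trans (⟦⟧*-cong (K? π) λ eq → trans (⟦avoids-both⟧ ω σ π)
                        (cong (_* ⟦ ¬? (contains? π ω) ⟧)
                              (⟦⟧-cong (¬? (contains? π σ)) A? (inv S {π} {π₀} mp mp₀ eq) (inv S {π₀} {π} mp₀ mp (sym eq)))))
                     (comm ⟦ K? π ⟧ ⟦ A? ⟧ _)))
            (∑-*ˡ ⟦ A? ⟧ (multiperms S) _)

-- Bounds on the number of copies.

Bounded : ℕ → Op → Set
Bounded b add     = ⊤
Bounded b (del m) = m ≤ b

IsDel : Op → Set
IsDel o = ∃ λ m → o ≡ del m

module _ {k : ℕ} (τ : List ℕ) where
  open Live k τ

  drops-All : ∀ {P : Op → Set} {m} → (∀ x → P (del (m x))) → ∀ h h′ → All P (drops m h h′)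
  drops-All p zero    h′ = []
  drops-All p (suc h) h′ with h′ ≤? h
  ... | yes _ = p h ∷ drops-All p h h′
  ... | no _  = []

  activeOps-bounded : ∀ {b} (π : Word k) → (∀ x → active x (letters π) ≤ b) → All (Bounded b) (activeOps τ π)
  activeOps-bounded {b} π act≤ = All-reverse⁺ (go (mask (letters π)))
    where
    go : ∀ κ → All (Bounded b) (ops (λ x → active x (letters π)) κ)
    go []            = drops-All act≤ (height []) 0
    go (nothing ∷ κ) = tt ∷ go κ
    go (just x ∷ κ)  = Allₚ.++⁺ (drops-All act≤ (height (x ∷ visible κ)) (height (visible κ))) (go κ)

  active≤count : ∀ x s → active x s ≤ count x s
  active≤count x s = ℕₚ.≤-trans (ℕₚ.m≤n+m (active x s) _) (ℕₚ.≤-reflexive (sym (count-visible x s)))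

module _ {k : ℕ} where
  open Live k []

  private
    height-[] : ∀ s → height s ≡ k
    height-[] s = go k
      where
      go : ∀ n → threshold n s ≡ n
      go zero    = refl
      go (suc n) with live? n s
      ... | yes _ = refl
      ... | no ¬l = contradiction ([] , minimum s , [] , []) ¬l

  -- For empty τ every letter is active, so forwards the whole word is read before the first
  -- deletion, and backwards all insertions precede all removals. This is why a statistic can
  -- suffice that says nothing about the effect of a removal.
  activeOps-[] : (π : Word k) → ∃ λ ds → ∃ λ n → activeOps [] π ≡ ds ++ replicate n add × All IsDel ds
  activeOps-[] π = reverse ds , length s , trans (cong reverse (shape s (letters-< π)))
    (trans (reverse-++ (replicate (length s) add) ds) (cong (reverse ds ++_) (reverse-replicate (length s))))
    , All-reverse⁺ (drops-All {k} [] {m = m} (λ x → m x , refl) (height []) 0)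
    where
    s = letters π
    m = λ x → active x s
    ds = drops m (height []) 0
    shape : ∀ s → All (_< k) s → ops m (mask s) ≡ replicate (length s) add ++ ds
    shape []      []          = refl
    shape (u ∷ s) (u<k ∷ s<k) rewrite mask-active {u} {s} (subst (u <_) (sym (height-[] s)) u<k) =
      cong (add ∷_) (shape s s<k)
    reverse-replicate : ∀ n → reverse (replicate n add) ≡ replicate n add
    reverse-replicate zero    = refl
    reverse-replicate (suc n) = trans (unfold-reverse add (replicate n add))
                                      (trans (cong (_++ [ add ]) (reverse-replicate n)) (snoc n))
      where
      snoc : ∀ n → replicate n add ++ [ add ] ≡ replicate (suc n) add
      snoc zero    = refl
      snoc (suc n) = cong (add ∷_) (snoc n)

sameOrder-≡ : ∀ {x y r s} → x ≡ y → r ≡ s → SameOrder x r y s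
sameOrder-≡ refl refl = mk⇔ irr irr , mk⇔ irr irr
  where
  irr : ∀ {m} {A : Set} → m < m → A
  irr lt = contradiction lt (ℕₚ.<-irrefl refl)

≅-replicate⁺ : ∀ j x r → replicate j x ≅ replicate j r
≅-replicate⁺ zero    x r = []
≅-replicate⁺ (suc j) x r = go j ∷ ≅-replicate⁺ j x r
  where
  go : ∀ j → Pointwise (SameOrder x r) (replicate j x) (replicate j r)
  go zero    = []
  go (suc j) = sameOrder-≡ refl refl ∷ go j

≅-replicate⁻ : ∀ j {x r l} → x ∷ l ≅ replicate (suc j) r → l ≡ replicate j x
≅-replicate⁻ zero    (_ ∷ [])      = refl
≅-replicate⁻ (suc j) {x} {r} {y ∷ l} (((p , q) ∷ _) ∷ e)
  with refl ← ℕₚ.≤-antisym {x} {y} (ℕₚ.≮⇒≥ (ℕₚ.<-irrefl refl ∘ Equivalence.to q))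
                                   (ℕₚ.≮⇒≥ (ℕₚ.<-irrefl refl ∘ Equivalence.to p)) =
  cong (x ∷_) (≅-replicate⁻ j e)

module _ (b : ℕ) where

  private
    σ : List ℕ
    σ = replicate (suc b) 1

  replicate-⊆⇒count : ∀ j {x} s → replicate j x ⊆ s → j ≤ count x s
  replicate-⊆⇒count zero    s       sub           = ℕ.z≤n
  replicate-⊆⇒count (suc j) (y ∷ s) (.y ∷ʳ sub)   = ℕₚ.≤-trans (replicate-⊆⇒count (suc j) s sub) (ℕₚ.m≤n+m _ _)
  replicate-⊆⇒count (suc j) {x} (.x ∷ s) (refl ∷ sub) =
    ℕₚ.+-mono-≤ (ℕₚ.≤-reflexive (sym (⟦⟧-yes (x ≟ x) refl))) (replicate-⊆⇒count j s sub)

  count⇒replicate-⊆ : ∀ j {x} s → j ≤ count x s → replicate j x ⊆ s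
  count⇒replicate-⊆ zero    s       j≤ = minimum s
  count⇒replicate-⊆ (suc j) {x} (y ∷ s) j≤ with y ≟ x
  ... | yes refl = refl ∷ count⇒replicate-⊆ j s (ℕ.s≤s⁻¹ j≤)
  ... | no _     = y ∷ʳ count⇒replicate-⊆ (suc j) s j≤

  avoids-replicate⇒ : ∀ {k} {π : Word k} → Avoids π σ → ∀ x → count x (letters π) ≤ b
  avoids-replicate⇒ {π = π} a x = ℕₚ.≮⇒≥ λ b< →
    a (has⇒contains {π = π} (_ , count⇒replicate-⊆ (suc b) _ b< , ≅-replicate⁺ (suc b) x 1))

  ⇒avoids-replicate : ∀ {k} {π : Word k} → (∀ i → occurrences i π ≤ b) → Avoids π σ
  ⇒avoids-replicate {π = π} occ c with contains⇒has c
  ... | [] , _ , ()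
  ... | x ∷ l , sub , e with refl ← ≅-replicate⁻ b e =
    ℕₚ.<⇒≱ (replicate-⊆⇒count (suc b) (letters π) sub) (begin
      count x (letters π)       ≡⟨ cong (λ z → count z (letters π)) (sym (Finₚ.toℕ-fromℕ< x<k)) ⟩
      count (toℕ i) (letters π) ≡⟨ sym (occurrences≡count i π) ⟩
      occurrences i π           ≤⟨ occ i ⟩
      b                         ∎)
    where
    open ℕₚ.≤-Reasoning
    x<k = All.head (Subₚ.All-resp-⊆ sub (letters-< π))
    i = fromℕ< x<k

  avoids-replicate-class : ∀ S {π π′} → IsMultiperm S π → IsMultiperm S π′ → Avoids π σ → Avoids π′ σ
  avoids-replicate-class S {π} {π′} mp mp′ a = ⇒avoids-replicate {π = π′} λ i → begin
    occurrences i π′            ≡⟨ trans (mp′ i) (sym (mp i)) ⟩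
    occurrences i π             ≡⟨ occurrences≡count i π ⟩
    count (toℕ i) (letters π)   ≤⟨ avoids-replicate⇒ {π = π} a (toℕ i) ⟩
    b                           ∎
    where open ℕₚ.≤-Reasoning

  avoids-replicate-bounded : ∀ {k} τ {π : Word k} → Avoids π σ → All (Bounded b) (activeOps τ π)
  avoids-replicate-bounded τ {π} a = activeOps-bounded τ π λ x →
    ℕₚ.≤-trans (active≤count τ x (letters π)) (avoids-replicate⇒ {π = π} a x)

-- As τ is a single letter, a letter is active if a larger one follows.
module _ (b r : ℕ) where

  private
    σ : List ℕ
    σ = replicate (suc b) 1 ++ [ 2 ]
    τ : List ℕ
    τ = [ r ]

  module _ {k : ℕ} where
    open Live k τ

    private
      suffix-live : ∀ {x y s} → y ∷ [] ⊆ s → x < y → Live x s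
      suffix-live sub x<y = _ , sub , [] ∷ [] , x<y ∷ []

      ⊆⇒active : ∀ j {x y} s → x < k → replicate j x ++ [ y ] ⊆ s → x < y → j ≤ active x s
      ⊆⇒active zero    s       x<k sub          x<y = ℕ.z≤n
      ⊆⇒active (suc j) (u ∷ s) x<k (.u ∷ʳ sub)  x<y = ℕₚ.≤-trans (⊆⇒active (suc j) s x<k sub x<y) (ℕₚ.m≤n+m _ _)
      ⊆⇒active (suc j) {x} (.x ∷ s) x<k (refl ∷ sub) x<y =
        ℕₚ.+-mono-≤ (ℕₚ.≤-reflexive (sym (⟦⟧-yes ((x ≟ x) ×-dec (x <? height s)) (refl ,
                       live-threshold k x<k (suffix-live (⊆-trans (Subₚ.++⁺ˡ (replicate j x) ⊆-refl) sub) x<y)))))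
                    (⊆⇒active j s x<k sub x<y)

      active⇒⊆ : ∀ j {x} s → suc j ≤ active x s → ∃ λ y → x < y × replicate (suc j) x ++ [ y ] ⊆ s
      active⇒⊆ j {x} (u ∷ s) j≤ with (u ≟ x) ×-dec (u <? height s)
      active⇒⊆ j (u ∷ s) j≤ | no _ = let y , x<y , sub = active⇒⊆ j s j≤ in y , x<y , u ∷ʳ sub
      active⇒⊆ zero    {x} (.x ∷ s) j≤ | yes (refl , u<) with threshold-live k u<
      ... | y ∷ [] , sub , _ ∷ [] , x<y ∷ [] = y , x<y , refl ∷ sub
      active⇒⊆ (suc j) {x} (.x ∷ s) j≤ | yes (refl , u<) =
        let y , x<y , sub = active⇒⊆ j s (ℕ.s≤s⁻¹ j≤) in y , x<y , refl ∷ sub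

      1<2 : 1 < 2
      1<2 = ℕₚ.n<1+n 1

      ⋖-replicate : ∀ j {x y} → x < y → replicate j x ⋖ [ y ]
      ⋖-replicate j x<y = Allₚ.replicate⁺ j (x<y ∷ [])

    avoids-⊕1⇒ : ∀ {π : Word k} → Avoids π σ → ∀ x → active x (letters π) ≤ b
    avoids-⊕1⇒ {π} a x = ℕₚ.≮⇒≥ λ b< → let y , x<y , sub = active⇒⊆ b _ b< in
      a (has⇒contains {π = π} (_ , sub , ≅-++⁺ (≅-replicate⁺ (suc b) x 1) ([] ∷ []) (⋖-replicate (suc b) x<y) (⋖-replicate (suc b) 1<2)))

    ⇒avoids-⊕1 : ∀ {π : Word k} → (∀ x → active x (letters π) ≤ b) → Avoids π σ
    ⇒avoids-⊕1 {π} act c with contains⇒has c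
    ... | l , sub , e with ≅-++⁻ (replicate (suc b) 1) e (⋖-replicate (suc b) 1<2)
    ... | x ∷ l₁ , y ∷ [] , refl , e₁ , [] ∷ [] , ((x<y ∷ []) ∷ _) with refl ← ≅-replicate⁻ b e₁ =
      ℕₚ.<⇒≱ (⊆⇒active (suc b) (letters π) (All.head (Subₚ.All-resp-⊆ sub (letters-< π))) sub x<y) (act x)

  -- Within a class both the visible copies and, by the multiplicities, all copies of a letter are
  -- equally many, hence also the active ones, whose number decides about `σ`.
  avoids-⊕1-class : ∀ S {π π′} → IsMultiperm S π → IsMultiperm S π′ → SameClass τ π π′ → Avoids π σ → Avoids π′ σ
  avoids-⊕1-class S {π} {π′} mp mp′ eq a = ⇒avoids-⊕1 {π = π′} λ x → ≤b x (x <? k S)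
    where
    open Live (k S) τ
    ≤b : ∀ x → Dec (x < k S) → active x (letters π′) ≤ b
    ≤b x (no x≮k) = ℕₚ.≤-trans (ℕₚ.≤-reflexive (active-none (letters π′)
      (ℕₚ.≤-trans (threshold-≤ (k S) (letters π′)) (ℕₚ.≮⇒≥ x≮k)))) ℕ.z≤n
    ≤b x (yes x<k) = ℕₚ.≤-trans (ℕₚ.≤-reflexive (ℕₚ.+-cancelˡ-≡ (count x (visible (mask (letters π)))) _ _ (begin
      count x (visible (mask (letters π))) + active x (letters π′)  ≡⟨ cong (λ κ → count x (visible κ) + active x (letters π′)) eq ⟩
      count x (visible (mask (letters π′))) + active x (letters π′) ≡⟨ sym (count-visible x (letters π′)) ⟩
      count x (letters π′)                                          ≡⟨ content ⟩
      count x (letters π)                                           ≡⟨ count-visible x (letters π) ⟩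
      count x (visible (mask (letters π))) + active x (letters π)   ∎))) (avoids-⊕1⇒ {π = π} a x)
      where
      open ≡-Reasoning
      i = fromℕ< x<k
      content : count x (letters π′) ≡ count x (letters π)
      content = subst (λ z → count z (letters π′) ≡ count z (letters π)) (Finₚ.toℕ-fromℕ< x<k)
        (trans (sym (occurrences≡count i π′)) (trans (trans (mp′ i) (sym (mp i))) (occurrences≡count i π)))

  avoids-⊕1-bounded : ∀ {k} {π : Word k} → Avoids π σ → All (Bounded b) (activeOps τ π)
  avoids-⊕1-bounded {π = π} a = activeOps-bounded τ π (avoids-⊕1⇒ {π = π} a)

-- Insertion of a new maximum; patterns governed by the length.

backward-add : ∀ r u w ω h y → backward r (add ∷ ω) (h , u ∷ w) y ≡ backward r ω (h , w) y
backward-add r u w ω h y = ℕₚ.+-identityʳ _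

backward-del : ∀ r m ω h w y → backward r (del m ∷ ω) (h , w) y ≡
  ∑ (ins m h w) (λ z → ⟦ av? r z ⟧ * backward r ω (suc h , z) y)
backward-del r m ω h w y =
  trans (∑-map {B = State} (suc h ,_) (filter (av? r) (ins m h w)) (λ s → backward r ω s y))
        (∑-filter (av? r) (ins m h w) (λ z → backward r ω (suc h , z) y))

-- What one entry of `ins m v w` looks like when `v` exceeds all of `w`, so that arguments about a
-- single entry need no recursion over the listing.
record Inserted (m v : ℕ) (w z : List ℕ) : Set where
  field
    rest  : filter (_<? v) z ≡ w
    total : count v z ≡ m
    bound : All (_≤ v) z
    long  : length z ≡ m + length w

inserted-new : ∀ {m v w z} → Inserted m v w z → Inserted (suc m) v w (v ∷ z)
inserted-new {v = v} {z = z} i = record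
  { rest  = trans (filter-reject (_<? v) {xs = z} (ℕₚ.<-irrefl refl)) rest
  ; total = trans (cong (_+ count v z) (⟦⟧-yes (v ≟ v) refl)) (cong suc total)
  ; bound = ℕₚ.≤-refl ∷ bound
  ; long  = cong suc long }
  where open Inserted i

inserted-∷ : ∀ {m v w z x} → x < v → Inserted m v w z → Inserted m v (x ∷ w) (x ∷ z)
inserted-∷ {v = v} {z = z} {x} x<v i = record
  { rest  = trans (filter-accept (_<? v) {xs = z} x<v) (cong (x ∷_) rest)
  ; total = trans (cong (_+ count v z) (⟦⟧-no (x ≟ v) (ℕₚ.<⇒≢ x<v))) total
  ; bound = ℕₚ.<⇒≤ x<v ∷ bound
  ; long  = trans (cong suc long) (sym (ℕₚ.+-suc _ _)) }
  where open Inserted i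

inserted-none : ∀ {v w} → All (_< v) w → Inserted 0 v w w
inserted-none w<v = record
  { rest = filter-all _ w<v ; total = count-∉ _ w<v ; bound = All.map ℕₚ.<⇒≤ w<v ; long = refl }

ins-spec : ∀ m {v} w → All (_< v) w → All (Inserted m v w) (ins m v w)
ins-spec zero        w w<v = inserted-none w<v ∷ []
ins-spec (suc m) {v} w w<v = go w w<v
  where
  go : ∀ w → All (_< v) w → All (Inserted (suc m) v w) (ins (suc m) v w)
  go []      []          = Allₚ.map⁺ (All.map inserted-new (ins-spec m [] []))
  go (x ∷ w) (x<v ∷ w<v) = Allₚ.++⁺ (Allₚ.map⁺ (All.map inserted-new (ins-spec m (x ∷ w) (x<v ∷ w<v))))
                                    (Allₚ.map⁺ (All.map (inserted-∷ x<v) (go w w<v)))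

module _ {m v w z} (i : Inserted m v w z) where
  open Inserted i

  inserted-⊆ : w ⊆ z
  inserted-⊆ = subst (_⊆ z) rest (Subₚ.filter-⊆ (_<? v) z)

  inserted-old : ∀ {l} → l ⊆ z → All (_< v) l → l ⊆ w
  inserted-old {l} sub l<v = subst₂ _⊆_ (filter-all (_<? v) l<v) rest
    (Subₚ.filter⁺ (_<? v) (_<? v) (λ { refl → id }) sub)

count-⊆ : ∀ {v} z → 1 ≤ count v z → [ v ] ⊆ z
count-⊆ {v} (y ∷ z) 1≤ with y ≟ v
... | yes refl = refl ∷ minimum z
... | no _     = y ∷ʳ count-⊆ z 1≤

count-⊆₂ : ∀ {v} z → 2 ≤ count v z → v ∷ v ∷ [] ⊆ z
count-⊆₂ {v} (y ∷ z) 2≤ with y ≟ v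
... | yes refl = refl ∷ count-⊆ z (ℕ.s≤s⁻¹ 2≤)
... | no _     = y ∷ʳ count-⊆₂ z 2≤

module _ {x r y s} (so : SameOrder x r y s) where

  so-< : {_ : True (r <? s)} → x < y
  so-< {t} = Equivalence.from (proj₁ so) (toWitness t)

  so-> : {_ : True (s <? r)} → y < x
  so-> {t} = Equivalence.from (proj₂ so) (toWitness t)

  so-≡ : {_ : True (r ≟ s)} → x ≡ y
  so-≡ {t} with refl ← toWitness {a? = r ≟ s} t =
    ℕₚ.≤-antisym (ℕₚ.≮⇒≥ (ℕₚ.<-irrefl refl ∘ Equivalence.to (proj₂ so)))
                 (ℕₚ.≮⇒≥ (ℕₚ.<-irrefl refl ∘ Equivalence.to (proj₁ so)))

so-<⁺ : ∀ {x r y s} → x < y → {_ : True (r <? s)} → SameOrder x r y s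
so-<⁺ x<y {t} = mk⇔ (λ _ → toWitness t) (λ _ → x<y)
             , mk⇔ (λ y<x → contradiction y<x (ℕₚ.<-asym x<y)) (λ s<r → contradiction s<r (ℕₚ.<-asym (toWitness t)))

so->⁺ : ∀ {x r y s} → y < x → {_ : True (s <? r)} → SameOrder x r y s
so->⁺ y<x {t} = swap (so-<⁺ y<x {t})

so-≡⁺ : ∀ {x r} → SameOrder x r x r
so-≡⁺ = mk⇔ (λ lt → contradiction lt (ℕₚ.<-irrefl refl)) (λ lt → contradiction lt (ℕₚ.<-irrefl refl))
      , mk⇔ (λ lt → contradiction lt (ℕₚ.<-irrefl refl)) (λ lt → contradiction lt (ℕₚ.<-irrefl refl))

av-∷⁺ : ∀ {r x z} → Av r z → (∀ {l} → l ⊆ z → ¬ x ∷ l ≅ r) → Av r (x ∷ z)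
av-∷⁺ a f (l , _ ∷ʳ sub , e)        = a (l , sub , e)
av-∷⁺ a f (_ ∷ l , refl ∷ sub , e) = f sub e

av-∷⁻ : ∀ {r x z} → Av r (x ∷ z) → Av r z
av-∷⁻ = Av-⊆ (_ ∷ʳ ⊆-refl)

backward-[] : ∀ r h w H → backward r [] (h , w) (H , []) ≡ ⟦ (h ≟ H) ×-dec (length w ≟ 0) ⟧
backward-[] r h w H = ⟦⟧-cong ((h , w) ≟ˢ (H , [])) ((h ≟ H) ×-dec (length w ≟ 0)) (λ { refl → refl , refl }) (back w)
  where
  back : ∀ w → h ≡ H × length w ≡ 0 → (h , w) ≡ (H , [])
  back [] (refl , _) = refl

-- Here `c m n` stands for the number of admissible insertions of `m` copies into a state of length
-- `n`; if it depends on nothing else, the number of walks is this product.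
length-path : (ℕ → ℕ → ℕ) → ℕ → List Op → ℕ → ℕ → ℕ
length-path c H []          h n       = ⟦ (h ≟ H) ×-dec (n ≟ 0) ⟧
length-path c H (add ∷ ω)   h zero    = 0
length-path c H (add ∷ ω)   h (suc n) = length-path c H ω h n
length-path c H (del m ∷ ω) h n       = c m n * length-path c H ω (suc h) (m + n)

backward-by-length : ∀ {r} (c : ℕ → ℕ → ℕ) →
  (∀ m {v} w → All (_< v) w → Av r w → ∑ (ins m v w) (λ z → ⟦ av? r z ⟧) ≡ c m (length w)) →
  ∀ ω {h H} w → All (_< h) w → Av r w → backward r ω (h , w) (H , []) ≡ length-path c H ω h (length w)
backward-by-length {r} c c≡ [] w w<h a = backward-[] r _ w _
backward-by-length c c≡ (add ∷ ω) []      w<h a = refl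
backward-by-length {r} c c≡ (add ∷ ω) (u ∷ w) (_ ∷ w<h) a =
  trans (backward-add r u w ω _ _) (backward-by-length c c≡ ω w w<h (av-∷⁻ a))
backward-by-length {r} c c≡ (del m ∷ ω) {h} {H} w w<h a = begin
  backward r (del m ∷ ω) (h , w) (H , [])
    ≡⟨ backward-del r m ω h w _ ⟩
  ∑ (ins m h w) (λ z → ⟦ av? r z ⟧ * backward r ω (suc h , z) (H , []))
    ≡⟨ ∑-cong-All (ins m h w) (All.map (λ {z} i → ⟦⟧*-cong (av? r z) λ az →
         trans (backward-by-length c c≡ ω z (All.map ℕ.s≤s (Inserted.bound i)) az)
               (cong (length-path c H ω (suc h)) (Inserted.long i))) (ins-spec m w w<h)) ⟩
  ∑ (ins m h w) (λ z → ⟦ av? r z ⟧ * length-path c H ω (suc h) (m + length w))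
    ≡⟨ ∑-*ʳ _ (ins m h w) _ ⟩
  ∑ (ins m h w) (λ z → ⟦ av? r z ⟧) * length-path c H ω (suc h) (m + length w)
    ≡⟨ cong (_* _) (c≡ m w w<h a) ⟩
  c m (length w) * length-path c H ω (suc h) (m + length w)
    ∎
  where open ≡-Reasoning

backward-≡-by-length : ∀ {r r′} (c : ℕ → ℕ → ℕ) → Av r [] → Av r′ [] →
  (∀ m {v} w → All (_< v) w → Av r w → ∑ (ins m v w) (λ z → ⟦ av? r z ⟧) ≡ c m (length w)) →
  (∀ m {v} w → All (_< v) w → Av r′ w → ∑ (ins m v w) (λ z → ⟦ av? r′ z ⟧) ≡ c m (length w)) →
  ∀ ω H → backward r ω (0 , []) (H , []) ≡ backward r′ ω (0 , []) (H , [])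
backward-≡-by-length c a a′ e e′ ω H =
  trans (backward-by-length c e ω [] [] a) (sym (backward-by-length c e′ ω [] [] a′))

av-[] : ∀ {x r} → Av (x ∷ r) []
av-[] (_ , [] , ())

av-swap : ∀ {r z z′} → (Av r z → Av r z′) → (Av r z′ → Av r z) → ⟦ av? r z ⟧ ≡ ⟦ av? r z′ ⟧
av-swap {r} {z} {z′} = ⟦⟧-cong (av? r z) (av? r z′)

∑-ins-cong : ∀ m {v} w {f g : List ℕ → ℕ} → All (_< v) w → (∀ {z} → Inserted m v w z → f z ≡ g z) →
             ∑ (ins m v w) f ≡ ∑ (ins m v w) g
∑-ins-cong m w w<v e = ∑-cong-All (ins m _ w) (All.map e (ins-spec m w w<v))

∑-ins-vanish : ∀ m {v} w {f : List ℕ → ℕ} → All (_< v) w → (∀ {z} → Inserted m v w z → f z ≡ 0) →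
               ∑ (ins m v w) f ≡ 0
∑-ins-vanish m w w<v e = ∑-vanish (ins m _ w) (All.map e (ins-spec m w w<v))

-- The list is weakly increasing, so all copies of the maximum go to its end; in `ins-12` it is
-- weakly decreasing and they go to its front.
ins-21 : ∀ m {v} w → All (_< v) w → Av (2 ∷ 1 ∷ []) w → ∑ (ins m v w) (λ z → ⟦ av? (2 ∷ 1 ∷ []) z ⟧) ≡ 1
ins-21 zero    w  w<v a = trans (ℕₚ.+-identityʳ _) (⟦⟧-yes (av? _ w) a)
ins-21 (suc m) {v} [] w<v a =
  trans (∑-ins-[] m v _)
  (trans (∑-ins-cong m [] [] λ {z} i → av-swap {z = v ∷ z} {z} av-∷⁻ λ az → av-∷⁺ az λ
           { {x ∷ []} sub ((so ∷ []) ∷ _) → contradiction (inserted-old i sub (so-> so ∷ [])) λ () })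
         (ins-21 m [] [] a))
ins-21 (suc m) {v} (x ∷ w) (x<v ∷ w<v) a =
  trans (∑-ins-∷ m v x w _)
  (trans (cong₂ _+_
    (∑-ins-vanish m (x ∷ w) (x<v ∷ w<v) λ {z} i → ⟦⟧-no (av? _ (v ∷ z)) λ az →
       az (_ , refl ∷ ⊆-trans (refl ∷ minimum w) (inserted-⊆ i) , (so->⁺ x<v ∷ []) ∷ [] ∷ []))
    (∑-ins-cong (suc m) w w<v λ {z} i → av-swap {z = x ∷ z} {z} av-∷⁻ λ az → av-∷⁺ az λ
       { {y ∷ []} sub e@((so ∷ []) ∷ _) →
         a (_ , refl ∷ inserted-old i sub (ℕₚ.<-trans (so-> so) x<v ∷ []) , e) }))
    (ins-21 (suc m) w w<v (av-∷⁻ a)))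

ins-12 : ∀ m {v} w → All (_< v) w → Av (1 ∷ 2 ∷ []) w → ∑ (ins m v w) (λ z → ⟦ av? (1 ∷ 2 ∷ []) z ⟧) ≡ 1
ins-12 zero    w  w<v a = trans (ℕₚ.+-identityʳ _) (⟦⟧-yes (av? _ w) a)
ins-12 (suc m) {v} w w<v a = split w w<v a
  where
  front : ∀ w → All (_< v) w → Av (1 ∷ 2 ∷ []) w → ∑ (ins m v w) (λ z → ⟦ av? (1 ∷ 2 ∷ []) (v ∷ z) ⟧) ≡ 1
  front w w<v a =
    trans (∑-ins-cong m w w<v λ {z} i → av-swap {z = v ∷ z} {z} av-∷⁻ λ az → av-∷⁺ az λ
             { {x ∷ []} sub ((so ∷ []) ∷ _) →
               ℕₚ.<⇒≱ (so-< so) (All.head (Subₚ.All-resp-⊆ sub (Inserted.bound i))) })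
          (ins-12 m w w<v a)
  split : ∀ w → All (_< v) w → Av (1 ∷ 2 ∷ []) w → ∑ (ins (suc m) v w) (λ z → ⟦ av? (1 ∷ 2 ∷ []) z ⟧) ≡ 1
  split []      w<v a = trans (∑-ins-[] m v _) (front [] w<v a)
  split (x ∷ w) (x<v ∷ w<v) a =
    trans (∑-ins-∷ m v x w _)
    (cong₂ _+_ (front (x ∷ w) (x<v ∷ w<v) a)
      (∑-ins-vanish (suc m) w w<v λ {z} i → ⟦⟧-no (av? _ (x ∷ z)) λ az →
         az (_ , refl ∷ count-⊆ z (ℕₚ.≤-trans (ℕ.s≤s ℕ.z≤n) (ℕₚ.≤-reflexive (sym (Inserted.total i))))
            , (so-<⁺ x<v ∷ []) ∷ [] ∷ [])))

backward-12≡21 : ∀ ω H → backward (2 ∷ 1 ∷ []) ω (0 , []) (H , []) ≡ backward (1 ∷ 2 ∷ []) ω (0 , []) (H , [])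
backward-12≡21 = backward-≡-by-length (λ _ _ → 1) av-[] av-[] ins-21 ins-12

-- One copy goes freely into any of the `n + 1` gaps, and it forces the remaining ones: to the end
-- for 221, next to it for 212, to the front for 122 (as patterns of the reversed words).
placements : ℕ → ℕ → ℕ
placements zero    n = 1
placements (suc m) n = suc n

module _ {v : ℕ} where

  private
    0-copies : ∀ {r} w → Av r w → ∑ (ins 0 v w) (λ z → ⟦ av? r z ⟧) ≡ 1
    0-copies w a = trans (ℕₚ.+-identityʳ _) (⟦⟧-yes (av? _ w) a)

    v-in : ∀ {m w z} → Inserted (suc m) v w z → [ v ] ⊆ z
    v-in {z = z} i = count-⊆ z (ℕₚ.≤-trans (ℕ.s≤s ℕ.z≤n) (ℕₚ.≤-reflexive (sym (Inserted.total i))))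

    vv-in : ∀ {m w z} → Inserted (suc (suc m)) v w z → v ∷ v ∷ [] ⊆ z
    vv-in {z = z} i = count-⊆₂ z (ℕₚ.≤-trans (ℕ.s≤s (ℕ.s≤s ℕ.z≤n)) (ℕₚ.≤-reflexive (sym (Inserted.total i))))

    not-< : ∀ {m w z x l} → Inserted m v w z → x ∷ l ⊆ z → ¬ v < x
    not-< i sub v<x = ℕₚ.<⇒≱ v<x (All.head (Subₚ.All-resp-⊆ sub (Inserted.bound i)))

  -- After the second copy of the new maximum there is no smaller letter.
  ins-221 : ∀ m w → All (_< v) w → Av (2 ∷ 2 ∷ 1 ∷ []) w →
            ∑ (ins m v w) (λ z → ⟦ av? (2 ∷ 2 ∷ 1 ∷ []) z ⟧) ≡ placements m (length w)
  ins-221 zero    w w<v a = 0-copies w a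
  ins-221 (suc m) w w<v a = go w w<v a
    where
    r : List ℕ
    r = 2 ∷ 2 ∷ 1 ∷ []
    keep : ∀ {m w z} x → x < v → Av r (x ∷ w) → Inserted m v w z → Av r z → Av r (x ∷ z)
    keep x x<v a i az = av-∷⁺ az λ
      { {y ∷ u ∷ []} sub e@((so ∷ so′ ∷ []) ∷ _) → a (_ , refl ∷ inserted-old i sub
        (subst (_< v) (so-≡ so) x<v ∷ ℕₚ.<-trans (so-> so′) x<v ∷ []) , e) }
    back : ∀ m w → All (_< v) w → Av r w → ∑ (ins m v w) (λ z → ⟦ av? r (v ∷ z) ⟧) ≡ 1
    back zero w w<v a = trans (ℕₚ.+-identityʳ _) (⟦⟧-yes (av? r (v ∷ w)) (av-∷⁺ a λ
      { {y ∷ _ ∷ []} sub ((so ∷ _ ∷ []) ∷ _) → ℕₚ.<-irrefl (sym (so-≡ so)) (All.head (Subₚ.All-resp-⊆ sub w<v)) }))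
    back (suc m) [] w<v a =
      trans (∑-ins-[] m v _)
      (trans (∑-ins-cong m [] [] λ {z} i → av-swap {z = v ∷ v ∷ z} {v ∷ z} av-∷⁻ λ az → av-∷⁺ az λ
               { (refl ∷ sub) ((so ∷ so′ ∷ []) ∷ _) → contradiction (inserted-old i sub (so-> so′ ∷ [])) λ ()
               ; {_ ∷ u ∷ []} (_ ∷ʳ sub) ((so ∷ so′ ∷ []) ∷ _) →
                 contradiction (inserted-old i (⊆-trans (_ ∷ʳ ⊆-refl) sub) (so-> so′ ∷ [])) λ () })
             (back m [] w<v a))
    back (suc m) (y ∷ w) (y<v ∷ w<v) a =
      trans (∑-ins-∷ m v y w _)
      (cong₂ _+_
        (∑-ins-vanish m (y ∷ w) (y<v ∷ w<v) λ {z} i → ⟦⟧-no (av? r (v ∷ v ∷ z)) λ az →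
           az (_ , refl ∷ refl ∷ ⊆-trans (refl ∷ minimum w) (inserted-⊆ i)
              , (so-≡⁺ ∷ so->⁺ y<v ∷ []) ∷ (so->⁺ y<v ∷ []) ∷ [] ∷ []))
        (trans (∑-ins-cong (suc m) w w<v λ {z} i → av-swap {z = v ∷ y ∷ z} {v ∷ z}
                 (Av-⊆ (refl ∷ _ ∷ʳ ⊆-refl))
                 λ az → av-∷⁺ (keep y y<v a i (av-∷⁻ az)) λ
                   { (_ ∷ʳ sub) e → az (_ , refl ∷ sub , e)
                   ; (refl ∷ sub) ((so ∷ _) ∷ _) → ℕₚ.<-irrefl (sym (so-≡ so)) y<v })
               (back (suc m) w w<v (av-∷⁻ a))))
    go : ∀ w → All (_< v) w → Av r w → ∑ (ins (suc m) v w) (λ z → ⟦ av? r z ⟧) ≡ suc (length w)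
    go []      w<v a = trans (∑-ins-[] m v _) (back m [] w<v a)
    go (x ∷ w) (x<v ∷ w<v) a =
      trans (∑-ins-∷ m v x w _)
      (cong₂ _+_ (back m (x ∷ w) (x<v ∷ w<v) a)
        (trans (∑-ins-cong (suc m) w w<v λ {z} i → av-swap {z = x ∷ z} {z} av-∷⁻ (keep x x<v a i))
               (go w w<v (av-∷⁻ a))))

  -- The copies of the new maximum are consecutive.
  ins-212 : ∀ m w → All (_< v) w → Av (2 ∷ 1 ∷ 2 ∷ []) w →
            ∑ (ins m v w) (λ z → ⟦ av? (2 ∷ 1 ∷ 2 ∷ []) z ⟧) ≡ placements m (length w)
  ins-212 zero    w w<v a = 0-copies w a
  ins-212 (suc m) w w<v a = go w w<v a
    where
    r : List ℕ
    r = 2 ∷ 1 ∷ 2 ∷ []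
    keep : ∀ {m w z} x → x < v → Av r (x ∷ w) → Inserted m v w z → Av r z → Av r (x ∷ z)
    keep x x<v a i az = av-∷⁺ az λ
      { {y ∷ u ∷ []} sub e@((so ∷ so′ ∷ []) ∷ _) → a (_ , refl ∷ inserted-old i sub
        (ℕₚ.<-trans (so-> so) x<v ∷ subst (_< v) (so-≡ so′) x<v ∷ []) , e) }
    front : ∀ m w → All (_< v) w → Av r w → ∑ (ins m v w) (λ z → ⟦ av? r (v ∷ z) ⟧) ≡ 1
    front zero w w<v a = trans (ℕₚ.+-identityʳ _) (⟦⟧-yes (av? r (v ∷ w)) (av-∷⁺ a λ
      { {_ ∷ y ∷ []} sub ((_ ∷ so ∷ []) ∷ _) → ℕₚ.<-irrefl (sym (so-≡ so)) (All.head (All.tail (Subₚ.All-resp-⊆ sub w<v))) }))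
    front (suc m) w w<v a = step w w<v a
      where
      double : ∀ w → All (_< v) w → Av r w → ∑ (ins m v w) (λ z → ⟦ av? r (v ∷ v ∷ z) ⟧) ≡ 1
      double w w<v a =
        trans (∑-ins-cong m w w<v λ {z} i → av-swap {z = v ∷ v ∷ z} {v ∷ z} av-∷⁻ λ az → av-∷⁺ az λ
                { (refl ∷ sub) ((so ∷ _) ∷ _) → ℕₚ.<-irrefl refl (so-> so)
                ; (_ ∷ʳ sub) e → az (_ , refl ∷ sub , e) })
              (front m w w<v a)
      step : ∀ w → All (_< v) w → Av r w → ∑ (ins (suc m) v w) (λ z → ⟦ av? r (v ∷ z) ⟧) ≡ 1
      step [] w<v a = trans (∑-ins-[] m v _) (double [] w<v a)
      step (y ∷ w) (y<v ∷ w<v) a =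
        trans (∑-ins-∷ m v y w _)
        (cong₂ _+_ (double (y ∷ w) (y<v ∷ w<v) a)
          (∑-ins-vanish (suc m) w w<v λ {z} i → ⟦⟧-no (av? r (v ∷ y ∷ z)) λ az →
             az (_ , refl ∷ refl ∷ v-in i , (so->⁺ y<v ∷ so-≡⁺ ∷ []) ∷ (so-<⁺ y<v ∷ []) ∷ [] ∷ [])))
    go : ∀ w → All (_< v) w → Av r w → ∑ (ins (suc m) v w) (λ z → ⟦ av? r z ⟧) ≡ suc (length w)
    go []      w<v a = trans (∑-ins-[] m v _) (front m [] w<v a)
    go (x ∷ w) (x<v ∷ w<v) a =
      trans (∑-ins-∷ m v x w _)
      (cong₂ _+_ (front m (x ∷ w) (x<v ∷ w<v) a)
        (trans (∑-ins-cong (suc m) w w<v λ {z} i → av-swap {z = x ∷ z} {z} av-∷⁻ (keep x x<v a i))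
               (go w w<v (av-∷⁻ a))))

  -- Before the last but one copy of the new maximum there is no smaller letter.
  ins-122 : ∀ m w → All (_< v) w → Av (1 ∷ 2 ∷ 2 ∷ []) w →
            ∑ (ins m v w) (λ z → ⟦ av? (1 ∷ 2 ∷ 2 ∷ []) z ⟧) ≡ placements m (length w)
  ins-122 zero    w w<v a = 0-copies w a
  ins-122 (suc m) w w<v a = go m w w<v a
    where
    r : List ℕ
    r = 1 ∷ 2 ∷ 2 ∷ []
    front : ∀ m w → All (_< v) w → ∑ (ins m v w) (λ z → ⟦ av? r (v ∷ z) ⟧) ≡ ∑ (ins m v w) (λ z → ⟦ av? r z ⟧)
    front m w w<v = ∑-ins-cong m w w<v λ {z} i → av-swap {z = v ∷ z} {z} av-∷⁻ λ az → av-∷⁺ az λ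
      { {x ∷ _} sub ((so ∷ _) ∷ _) → not-< i sub (so-< so) }
    one : ∀ w → All (_< v) w → Av r w → ∑ (ins 1 v w) (λ z → ⟦ av? r z ⟧) ≡ suc (length w)
    one [] w<v a = trans (∑-ins-[] 0 v (λ z → ⟦ av? r z ⟧)) (trans (front 0 [] []) (0-copies [] a))
    one (x ∷ w) (x<v ∷ w<v) a =
      trans (∑-ins-∷ 0 v x w (λ z → ⟦ av? r z ⟧))
      (cong₂ _+_ (trans (front 0 (x ∷ w) (x<v ∷ w<v)) (0-copies (x ∷ w) a))
        (trans (∑-ins-cong 1 w w<v λ {z} i → av-swap {z = x ∷ z} {z} av-∷⁻ λ az → av-∷⁺ az λ
                 { {y ∷ y′ ∷ []} sub e@((so ∷ so′ ∷ []) ∷ ((so″ ∷ []) ∷ _)) → a (_ , refl ∷ inserted-old i sub (single i sub (so-≡ so″)) , e) })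
               (one w w<v (av-∷⁻ a))))
      where
      single : ∀ {w z y y′} → Inserted 1 v w z → y ∷ y′ ∷ [] ⊆ z → y ≡ y′ → All (_< v) (y ∷ y′ ∷ [])
      single {z = z} {y} i sub refl = y<v ∷ y<v ∷ []
        where
        y<v : y < v
        y<v = ℕₚ.≤∧≢⇒< (All.head (Subₚ.All-resp-⊆ sub (Inserted.bound i))) λ { refl →
          ℕₚ.<⇒≱ (ℕₚ.n<1+n 1) (ℕₚ.≤-trans (replicate-⊆⇒count 1 2 z sub) (ℕₚ.≤-reflexive (Inserted.total i))) }
    go : ∀ m w → All (_< v) w → Av r w → ∑ (ins (suc m) v w) (λ z → ⟦ av? r z ⟧) ≡ suc (length w)
    go zero    w       w<v a = one w w<v a
    go (suc m) []      w<v a = trans (∑-ins-[] (suc m) v _) (trans (front (suc m) [] []) (go m [] [] a))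
    go (suc m) (x ∷ w) (x<v ∷ w<v) a =
      trans (∑-ins-∷ (suc m) v x w _)
      (trans (cong₂ _+_ (trans (front (suc m) (x ∷ w) (x<v ∷ w<v)) (go m (x ∷ w) (x<v ∷ w<v) a))
        (∑-ins-vanish (suc (suc m)) w w<v λ {z} i → ⟦⟧-no (av? r (x ∷ z)) λ az →
           az (_ , refl ∷ vv-in i , (so-<⁺ x<v ∷ so-<⁺ x<v ∷ []) ∷ (so-≡⁺ ∷ []) ∷ [] ∷ [])))
      (ℕₚ.+-identityʳ _))

backward-122≡212 : ∀ ω H → backward (2 ∷ 2 ∷ 1 ∷ []) ω (0 , []) (H , []) ≡ backward (2 ∷ 1 ∷ 2 ∷ []) ω (0 , []) (H , [])
backward-122≡212 = backward-≡-by-length placements av-[] av-[] (λ m → ins-221 m) (λ m → ins-212 m)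

backward-122≡221 : ∀ ω H → backward (2 ∷ 2 ∷ 1 ∷ []) ω (0 , []) (H , []) ≡ backward (1 ∷ 2 ∷ 2 ∷ []) ω (0 , []) (H , [])
backward-122≡221 = backward-≡-by-length placements av-[] av-[] (λ m → ins-221 m) (λ m → ins-122 m)

-- Patterns governed by insertion sites: 2132 and 2213.

site-path : ℕ → ℕ → List Op → ℕ → ℕ → ℕ → ℕ
site-path H n []                       h l α = ⟦ (h ≟ H) ×-dec (l ≟ n) ⟧
site-path H n (del 0 ∷ ω)              h l α = site-path H n ω (suc h) l α
site-path H n (del 1 ∷ ω)              h l α = α * site-path H n ω (suc h) (suc l) (suc α)
-- Of the `α (α + 1) / 2` choices of two sites, equal or not, `i + 1` leave `3 + i` sites. For 2213
-- the copy nearer to the front is then at the site numbered `i + 1` from the end, and the other one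
-- has `i + 1` choices; for 2132 the copies are `α - 1 - i` sites apart.
site-path H n (del (suc (suc _)) ∷ ω)  h l α =
  ∑ (upTo α) λ i → suc i * site-path H n ω (suc h) (suc (suc l)) (3 + i)
site-path H n (add ∷ ω)                h l α = 0

-- A statistic counting the admissible sites for a new maximum.
record Sites (r : List ℕ) : Set where
  field
    sites   : List ℕ → ℕ
    sites-1 : ∀ {v} w (F : ℕ → ℕ) → All (_< v) w → Av r w →
      ∑ (ins 1 v w) (λ z → ⟦ av? r z ⟧ * F (sites z)) ≡ sites w * F (suc (sites w))
    sites-2 : ∀ {v} w (F : ℕ → ℕ) → All (_< v) w → Av r w →
      ∑ (ins 2 v w) (λ z → ⟦ av? r z ⟧ * F (sites z)) ≡ ∑ (upTo (sites w)) (λ i → suc i * F (3 + i))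

-- A removal takes the front letter away, whichever it is, so once the insertions are over only the
-- length counts.
backward-adds : ∀ r n h w H → backward r (replicate n add) (h , w) (H , []) ≡ ⟦ (h ≟ H) ×-dec (length w ≟ n) ⟧
backward-adds r zero    h w H = backward-[] r h w H
backward-adds r (suc n) h [] H = sym (⟦⟧-no ((h ≟ H) ×-dec (0 ≟ suc n)) λ ())
backward-adds r (suc n) h (u ∷ w) H =
  trans (backward-add r u w (replicate n add) h (H , []))
  (trans (backward-adds r n h w H)
         (⟦⟧-cong ((h ≟ H) ×-dec (length w ≟ n)) ((h ≟ H) ×-dec (suc (length w) ≟ suc n))
                  (λ (a , b) → a , cong suc b) (λ (a , b) → a , ℕₚ.suc-injective b)))

module _ {r : List ℕ} (S : Sites r) where
  open Sites S

  backward-by-sites : ∀ ω n {h H} w → All IsDel ω → All (Bounded 2) ω → All (_< h) w → Av r w →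
    backward r (ω ++ replicate n add) (h , w) (H , []) ≡ site-path H n ω h (length w) (sites w)
  backward-by-sites [] n w [] [] w<h a = backward-adds r n _ w _
  backward-by-sites (del 0 ∷ ω) n {h} w (_ ∷ ds) (_ ∷ bs) w<h a =
    trans (backward-del r 0 (ω ++ replicate n add) h w _)
    (trans (ℕₚ.+-identityʳ _)
    (trans (cong (_* backward r (ω ++ replicate n add) (suc h , w) _) (⟦⟧-yes (av? r w) a))
    (trans (ℕₚ.*-identityˡ _) (backward-by-sites ω n w ds bs (All.map ℕₚ.m<n⇒m<1+n w<h) a))))
  backward-by-sites (del 1 ∷ ω) n {h} {H} w (_ ∷ ds) (_ ∷ bs) w<h a =
    trans (backward-del r 1 (ω ++ replicate n add) h w _)
    (trans (∑-ins-cong 1 w w<h λ {z} i → ⟦⟧*-cong (av? r z) λ az →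
              trans (backward-by-sites ω n z ds bs (All.map ℕ.s≤s (Inserted.bound i)) az)
                    (cong (λ l → site-path H n ω (suc h) l (sites z)) (Inserted.long i)))
           (sites-1 w (site-path H n ω (suc h) (suc (length w))) w<h a))
  backward-by-sites (del 2 ∷ ω) n {h} {H} w (_ ∷ ds) (_ ∷ bs) w<h a =
    trans (backward-del r 2 (ω ++ replicate n add) h w _)
    (trans (∑-ins-cong 2 w w<h λ {z} i → ⟦⟧*-cong (av? r z) λ az →
              trans (backward-by-sites ω n z ds bs (All.map ℕ.s≤s (Inserted.bound i)) az)
                    (cong (λ l → site-path H n ω (suc h) l (sites z)) (Inserted.long i)))
           (sites-2 w (site-path H n ω (suc h) (2 + length w)) w<h a))
  backward-by-sites (del (suc (suc (suc m))) ∷ ω) n w (_ ∷ ds) (ℕ.s≤s (ℕ.s≤s ()) ∷ bs) w<h a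
  backward-by-sites (add ∷ ω) n w ((_ , ()) ∷ ds) bs w<h a

-- In 2213 a new maximum cannot be placed after an occurrence of 221.
module Sites-2213 where

  private
    r r′ : List ℕ
    r  = 3 ∷ 1 ∷ 2 ∷ 2 ∷ []
    r′ = 1 ∷ 2 ∷ 2 ∷ []

  sites : List ℕ → ℕ
  sites []      = 1
  sites (x ∷ w) = ⟦ av? r′ (x ∷ w) ⟧ + sites w

  module _ {v : ℕ} where

    private
      -- If an old letter plays the 3, all letters of the occurrence are smaller than it, hence old
      -- as well.
      keep-av : ∀ {m w z} x → x < v → Av r (x ∷ w) → Inserted m v w z → ⟦ av? r (x ∷ z) ⟧ ≡ ⟦ av? r z ⟧
      keep-av {z = z} x x<v a i = av-swap {z = x ∷ z} {z} av-∷⁻ λ az → av-∷⁺ az λ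
        { {b ∷ c ∷ d ∷ []} sub e@((s₁ ∷ s₂ ∷ s₃ ∷ []) ∷ _) → a (_ , refl ∷ inserted-old i sub
          (ℕₚ.<-trans (so-> s₁) x<v ∷ ℕₚ.<-trans (so-> s₂) x<v ∷ ℕₚ.<-trans (so-> s₃) x<v ∷ []) , e) }

      -- The new maximum could only play a 2, but the pattern needs two equal ones.
      once-av′ : ∀ {w z} → Inserted 1 v w z → Av r′ w → Av r′ z
      once-av′ {z = z} i a (b ∷ c ∷ d ∷ [] , sub , e@((s₁ ∷ s₂ ∷ []) ∷ (s₃ ∷ []) ∷ _)) with so-≡ s₃
      ... | refl = a (_ , inserted-old i sub (ℕₚ.<-trans (so-< s₁) c<v ∷ c<v ∷ c<v ∷ []) , e)
        where
        c<v : c < v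
        c<v = ℕₚ.≤∧≢⇒< (All.head (All.tail (Subₚ.All-resp-⊆ sub (Inserted.bound i)))) λ { refl →
          ℕₚ.<⇒≱ (ℕₚ.n<1+n 1) (ℕₚ.≤-trans (replicate-⊆⇒count 1 2 z (⊆-trans (b ∷ʳ ⊆-refl) sub))
                                           (ℕₚ.≤-reflexive (Inserted.total i))) }

      once : ∀ {w z} → Inserted 1 v w z → ⟦ av? r′ z ⟧ ≡ ⟦ av? r′ w ⟧
      once {w} {z} i = ⟦⟧-cong (av? r′ z) (av? r′ w) (Av-⊆ (inserted-⊆ i)) (once-av′ i)

      top-av′ : ∀ {z} → All (_≤ v) z → ⟦ av? r′ (v ∷ z) ⟧ ≡ ⟦ av? r′ z ⟧
      top-av′ {z} z≤v = av-swap {z = v ∷ z} {z} av-∷⁻ λ az → av-∷⁺ az λ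
        { {c ∷ d ∷ []} sub ((s₁ ∷ _ ∷ []) ∷ _) → ℕₚ.<⇒≱ (so-< s₁) (All.head (Subₚ.All-resp-⊆ sub z≤v)) }

      top-av : ∀ {m w z} → All (_< v) w → Inserted m v w z → ⟦ av? r (v ∷ z) ⟧ ≡ ⟦ av? r′ w ⟧ * ⟦ av? r z ⟧
      top-av {w = w} {z} w<v i =
        trans (⟦⟧-cong (av? r (v ∷ z)) (av? r′ w ×-dec av? r z)
          (λ a → (λ (l , sub , e) → a (v ∷ l , refl ∷ ⊆-trans sub (inserted-⊆ i)
                   , above e (Subₚ.All-resp-⊆ sub w<v) ∷ e)) , av-∷⁻ a)
          (λ (a′ , az) → av-∷⁺ az λ
            { {b ∷ c ∷ d ∷ []} sub ((s₁ ∷ s₂ ∷ s₃ ∷ []) ∷ e) →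
              a′ (_ , inserted-old i sub (so-> s₁ ∷ so-> s₂ ∷ so-> s₃ ∷ []) , e) }))
        (⟦⟧-× (av? r′ w) (av? r z))
        where
        above : ∀ {l} → l ≅ r′ → All (_< v) l → Pointwise (SameOrder v 3) l r′
        above (_ ∷ _ ∷ _ ∷ []) (b<v ∷ c<v ∷ d<v ∷ []) = so->⁺ b<v ∷ so->⁺ c<v ∷ so->⁺ d<v ∷ []

    sites-1 : ∀ w (F : ℕ → ℕ) → All (_< v) w → Av r w →
      ∑ (ins 1 v w) (λ z → ⟦ av? r z ⟧ * F (sites z)) ≡ sites w * F (suc (sites w))
    sites-1 [] F w<v a = trans (∑-ins-[] 0 v (λ z → ⟦ av? r z ⟧ * F (sites z)))
      (trans (cong₂ (λ m n → m * F (n + 1) + 0) (⟦⟧-yes (av? r [ v ]) av₁) (⟦⟧-yes (av? r′ [ v ]) av₂))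
             (ℕₚ.+-identityʳ _))
      where
      av₁ : Av r [ v ]
      av₁ = av-∷⁺ av-[] λ { [] ((()) ∷ _) }
      av₂ : Av r′ [ v ]
      av₂ = av-∷⁺ av-[] λ { [] ((()) ∷ _) }
    sites-1 (x ∷ w) F (x<v ∷ w<v) a = begin
      ∑ (ins 1 v (x ∷ w)) (λ z → ⟦ av? r z ⟧ * F (sites z))
        ≡⟨ ∑-ins-∷ 0 v x w (λ z → ⟦ av? r z ⟧ * F (sites z)) ⟩
      ⟦ av? r (v ∷ x ∷ w) ⟧ * F (sites (v ∷ x ∷ w)) + 0 + ∑ (ins 1 v w) (λ z → ⟦ av? r (x ∷ z) ⟧ * F (sites (x ∷ z)))
        ≡⟨ cong₂ _+_ head (trans (∑-ins-cong 1 w w<v λ {z} i → cong₂ _*_ (keep-av x x<v a i)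
               (cong (λ n → F (n + sites z)) (once (inserted-∷ x<v i))))
             (sites-1 w (λ n → F (e + n)) w<v (av-∷⁻ a))) ⟩
      e * F (suc (e + sites w)) + sites w * F (e + suc (sites w))
        ≡⟨ cong (λ n → e * F (suc (e + sites w)) + sites w * F n) (ℕₚ.+-suc e (sites w)) ⟩
      e * F (suc (e + sites w)) + sites w * F (suc (e + sites w))
        ≡⟨ sym (ℕₚ.*-distribʳ-+ (F (suc (e + sites w))) e (sites w)) ⟩
      (e + sites w) * F (suc (e + sites w))
        ∎
      where
      open ≡-Reasoning
      e = ⟦ av? r′ (x ∷ w) ⟧
      all< : All (_< v) (x ∷ w)
      all< = x<v ∷ w<v
      head : ⟦ av? r (v ∷ x ∷ w) ⟧ * F (sites (v ∷ x ∷ w)) + 0 ≡ e * F (suc (e + sites w))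
      head = trans (ℕₚ.+-identityʳ _)
        (trans (cong₂ (λ m n → m * F (n + (e + sites w)))
                      (trans (top-av all< (inserted-none all<)) (trans (cong (e *_) (⟦⟧-yes (av? r (x ∷ w)) a)) (ℕₚ.*-identityʳ e)))
                      (top-av′ (All.map ℕₚ.<⇒≤ all<)))
               (⟦⟧*-cong (av? r′ (x ∷ w)) λ a′ → cong (λ n → F (n + (e + sites w))) (⟦⟧-yes (av? r′ (x ∷ w)) a′)))

    sites-2 : ∀ w (F : ℕ → ℕ) → All (_< v) w → Av r w →
      ∑ (ins 2 v w) (λ z → ⟦ av? r z ⟧ * F (sites z)) ≡ ∑ (upTo (sites w)) (λ i → suc i * F (3 + i))
    sites-2 w F w<v a = go w w<v a
      where
      open ≡-Reasoning
      first : ∀ w → All (_< v) w → Av r w →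
        ∑ (ins 1 v w) (λ z → ⟦ av? r (v ∷ z) ⟧ * F (sites (v ∷ z))) ≡ ⟦ av? r′ w ⟧ * (sites w * F (2 + sites w))
      first w w<v a = begin
        ∑ (ins 1 v w) (λ z → ⟦ av? r (v ∷ z) ⟧ * F (sites (v ∷ z)))
          ≡⟨ ∑-ins-cong 1 w w<v (λ {z} i → trans (cong₂ (λ m n → m * F (n + sites z)) (top-av w<v i)
                (trans (top-av′ (Inserted.bound i)) (once i)))
                (trans (ℕₚ.*-assoc ⟦ av? r′ w ⟧ _ _) (⟦⟧*-cong (av? r′ w) λ a′ →
                   cong (λ n → ⟦ av? r z ⟧ * F (n + sites z)) (⟦⟧-yes (av? r′ w) a′)))) ⟩
        ∑ (ins 1 v w) (λ z → ⟦ av? r′ w ⟧ * (⟦ av? r z ⟧ * F (suc (sites z))))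
          ≡⟨ ∑-*ˡ ⟦ av? r′ w ⟧ (ins 1 v w) _ ⟩
        ⟦ av? r′ w ⟧ * ∑ (ins 1 v w) (λ z → ⟦ av? r z ⟧ * F (suc (sites z)))
          ≡⟨ cong (⟦ av? r′ w ⟧ *_) (sites-1 w (F ∘ suc) w<v a) ⟩
        ⟦ av? r′ w ⟧ * (sites w * F (2 + sites w))
          ∎
      go : ∀ w → All (_< v) w → Av r w →
        ∑ (ins 2 v w) (λ z → ⟦ av? r z ⟧ * F (sites z)) ≡ ∑ (upTo (sites w)) (λ i → suc i * F (3 + i))
      go [] w<v a = trans (∑-ins-[] 1 v (λ z → ⟦ av? r z ⟧ * F (sites z)))
        (trans (first [] [] a) (cong (_* (1 * F 3)) (⟦⟧-yes (av? r′ []) av-[])))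
      go (x ∷ w) (x<v ∷ w<v) a = begin
        ∑ (ins 2 v (x ∷ w)) (λ z → ⟦ av? r z ⟧ * F (sites z))
          ≡⟨ ∑-ins-∷ 1 v x w (λ z → ⟦ av? r z ⟧ * F (sites z)) ⟩
        ∑ (ins 1 v (x ∷ w)) (λ z → ⟦ av? r (v ∷ z) ⟧ * F (sites (v ∷ z))) +
        ∑ (ins 2 v w) (λ z → ⟦ av? r (x ∷ z) ⟧ * F (sites (x ∷ z)))
          ≡⟨ cong₂ _+_ (first (x ∷ w) (x<v ∷ w<v) a)
               (trans (∑-ins-cong 2 w w<v λ {z} i → cong₂ _*_ (keep-av x x<v a i)
                         -- With both copies behind it `x` starts a 122, so no site remains in front
                         -- of `x`.
                         (cong (λ n → F (n + sites z)) (⟦⟧-no (av? r′ (x ∷ z)) λ az →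
                            az (_ , refl ∷ count-⊆₂ z (ℕₚ.≤-reflexive (sym (Inserted.total i)))
                               , (so-<⁺ x<v ∷ so-<⁺ x<v ∷ []) ∷ (so-≡⁺ ∷ []) ∷ [] ∷ []))))
                      (go w w<v (av-∷⁻ a))) ⟩
        ⟦ av? r′ (x ∷ w) ⟧ * (sites (x ∷ w) * F (2 + sites (x ∷ w))) + ∑ (upTo (sites w)) (λ i → suc i * F (3 + i))
          ≡⟨ last (av? r′ (x ∷ w)) ⟩
        ∑ (upTo (sites (x ∷ w))) (λ i → suc i * F (3 + i))
          ∎
        where
        last : (d : Dec (Av r′ (x ∷ w))) →
          ⟦ d ⟧ * ((⟦ d ⟧ + sites w) * F (2 + (⟦ d ⟧ + sites w))) + ∑ (upTo (sites w)) (λ i → suc i * F (3 + i)) ≡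
          ∑ (upTo (⟦ d ⟧ + sites w)) (λ i → suc i * F (3 + i))
        last (no _)  = refl
        last (yes _) = trans (ℕₚ.+-comm _ (∑ (upTo (sites w)) (λ i → suc i * F (3 + i))))
          (trans (cong (∑ (upTo (sites w)) (λ i → suc i * F (3 + i)) +_) (ℕₚ.*-identityˡ _))
                 (sym (∑-upTo (sites w) (λ i → suc i * F (3 + i)))))

sites-2213 : Sites (3 ∷ 1 ∷ 2 ∷ 2 ∷ [])
sites-2213 = record { sites = Sites-2213.sites ; sites-1 = Sites-2213.sites-1 ; sites-2 = Sites-2213.sites-2 }

-- In 2132 a new maximum cannot be placed between two copies of x with a smaller letter between
-- the new maximum and the copy on its left; in the reversed words below that copy is on its right.
module Sites-2132 where

  private
    r : List ℕ
    r = 2 ∷ 3 ∷ 1 ∷ 2 ∷ []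

  -- The letters behind a new maximum that, together with an `x` in front of it, would complete the
  -- reversed pattern 2312.
  data Return (x : ℕ) : List ℕ → Set where
    return : ∀ {s} → s < x → Return x (s ∷ x ∷ [])

  return? : ∀ x l → Dec (Return x l)
  return? x []              = no λ ()
  return? x (s ∷ [])        = no λ ()
  return? x (s ∷ y ∷ _ ∷ _) = no λ ()
  return? x (s ∷ y ∷ []) with s <? x | y ≟ x
  ... | yes s<x | yes refl = yes (return s<x)
  ... | no s≮x  | _        = no λ { (return s<x) → s≮x s<x }
  ... | _       | no y≢x   = no λ { (return _) → y≢x refl }

  Blocked : List ℕ → List ℕ → Set
  Blocked c w = Any (λ x → ∃ λ l → l ⊆ w × Return x l) c

  opaque
    free? : ∀ c w → Dec (¬ Blocked c w)
    free? c w = ¬? (any? (λ x → anySublist? (return? x) w) c)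

  blocked-⊆ : ∀ {c w w′} → w ⊆ w′ → Blocked c w → Blocked c w′
  blocked-⊆ sub = Any.map λ (l , s , ret) → l , ⊆-trans s sub , ret

  -- The letters in front of `w` are accumulated in `c`, nearest one first: unlike for 2213, whether
  -- a site is admissible depends on both of its sides.
  sites : List ℕ → List ℕ → ℕ
  sites c []      = 1
  sites c (x ∷ w) = ⟦ free? c (x ∷ w) ⟧ + sites (x ∷ c) w

  private
    split-ʳ++ : ∀ (c : List ℕ) {w l} → l ⊆ c ʳ++ w → ∃ λ l₁ → ∃ λ l₂ → l ≡ l₁ ++ l₂ × l₁ ⊆ reverse c × l₂ ⊆ w
    split-ʳ++ c {w} {l} sub = ⊆-++⁻ (reverse c) (subst (l ⊆_) (ʳ++-defn c) sub)

    ∈-reverse : ∀ {x : ℕ} {l} c → x ∷ l ⊆ reverse c → x ∈ c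
    ∈-reverse c sub = Anyₚ.reverse⁻ (Subₚ.Any-resp-⊆ sub (here refl))

    old-return : ∀ {m v w z x l} → Inserted m v w z → x < v → l ⊆ z → Return x l → l ⊆ w
    old-return i x<v sub (return s<x) = inserted-old i sub (ℕₚ.<-trans s<x x<v ∷ x<v ∷ [])

    free-[] : ∀ c → ⟦ free? c [] ⟧ ≡ 1
    free-[] c = ⟦⟧-yes (free? c []) λ b → let _ , _ , l , sub , ret = find b in none sub ret
      where
      none : ∀ {x l} → l ⊆ [] → ¬ Return x l
      none [] ()

  module _ {v : ℕ} where

    private
      free-old : ∀ {m w z} c → All (_< v) c → Inserted m v w z → ⟦ free? c z ⟧ ≡ ⟦ free? c w ⟧
      free-old {w = w} {z} c c<v i = ⟦⟧-cong (free? c z) (free? c w)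
        (λ f b → f (blocked-⊆ (inserted-⊆ i) b))
        (λ f b → let x , x∈ , l , sub , ret = find b in
                 f (lose x∈ (l , old-return i (All.lookup c<v x∈) sub ret , ret)))

      -- A letter above everything is never the last letter of a return.
      free-top : ∀ c {w} → All (_≤ v) c → All (_< v) w → ⟦ free? c (v ∷ w) ⟧ ≡ ⟦ free? c w ⟧
      free-top c {w} c≤v w<v = ⟦⟧-cong (free? c (v ∷ w)) (free? c w) (λ f b → f (blocked-⊆ (v ∷ʳ ⊆-refl) b))
        λ f b → let x , x∈ , l , sub , ret = find b in f (lose x∈ (l , drop (All.lookup c≤v x∈) sub ret , ret))
        where
        drop : ∀ {x l} → x ≤ v → l ⊆ v ∷ w → Return x l → l ⊆ w
        drop x≤v (_ ∷ʳ sub)   ret          = sub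
        drop x≤v (refl ∷ sub) (return v<x) = contradiction v<x (ℕₚ.≤⇒≯ x≤v)

      sites-v : ∀ c w → All (_< v) w → sites (v ∷ c) w ≡ sites c w
      sites-v c w w<v = go [] w w<v
        where
        go : ∀ p w → All (_< v) w → sites (p ++ v ∷ c) w ≡ sites (p ++ c) w
        go p []      w<v = refl
        go p (x ∷ w) (x<v ∷ w<v) = cong₂ _+_
          (⟦⟧-cong (free? (p ++ v ∷ c) (x ∷ w)) (free? (p ++ c) (x ∷ w))
            (λ f b → f (Subₚ.Any-resp-⊆ (Subₚ.++⁺ (⊆-refl {x = p}) (v ∷ʳ ⊆-refl)) b))
            (λ f b → f (without p b)))
          (go (x ∷ p) w w<v)
          where
          without : ∀ p → Blocked (p ++ v ∷ c) (x ∷ w) → Blocked (p ++ c) (x ∷ w)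
          without []      (here (_ , sub , return _)) =
            contradiction (All.head (All.tail (Subₚ.All-resp-⊆ sub (x<v ∷ w<v)))) (ℕₚ.<-irrefl refl)
          without []      (there b) = b
          without (y ∷ p) (here b)  = here b
          without (y ∷ p) (there b) = there (without p b)

      av-top : ∀ c w → All (_≤ v) c → All (_< v) w → Av r (c ʳ++ w) →
               ⟦ av? r (c ʳ++ v ∷ w) ⟧ ≡ ⟦ free? c w ⟧
      av-top c w c≤v w<v a = ⟦⟧-cong (av? r (c ʳ++ v ∷ w)) (free? c w) to from
        where
        to : Av r (c ʳ++ v ∷ w) → ¬ Blocked c w
        to az b with find b
        ... | x , x∈ , .(_ ∷ x ∷ []) , sub , return s<x with All.tail (Subₚ.All-resp-⊆ sub w<v)
        ... | x<v ∷ [] = az (_ , ⊆-trans (refl ∷ refl ∷ sub) (∈-ʳ++ c x∈)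
                             , (so-<⁺ x<v ∷ so->⁺ s<x ∷ so-≡⁺ ∷ [])
                               ∷ (so->⁺ (ℕₚ.<-trans s<x x<v) ∷ so->⁺ x<v ∷ []) ∷ (so-<⁺ s<x ∷ []) ∷ [] ∷ [])
        from : ¬ Blocked c w → Av r (c ʳ++ v ∷ w)
        from f (l , sub , e) with split-ʳ++ c sub
        ... | l₁ , l₂ , refl , s₁ , (_ ∷ʳ s₂) =
          a (l₁ ++ l₂ , subst (l₁ ++ l₂ ⊆_) (sym (ʳ++-defn c)) (Subₚ.++⁺ s₁ s₂) , e)
        ... | l₁ , _ ∷ l₂ , refl , s₁ , (refl ∷ s₂) = clash l₁ e s₁ s₂
          where
          clash : ∀ l₁ {l₂} → l₁ ++ v ∷ l₂ ≅ r → l₁ ⊆ reverse c → l₂ ⊆ w → ⊥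
          clash [] ((so ∷ _ ∷ _ ∷ []) ∷ _) s₁ s₂ = ℕₚ.<-asym (so-< so) (All.head (Subₚ.All-resp-⊆ s₂ w<v))
          clash (x ∷ []) ((_ ∷ so₂ ∷ so₃ ∷ []) ∷ _) s₁ s₂ with so-≡ so₃
          ... | refl = f (lose (∈-reverse c s₁) (_ , s₂ , return (so-> so₂)))
          clash (x ∷ y ∷ []) (_ ∷ (so ∷ _ ∷ []) ∷ _) s₁ s₂ =
            ℕₚ.<⇒≱ (so-> so) (All.lookup c≤v (∈-reverse c (⊆-trans (_ ∷ʳ ⊆-refl) s₁)))
          clash (x ∷ y ∷ _ ∷ []) ((so ∷ _ ∷ so′ ∷ []) ∷ _) s₁ s₂ with so-≡ so′
          ... | refl = ℕₚ.<⇒≱ (so-< so) (All.lookup c≤v (∈-reverse c (⊆-trans (_ ∷ʳ ⊆-refl) s₁)))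
          clash (_ ∷ _ ∷ _ ∷ _ ∷ []) ((_ ∷ _ ∷ _ ∷ ()) ∷ _)
          clash (_ ∷ _ ∷ _ ∷ _ ∷ _ ∷ _) ((_ ∷ _ ∷ _ ∷ ()) ∷ _)

    sites-1 : ∀ c w (F : ℕ → ℕ) → All (_< v) c → All (_< v) w → Av r (c ʳ++ w) →
      ∑ (ins 1 v w) (λ z → ⟦ av? r (c ʳ++ z) ⟧ * F (sites c z)) ≡ sites c w * F (suc (sites c w))
    sites-1 c [] F c<v w<v a = trans (∑-ins-[] 0 v (λ z → ⟦ av? r (c ʳ++ z) ⟧ * F (sites c z)))
      (trans (cong₂ (λ m n → m * F (n + 1) + 0)
               (trans (av-top c [] (All.map ℕₚ.<⇒≤ c<v) [] a) (free-[] c))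
               (trans (free-top c (All.map ℕₚ.<⇒≤ c<v) []) (free-[] c)))
             (ℕₚ.+-identityʳ _))
    sites-1 c (x ∷ w) F c<v (x<v ∷ w<v) a = begin
      ∑ (ins 1 v (x ∷ w)) (λ z → ⟦ av? r (c ʳ++ z) ⟧ * F (sites c z))
        ≡⟨ ∑-ins-∷ 0 v x w (λ z → ⟦ av? r (c ʳ++ z) ⟧ * F (sites c z)) ⟩
      ⟦ av? r (c ʳ++ v ∷ x ∷ w) ⟧ * F (⟦ free? c (v ∷ x ∷ w) ⟧ + sites (v ∷ c) (x ∷ w)) + 0 +
      ∑ (ins 1 v w) (λ z → ⟦ av? r (c ʳ++ x ∷ z) ⟧ * F (⟦ free? c (x ∷ z) ⟧ + sites (x ∷ c) z))
        ≡⟨ cong₂ _+_ head (trans (∑-ins-cong 1 w w<v λ {z} i →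
               cong (λ n → ⟦ av? r (c ʳ++ x ∷ z) ⟧ * F (n + sites (x ∷ c) z)) (free-old c c<v (inserted-∷ x<v i)))
             (sites-1 (x ∷ c) w (λ n → F (e + n)) (x<v ∷ c<v) w<v a)) ⟩
      e * F (suc (e + A)) + A * F (e + suc A)
        ≡⟨ cong (λ n → e * F (suc (e + A)) + A * F n) (ℕₚ.+-suc e A) ⟩
      e * F (suc (e + A)) + A * F (suc (e + A))
        ≡⟨ sym (ℕₚ.*-distribʳ-+ (F (suc (e + A))) e A) ⟩
      (e + A) * F (suc (e + A))
        ∎
      where
      open ≡-Reasoning
      e = ⟦ free? c (x ∷ w) ⟧
      A = sites (x ∷ c) w
      c≤v = All.map ℕₚ.<⇒≤ c<v
      head : ⟦ av? r (c ʳ++ v ∷ x ∷ w) ⟧ * F (⟦ free? c (v ∷ x ∷ w) ⟧ + sites (v ∷ c) (x ∷ w)) + 0 ≡ e * F (suc (e + A))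
      head = trans (ℕₚ.+-identityʳ _)
        (trans (cong₂ _*_ (av-top c (x ∷ w) c≤v (x<v ∷ w<v) a)
                          (cong₂ (λ m n → F (m + n)) (free-top c c≤v (x<v ∷ w<v)) (sites-v c (x ∷ w) (x<v ∷ w<v))))
               (⟦⟧*-cong (free? c (x ∷ w)) λ f → cong (λ n → F (n + (e + A))) (⟦⟧-yes (free? c (x ∷ w)) f)))

    -- A second copy of v, with the first one already among the letters c: all the sites between
    -- the two copies get blocked, except for the last one.
    second : ∀ c w (F : ℕ → ℕ) → v ∈ c → All (_≤ v) c → All (_< v) w → Av r (c ʳ++ w) →
      ∑ (ins 1 v w) (λ z → ⟦ av? r (c ʳ++ z) ⟧ * F (sites c z)) ≡ ∑ (upTo (sites c w)) (λ i → F (2 + i))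
    second c [] F v∈ c≤v w<v a = trans (∑-ins-[] 0 v (λ z → ⟦ av? r (c ʳ++ z) ⟧ * F (sites c z)))
      (trans (cong₂ (λ m n → m * F (n + 1) + 0) (trans (av-top c [] c≤v [] a) (free-[] c)) (trans (free-top c c≤v []) (free-[] c)))
             (ℕₚ.+-identityʳ _))
    second c (x ∷ w) F v∈ c≤v (x<v ∷ w<v) a = begin
      ∑ (ins 1 v (x ∷ w)) (λ z → ⟦ av? r (c ʳ++ z) ⟧ * F (sites c z))
        ≡⟨ ∑-ins-∷ 0 v x w (λ z → ⟦ av? r (c ʳ++ z) ⟧ * F (sites c z)) ⟩
      ⟦ av? r (c ʳ++ v ∷ x ∷ w) ⟧ * F (⟦ free? c (v ∷ x ∷ w) ⟧ + sites (v ∷ c) (x ∷ w)) + 0 +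
      ∑ (ins 1 v w) (λ z → ⟦ av? r (c ʳ++ x ∷ z) ⟧ * F (⟦ free? c (x ∷ z) ⟧ + sites (x ∷ c) z))
        ≡⟨ cong₂ _+_ head (trans (∑-ins-cong 1 w w<v λ {z} i →
               cong (λ n → ⟦ av? r (c ʳ++ x ∷ z) ⟧ * F (n + sites (x ∷ c) z))
                    (⟦⟧-no (free? c (x ∷ z)) λ f → f (lose v∈ (_ , refl ∷ v-in i , return x<v))))
             (second (x ∷ c) w F (there v∈) (ℕₚ.<⇒≤ x<v ∷ c≤v) w<v a)) ⟩
      e * F (2 + A) + ∑ (upTo A) (λ i → F (2 + i))
        ≡⟨ last (free? c (x ∷ w)) ⟩
      ∑ (upTo (e + A)) (λ i → F (2 + i))
        ∎
      where
      open ≡-Reasoning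
      e = ⟦ free? c (x ∷ w) ⟧
      A = sites (x ∷ c) w
      v-in : ∀ {z} → Inserted 1 v w z → [ v ] ⊆ z
      v-in {z} i = count-⊆ z (ℕₚ.≤-reflexive (sym (Inserted.total i)))
      head : ⟦ av? r (c ʳ++ v ∷ x ∷ w) ⟧ * F (⟦ free? c (v ∷ x ∷ w) ⟧ + sites (v ∷ c) (x ∷ w)) + 0 ≡ e * F (2 + A)
      head = trans (ℕₚ.+-identityʳ _)
        (trans (cong₂ _*_ (av-top c (x ∷ w) c≤v (x<v ∷ w<v) a)
                          (cong₂ (λ m n → F (m + n)) (free-top c c≤v (x<v ∷ w<v)) (sites-v c (x ∷ w) (x<v ∷ w<v))))
               (⟦⟧*-cong (free? c (x ∷ w)) λ f → cong (λ n → F (n + (n + A))) (⟦⟧-yes (free? c (x ∷ w)) f)))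
      last : (d : Dec (¬ Blocked c (x ∷ w))) →
             ⟦ d ⟧ * F (2 + A) + ∑ (upTo A) (λ i → F (2 + i)) ≡ ∑ (upTo (⟦ d ⟧ + A)) (λ i → F (2 + i))
      last (no _)  = refl
      last (yes _) = trans (ℕₚ.+-comm _ (∑ (upTo A) (λ i → F (2 + i))))
        (trans (cong (∑ (upTo A) (λ i → F (2 + i)) +_) (ℕₚ.*-identityˡ _)) (sym (∑-upTo A (λ i → F (2 + i)))))

    sites-2 : ∀ c w (F : ℕ → ℕ) → All (_< v) c → All (_< v) w → Av r (c ʳ++ w) →
      ∑ (ins 2 v w) (λ z → ⟦ av? r (c ʳ++ z) ⟧ * F (sites c z)) ≡ ∑ (upTo (sites c w)) (λ i → suc i * F (3 + i))
    sites-2 c w F c<v w<v a = go c w F c<v w<v a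
      where
      open ≡-Reasoning
      first : ∀ c w (F : ℕ → ℕ) → All (_< v) c → All (_< v) w → Av r (c ʳ++ w) →
        ∑ (ins 1 v w) (λ z → ⟦ av? r (c ʳ++ v ∷ z) ⟧ * F (sites c (v ∷ z))) ≡
        ⟦ free? c w ⟧ * ∑ (upTo (sites c w)) (λ i → F (3 + i))
      first c w F c<v w<v a = trans
        (∑-ins-cong 1 w w<v (λ {z} i → cong (λ n → ⟦ av? r (c ʳ++ v ∷ z) ⟧ * F (n + sites (v ∷ c) z))
                                            (free-old c c<v (inserted-new i))))
        (go (free? c w))
        where
        c≤v = All.map ℕₚ.<⇒≤ c<v
        top = av-top c w c≤v w<v a
        go : (d : Dec (¬ Blocked c w)) →
             ∑ (ins 1 v w) (λ z → ⟦ av? r (c ʳ++ v ∷ z) ⟧ * F (⟦ free? c w ⟧ + sites (v ∷ c) z)) ≡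
             ⟦ d ⟧ * ∑ (upTo (sites c w)) (λ i → F (3 + i))
        go (no ¬f) = ∑-ins-vanish 1 w w<v λ {z} i → cong (_* F (⟦ free? c w ⟧ + sites (v ∷ c) z)) (⟦⟧-no (av? r (c ʳ++ v ∷ z)) λ az →
          ¬f (λ b → contradiction (trans (sym (⟦⟧-yes (av? r (c ʳ++ v ∷ w)) (Av-⊆ (Subₚ.ʳ++⁺ (⊆-refl {x = c}) (refl ∷ inserted-⊆ i)) az)))
                                         (trans top (⟦⟧-no (free? c w) ¬f))) λ ()))
        go (yes f) rewrite ⟦⟧-yes (free? c w) f =
          trans (second (v ∷ c) w (F ∘ suc) (here refl) (ℕₚ.≤-refl ∷ c≤v) w<v (av-yes (av? r (c ʳ++ v ∷ w)) (trans top (⟦⟧-yes (free? c w) f))))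
                (trans (cong (λ n → ∑ (upTo n) (λ i → F (3 + i))) (sites-v c w w<v)) (sym (ℕₚ.*-identityˡ _)))
          where
          av-yes : (d : Dec (Av r (c ʳ++ v ∷ w))) → ⟦ d ⟧ ≡ 1 → Av r (c ʳ++ v ∷ w)
          av-yes (yes p) _ = p
      go : ∀ c w (F : ℕ → ℕ) → All (_< v) c → All (_< v) w → Av r (c ʳ++ w) →
        ∑ (ins 2 v w) (λ z → ⟦ av? r (c ʳ++ z) ⟧ * F (sites c z)) ≡ ∑ (upTo (sites c w)) (λ i → suc i * F (3 + i))
      go c [] F c<v w<v a = trans (∑-ins-[] 1 v (λ z → ⟦ av? r (c ʳ++ z) ⟧ * F (sites c z)))
        (trans (first c [] F c<v [] a) (cong (_* (F 3 + 0)) (free-[] c)))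
      go c (x ∷ w) F c<v (x<v ∷ w<v) a = begin
        ∑ (ins 2 v (x ∷ w)) (λ z → ⟦ av? r (c ʳ++ z) ⟧ * F (sites c z))
          ≡⟨ ∑-ins-∷ 1 v x w (λ z → ⟦ av? r (c ʳ++ z) ⟧ * F (sites c z)) ⟩
        ∑ (ins 1 v (x ∷ w)) (λ z → ⟦ av? r (c ʳ++ v ∷ z) ⟧ * F (sites c (v ∷ z))) +
        ∑ (ins 2 v w) (λ z → ⟦ av? r (c ʳ++ x ∷ z) ⟧ * F (⟦ free? c (x ∷ z) ⟧ + sites (x ∷ c) z))
          ≡⟨ cong₂ _+_ (first c (x ∷ w) F c<v (x<v ∷ w<v) a)
               (trans (∑-ins-cong 2 w w<v λ {z} i → cong (λ n → ⟦ av? r (c ʳ++ x ∷ z) ⟧ * F (n + sites (x ∷ c) z))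
                                                         (free-old c c<v (inserted-∷ x<v i)))
                      (go (x ∷ c) w (λ n → F (e + n)) (x<v ∷ c<v) w<v a)) ⟩
        e * ∑ (upTo (e + A)) (λ i → F (3 + i)) + ∑ (upTo A) (λ i → suc i * F (e + (3 + i)))
          ≡⟨ last (free? c (x ∷ w)) ⟩
        ∑ (upTo (e + A)) (λ i → suc i * F (3 + i))
          ∎
        where
        e = ⟦ free? c (x ∷ w) ⟧
        A = sites (x ∷ c) w
        -- The pairs of sites sorted by distance: those using the front site, one for each distance,
        -- and those among the remaining sites.
        shift : ∀ n → ∑ (upTo (suc n)) (λ i → F (3 + i)) + ∑ (upTo n) (λ i → suc i * F (4 + i)) ≡
                      ∑ (upTo (suc n)) (λ i → suc i * F (3 + i))
        shift zero    = refl
        shift (suc n)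
          rewrite ∑-upTo (suc n) (λ i → F (3 + i)) | ∑-upTo n (λ i → suc i * F (4 + i))
                | ∑-upTo (suc n) (λ i → suc i * F (3 + i)) | sym (shift n) =
          assoc (∑ (upTo (suc n)) (λ i → F (3 + i))) (∑ (upTo n) (λ i → suc i * F (4 + i))) (F (4 + n)) (suc n * F (4 + n))
          where
          assoc : ∀ a b c d → a + c + (b + d) ≡ a + b + (c + d)
          assoc = solve-∀
        last : (d : Dec (¬ Blocked c (x ∷ w))) →
               ⟦ d ⟧ * ∑ (upTo (⟦ d ⟧ + A)) (λ i → F (3 + i)) + ∑ (upTo A) (λ i → suc i * F (⟦ d ⟧ + (3 + i))) ≡
               ∑ (upTo (⟦ d ⟧ + A)) (λ i → suc i * F (3 + i))
        last (no _)  = refl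
        last (yes _) = trans (cong (_+ ∑ (upTo A) (λ i → suc i * F (4 + i))) (ℕₚ.*-identityˡ _)) (shift A)

sites-2132 : Sites (2 ∷ 3 ∷ 1 ∷ 2 ∷ [])
sites-2132 = record
  { sites   = Sites-2132.sites []
  ; sites-1 = λ w F → Sites-2132.sites-1 [] w F []
  ; sites-2 = λ w F → Sites-2132.sites-2 [] w F [] }

backward-2132≡2213 : ∀ ω n H → All IsDel ω → All (Bounded 2) ω →
  backward (2 ∷ 3 ∷ 1 ∷ 2 ∷ []) (ω ++ replicate n add) (0 , []) (H , []) ≡
  backward (3 ∷ 1 ∷ 2 ∷ 2 ∷ []) (ω ++ replicate n add) (0 , []) (H , [])
backward-2132≡2213 ω n H ds bs =
  trans (backward-by-sites sites-2132 ω n [] ds bs [] av-[])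
        (sym (backward-by-sites sites-2213 ω n [] ds bs [] av-[]))

-- Patterns governed by compositions: 231 and 312.

-- A composition with parts r₁ + 1, r₂ + 1, … is represented by the list of the rᵢ.
Composition : Set
Composition = List ℕ

infix 4 _≗⁺_
-- An insertion always leads to a nonempty composition, so `U` and `θ` only see these values; the
-- relations with `drop₁` may then ignore the empty one, where it is exceptional.
_≗⁺_ : (f g : Composition → ℕ) → Set
f ≗⁺ g = ∀ r rs → f (r ∷ rs) ≡ g (r ∷ rs)

drop₁ : (Composition → ℕ) → Composition → ℕ
drop₁ f []           = 0
drop₁ f (zero ∷ rs)  = f rs
drop₁ f (suc r ∷ rs) = f (r ∷ rs)

iter : ∀ {A : Set} → (A → A) → ℕ → A → A
iter g zero    x = x
iter g (suc d) x = g (iter g d x)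

-- As operators, the relations say `U θ^d drop₁ = θ^(d - 1) (1 + θ)^2`, with the term `θ^(-1)`
-- omitted for `d = 0`. A removal following an insertion is thus eliminated at the price of powers
-- of `θ`, and the operators `U θ^d` form a family closed under this.
record Insertion : Set where
  field
    U θ     : (Composition → ℕ) → Composition → ℕ
    U-cong  : ∀ {f g} → f ≗⁺ g → ∀ c → U f c ≡ U g c
    θ-cong  : ∀ {f g} → f ≗⁺ g → θ f ≗⁺ θ g
    U-+     : ∀ f g c → U (λ c → f c + g c) c ≡ U f c + U g c
    θ-+     : ∀ f g → θ (λ c → f c + g c) ≗⁺ λ c → θ f c + θ g c
    U-zero  : ∀ c → U (λ _ → 0) c ≡ 0
    θ-zero  : θ (λ _ → 0) ≗⁺ λ _ → 0

    U-drop₁    : ∀ f → U (drop₁ f) ≗⁺ λ c → f c + f c + θ f c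
    Uθ-drop₁   : ∀ d f → U (iter θ (suc d) (drop₁ f)) ≗⁺ λ c → iter θ d f c + (iter θ (suc d) f c + iter θ (suc d) f c) + iter θ (suc (suc d)) f c
    U-drop₁-[]  : ∀ f → U (drop₁ f) [] ≡ f []
    Uθ-drop₁-[] : ∀ d f → U (iter θ (suc d) (drop₁ f)) [] ≡ 0

  θ^ : ℕ → (Composition → ℕ) → Composition → ℕ
  θ^ = iter θ

  θ^-cong : ∀ d {f g} → f ≗⁺ g → θ^ d f ≗⁺ θ^ d g
  θ^-cong zero    e = e
  θ^-cong (suc d) e = θ-cong (θ^-cong d e)

  θ^-+ : ∀ d f g → θ^ d (λ c → f c + g c) ≗⁺ λ c → θ^ d f c + θ^ d g c
  θ^-+ zero    f g r rs = refl
  θ^-+ (suc d) f g r rs = trans (θ-cong (θ^-+ d f g) r rs) (θ-+ (θ^ d f) (θ^ d g) r rs)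

  θ^-zero : ∀ d → θ^ d (λ _ → 0) ≗⁺ λ _ → 0
  θ^-zero zero    r rs = refl
  θ^-zero (suc d) r rs = trans (θ-cong (θ^-zero d) r rs) (θ-zero r rs)

  θ^-∘ : ∀ d e f → θ^ d (θ^ e f) ≡ θ^ (d + e) f
  θ^-∘ zero    e f = refl
  θ^-∘ (suc d) e f = cong θ (θ^-∘ d e f)

  -- The walk starts at the empty composition, and the head of the list belongs to its latest
  -- insertion, the one that a following removal meets first.
  run : List ℕ → (Composition → ℕ) → ℕ
  run []       f = f []
  run (d ∷ ds) f = run ds (U (θ^ d f))

  run-cong : ∀ ds {f g} → (∀ c → f c ≡ g c) → run ds f ≡ run ds g
  run-cong []       e = e []
  run-cong (d ∷ ds) e = run-cong ds (U-cong (θ^-cong d λ r rs → e (r ∷ rs)))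

  run-cong⁺ : ∀ d ds {f g} → f ≗⁺ g → run (d ∷ ds) f ≡ run (d ∷ ds) g
  run-cong⁺ d ds e = run-cong ds (U-cong (θ^-cong d e))

  run-+ : ∀ ds f g → run ds (λ c → f c + g c) ≡ run ds f + run ds g
  run-+ []       f g = refl
  run-+ (d ∷ ds) f g =
    trans (run-cong ds λ c → trans (U-cong (θ^-+ d f g) c) (U-+ (θ^ d f) (θ^ d g) c))
          (run-+ ds (U (θ^ d f)) (U (θ^ d g)))

  run-zero : ∀ ds → run ds (λ _ → 0) ≡ 0
  run-zero []       = refl
  run-zero (d ∷ ds) = trans (run-cong ds λ c → trans (U-cong (θ^-zero d) c) (U-zero c)) (run-zero ds)

  run-θ : ∀ e ds d f → run (e ∷ ds) (θ^ d f) ≡ run (e + d ∷ ds) f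
  run-θ e ds d f = cong (λ g → run ds (U g)) (θ^-∘ e d f)

  run-drop₁ : ℕ → List ℕ → (Composition → ℕ) → ℕ
  run-drop₁ zero    []       f = run [] f
  run-drop₁ (suc d) []       f = 0
  run-drop₁ zero    (e ∷ ds) f = run (e ∷ ds) f + run (e ∷ ds) f + run (e + 1 ∷ ds) f
  run-drop₁ (suc d) (e ∷ ds) f =
    run (e + d ∷ ds) f + (run (e + suc d ∷ ds) f + run (e + suc d ∷ ds) f) + run (e + suc (suc d) ∷ ds) f

  run-drop₁-≡ : ∀ d ds f → run (d ∷ ds) (drop₁ f) ≡ run-drop₁ d ds f
  run-drop₁-≡ zero    []       f = U-drop₁-[] f
  run-drop₁-≡ (suc d) []       f = Uθ-drop₁-[] d f
  run-drop₁-≡ zero    (e ∷ ds) f =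
    trans (run-cong⁺ e ds (U-drop₁ f))
    (trans (run-+ (e ∷ ds) (λ c → f c + f c) (θ f))
           (cong₂ _+_ (run-+ (e ∷ ds) f f) (run-θ e ds 1 f)))
  run-drop₁-≡ (suc d) (e ∷ ds) f =
    trans (run-cong⁺ e ds (Uθ-drop₁ d f))
    (trans (run-+ (e ∷ ds) _ _)
           (cong₂ _+_ (trans (run-+ (e ∷ ds) _ _)
                             (cong₂ _+_ (run-θ e ds d f)
                                        (trans (run-+ (e ∷ ds) _ _) (cong₂ _+_ (run-θ e ds (suc d) f) (run-θ e ds (suc d) f)))))
                      (run-θ e ds (suc (suc d)) f)))

  value : ℕ → List Op → ℕ → Composition → ℕ
  value H []                     h []      = ⟦ h ≟ H ⟧
  value H []                     h (_ ∷ _) = 0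
  value H (add ∷ ω)              h c       = drop₁ (value H ω h) c
  value H (del 0 ∷ ω)            h c       = value H ω (suc h) c
  value H (del 1 ∷ ω)            h c       = U (value H ω (suc h)) c
  value H (del (suc (suc _)) ∷ ω) h c      = 0

-- Both sides reduce in the same way: an insertion followed, after some θs, by a removal can be
-- rewritten in terms of the other insertions and powers of θ.
run-value : (I J : Insertion) → ∀ H ω h ds →
  Insertion.run I ds (Insertion.value I H ω h) ≡ Insertion.run J ds (Insertion.value J H ω h)
run-value I J H [] h []       = refl
run-value I J H [] h (d ∷ ds) =
  trans (vanish I) (sym (vanish J))
  where
  vanish : (K : Insertion) → Insertion.run K (d ∷ ds) (Insertion.value K H [] h) ≡ 0
  -- The final value is zero at all nonempty compositions, the only ones seen by an insertion.
  vanish K = trans (K.run-cong⁺ d ds λ r rs → refl) (K.run-zero (d ∷ ds))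
    where module K = Insertion K
run-value I J H (add ∷ ω) h []       = refl
run-value I J H (add ∷ ω) h (d ∷ ds) =
  trans (trans (I.run-cong⁺ d ds λ r rs → refl) (I.run-drop₁-≡ d ds (I.value H ω h)))
  (trans (go d ds) (sym (trans (J.run-cong⁺ d ds λ r rs → refl) (J.run-drop₁-≡ d ds (J.value H ω h)))))
  where
  module I = Insertion I
  module J = Insertion J
  ih : ∀ ds → I.run ds (I.value H ω h) ≡ J.run ds (J.value H ω h)
  ih = run-value I J H ω h
  go : ∀ d ds → I.run-drop₁ d ds (I.value H ω h) ≡ J.run-drop₁ d ds (J.value H ω h)
  go zero    []       = ih []
  go (suc d) []       = refl
  go zero    (e ∷ ds) = cong₂ _+_ (cong₂ _+_ (ih (e ∷ ds)) (ih (e ∷ ds))) (ih (e + 1 ∷ ds))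
  go (suc d) (e ∷ ds) = cong₂ _+_ (cong₂ _+_ (ih (e + d ∷ ds)) (cong₂ _+_ (ih (e + suc d ∷ ds)) (ih (e + suc d ∷ ds))))
                                  (ih (e + suc (suc d) ∷ ds))
run-value I J H (del 0 ∷ ω) h ds =
  trans (Insertion.run-cong I ds λ c → refl) (trans (run-value I J H ω (suc h) ds) (Insertion.run-cong J ds λ c → refl))
run-value I J H (del 1 ∷ ω) h ds =
  trans (Insertion.run-cong I ds λ c → refl) (trans (run-value I J H ω (suc h) (0 ∷ ds)) (Insertion.run-cong J ds λ c → refl))
run-value I J H (del (suc (suc m)) ∷ ω) h ds =
  trans (trans (Insertion.run-cong I ds λ c → refl) (Insertion.run-zero I ds))
        (sym (trans (Insertion.run-cong J ds λ c → refl) (Insertion.run-zero J ds)))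

private
  interchange : ∀ a b c d → a + b + (c + d) ≡ a + c + (b + d)
  interchange = solve-∀

grow : (Composition → ℕ) → Composition → ℕ
grow f []       = 0
grow f (r ∷ rs) = f (suc r ∷ rs)

-- The new maximum cuts the last run in two.
module Splitting where

  -- All ways of cutting a first part of size `r + 2` in two, beginning with the shortest first
  -- piece; `grow` lengthens that piece.
  splits : (Composition → ℕ) → ℕ → Composition → ℕ
  splits f zero    rs = f (0 ∷ 0 ∷ rs)
  splits f (suc r) rs = f (0 ∷ suc r ∷ rs) + splits (grow f) r rs

  θ : (Composition → ℕ) → Composition → ℕ
  θ f []           = 0
  θ f (zero ∷ rs)  = 0
  θ f (suc r ∷ rs) = splits f r rs

  -- Behind the last letter of the run the maximum prolongs it; anywhere earlier it ends the first
  -- of the two pieces into which the prolonged run is cut.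
  U : (Composition → ℕ) → Composition → ℕ
  U f []       = f (0 ∷ [])
  U f (r ∷ rs) = f (suc r ∷ rs) + θ f (suc r ∷ rs)

  grow-cong : ∀ {f g} → f ≗⁺ g → grow f ≗⁺ grow g
  grow-cong e r rs = e (suc r) rs

  splits-cong : ∀ {f g} → f ≗⁺ g → ∀ r rs → splits f r rs ≡ splits g r rs
  splits-cong e zero    rs = e 0 (0 ∷ rs)
  splits-cong {f} {g} e (suc r) rs = cong₂ _+_ (e 0 (suc r ∷ rs)) (splits-cong (grow-cong {f} {g} e) r rs)

  splits-+ : ∀ f g r rs → splits (λ c → f c + g c) r rs ≡ splits f r rs + splits g r rs
  splits-+ f g zero    rs = refl
  splits-+ f g (suc r) rs =
    trans (cong (f (0 ∷ suc r ∷ rs) + g (0 ∷ suc r ∷ rs) +_)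
                (trans (splits-cong (λ _ _ → refl) r rs) (splits-+ (grow f) (grow g) r rs)))
          (interchange (f (0 ∷ suc r ∷ rs)) (g (0 ∷ suc r ∷ rs)) _ _)

  splits-zero : ∀ f → (∀ r rs → f (r ∷ rs) ≡ 0) → ∀ r rs → splits f r rs ≡ 0
  splits-zero f z zero    rs = z 0 (0 ∷ rs)
  splits-zero f z (suc r) rs = cong₂ _+_ (z 0 (suc r ∷ rs)) (splits-zero (grow f) (λ r → z (suc r)) r rs)

  θ-cong : ∀ {f g} → f ≗⁺ g → θ f ≗⁺ θ g
  θ-cong e zero    rs = refl
  θ-cong e (suc r) rs = splits-cong e r rs

  θ-+ : ∀ f g → θ (λ c → f c + g c) ≗⁺ λ c → θ f c + θ g c
  θ-+ f g zero    rs = refl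
  θ-+ f g (suc r) rs = splits-+ f g r rs

  θ-zero : θ (λ _ → 0) ≗⁺ λ _ → 0
  θ-zero zero    rs = refl
  θ-zero (suc r) rs = splits-zero (λ _ → 0) (λ _ _ → refl) r rs

  U-cong : ∀ {f g} → f ≗⁺ g → ∀ c → U f c ≡ U g c
  U-cong e []       = e 0 []
  U-cong e (r ∷ rs) = cong₂ _+_ (e (suc r) rs) (θ-cong e (suc r) rs)

  U-+ : ∀ f g c → U (λ c → f c + g c) c ≡ U f c + U g c
  U-+ f g []       = refl
  U-+ f g (r ∷ rs) = trans (cong (f (suc r ∷ rs) + g (suc r ∷ rs) +_) (θ-+ f g (suc r) rs))
                           (interchange (f (suc r ∷ rs)) (g (suc r ∷ rs)) _ _)

  U-zero : ∀ c → U (λ _ → 0) c ≡ 0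
  U-zero []       = refl
  U-zero (r ∷ rs) = θ-zero (suc r) rs

  -- Here g plays the role of f ∘ drop₁, up to the value at compositions with first part 1.
  splits-shift : ∀ f g r rs → (∀ r rs → f (suc r ∷ rs) ≡ g (r ∷ rs)) →
                 splits f r rs ≡ f (0 ∷ r ∷ rs) + θ g (r ∷ rs)
  splits-shift f g zero    rs e = sym (ℕₚ.+-identityʳ _)
  splits-shift f g (suc r) rs e = cong (f (0 ∷ suc r ∷ rs) +_) (splits-cong e r rs)

  -- If the first piece has size one, the removal makes it disappear and the cut is undone;
  -- otherwise a cut of the shortened part remains.
  θ-drop₁ : ∀ f r rs → θ (drop₁ f) (suc r ∷ rs) ≡ f (r ∷ rs) + θ f (r ∷ rs)
  θ-drop₁ f r rs = splits-shift (drop₁ f) f r rs λ _ _ → refl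

  θ^-drop₁ : ∀ d f r rs → iter θ (suc d) (drop₁ f) (suc r ∷ rs) ≡
                          iter θ d f (r ∷ rs) + iter θ (suc d) f (r ∷ rs)
  θ^-drop₁ zero    f r rs = θ-drop₁ f r rs
  θ^-drop₁ (suc d) f r rs =
    trans (splits-shift (iter θ (suc d) (drop₁ f)) (λ c → iter θ d f c + iter θ (suc d) f c) r rs (θ^-drop₁ d f))
          (θ-+ (iter θ d f) (iter θ (suc d) f) r rs)

  U-drop₁ : ∀ f → U (drop₁ f) ≗⁺ λ c → f c + f c + θ f c
  U-drop₁ f r rs = trans (cong (f (r ∷ rs) +_) (θ-drop₁ f r rs)) (sym (ℕₚ.+-assoc (f (r ∷ rs)) _ _))

  Uθ-drop₁ : ∀ d f → U (iter θ (suc d) (drop₁ f)) ≗⁺ λ c →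
             iter θ d f c + (iter θ (suc d) f c + iter θ (suc d) f c) + iter θ (suc (suc d)) f c
  Uθ-drop₁ d f r rs =
    trans (cong₂ _+_ (θ^-drop₁ d f r rs) (θ^-drop₁ (suc d) f r rs))
          (regroup (iter θ d f (r ∷ rs)) (iter θ (suc d) f (r ∷ rs)) _)
    where
    regroup : ∀ a b c → a + b + (b + c) ≡ a + (b + b) + c
    regroup = solve-∀

  insertion : Insertion
  insertion = record
    { U = U ; θ = θ ; U-cong = U-cong ; θ-cong = θ-cong ; U-+ = U-+ ; θ-+ = θ-+ ; U-zero = U-zero ; θ-zero = θ-zero
    ; U-drop₁ = U-drop₁ ; Uθ-drop₁ = Uθ-drop₁ ; U-drop₁-[] = λ f → refl ; Uθ-drop₁-[] = λ d f → refl }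

-- The new maximum merges the last blocks.
module Merging where

  -- The first block swallows the following ones successively, and every stage after the first
  -- swallowing contributes.
  merges : (Composition → ℕ) → ℕ → Composition → ℕ
  merges f r []       = 0
  merges f r (q ∷ rs) = f (r + suc q ∷ rs) + merges f (r + suc q) rs

  θ : (Composition → ℕ) → Composition → ℕ
  θ f []       = 0
  θ f (r ∷ rs) = merges f r rs

  -- The maximum stands in front of all blocks, behind the first one, or behind several; it becomes
  -- the maximum of a single block consisting of all letters in front of it.
  U : (Composition → ℕ) → Composition → ℕ
  U f []       = f (0 ∷ [])
  U f (r ∷ rs) = f (0 ∷ r ∷ rs) + (f (suc r ∷ rs) + θ f (suc r ∷ rs))

  θ-cong : ∀ {f g} → f ≗⁺ g → θ f ≗⁺ θ g
  θ-cong e r []       = refl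
  θ-cong e r (q ∷ rs) = cong₂ _+_ (e (r + suc q) rs) (θ-cong e (r + suc q) rs)

  θ-+ : ∀ f g → θ (λ c → f c + g c) ≗⁺ λ c → θ f c + θ g c
  θ-+ f g r []       = refl
  θ-+ f g r (q ∷ rs) = trans (cong (f (r + suc q ∷ rs) + g (r + suc q ∷ rs) +_) (θ-+ f g (r + suc q) rs))
                             (interchange (f (r + suc q ∷ rs)) (g (r + suc q ∷ rs)) _ _)

  θ-zero : θ (λ _ → 0) ≗⁺ λ _ → 0
  θ-zero r []       = refl
  θ-zero r (q ∷ rs) = θ-zero (r + suc q) rs

  U-cong : ∀ {f g} → f ≗⁺ g → ∀ c → U f c ≡ U g c
  U-cong e []       = e 0 []
  U-cong e (r ∷ rs) = cong₂ _+_ (e 0 (r ∷ rs)) (cong₂ _+_ (e (suc r) rs) (θ-cong e (suc r) rs))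

  U-+ : ∀ f g c → U (λ c → f c + g c) c ≡ U f c + U g c
  U-+ f g []       = refl
  U-+ f g (r ∷ rs) =
    trans (cong (λ n → f (0 ∷ r ∷ rs) + g (0 ∷ r ∷ rs) + n)
                (trans (cong (f (suc r ∷ rs) + g (suc r ∷ rs) +_) (θ-+ f g (suc r) rs))
                       (interchange (f (suc r ∷ rs)) (g (suc r ∷ rs)) _ _)))
          (interchange (f (0 ∷ r ∷ rs)) (g (0 ∷ r ∷ rs)) _ _)

  U-zero : ∀ c → U (λ _ → 0) c ≡ 0
  U-zero []       = refl
  U-zero (r ∷ rs) = θ-zero (suc r) rs

  θ-shift : ∀ f g → (∀ r rs → f (suc r ∷ rs) ≡ g (r ∷ rs)) → ∀ r rs → θ f (suc r ∷ rs) ≡ θ g (r ∷ rs)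
  θ-shift f g e r []       = refl
  θ-shift f g e r (q ∷ rs) = cong₂ _+_ (e (r + suc q) rs) (θ-shift f g e (r + suc q) rs)

  θ^-drop₁ : ∀ d f r rs → iter θ d (drop₁ f) (suc r ∷ rs) ≡ iter θ d f (r ∷ rs)
  θ^-drop₁ zero    f r rs = refl
  θ^-drop₁ (suc d) f r rs = θ-shift (iter θ d (drop₁ f)) (iter θ d f) (θ^-drop₁ d f) r rs

  U-drop₁ : ∀ f → U (drop₁ f) ≗⁺ λ c → f c + f c + θ f c
  U-drop₁ f r rs = trans (cong (λ n → f (r ∷ rs) + (f (r ∷ rs) + n)) (θ^-drop₁ 1 f r rs))
                         (sym (ℕₚ.+-assoc (f (r ∷ rs)) _ _))

  Uθ-drop₁ : ∀ d f → U (iter θ (suc d) (drop₁ f)) ≗⁺ λ c →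
             iter θ d f c + (iter θ (suc d) f c + iter θ (suc d) f c) + iter θ (suc (suc d)) f c
  Uθ-drop₁ d f r rs =
    trans (cong₂ _+_ (cong₂ _+_ (θ^-drop₁ d f r rs) (θ^-drop₁ (suc d) f r rs))
                     (cong₂ _+_ (θ^-drop₁ (suc d) f r rs) (θ^-drop₁ (suc (suc d)) f r rs)))
          (regroup (iter θ d f (r ∷ rs)) (iter θ (suc d) f (r ∷ rs)) _)
    where
    regroup : ∀ a b c → a + b + (b + c) ≡ a + (b + b) + c
    regroup = solve-∀

  insertion : Insertion
  insertion = record
    { U = U ; θ = θ ; U-cong = U-cong ; θ-cong = θ-cong ; U-+ = U-+ ; θ-+ = θ-+ ; U-zero = U-zero ; θ-zero = θ-zero
    ; U-drop₁ = U-drop₁ ; Uθ-drop₁ = Uθ-drop₁ ; U-drop₁-[] = λ f → refl ; Uθ-drop₁-[] = λ d f → refl }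

-- In `⊨-insert` the functions `φ` and `f` are arbitrary up to agreement on related arguments: they
-- stand for the rest of the walk on states and on compositions.
record Shape (r : List ℕ) (I : Insertion) : Set₁ where
  open Insertion I
  field
    _⊨_      : List ℕ → Composition → Set
    ⊨-[]     : [] ⊨ []
    ⊨-∷      : ∀ {w r rs} → w ⊨ (r ∷ rs) → w ≢ []
    ⊨-empty  : ∀ {w} → w ⊨ [] → w ≡ []
    ⊨-drop   : ∀ {u w c} → (u ∷ w) ⊨ c → ∃ λ c′ → w ⊨ c′ × (∀ f → drop₁ f c ≡ f c′)
    ⊨-insert : ∀ {v w c} (φ : List ℕ → ℕ) f → w ⊨ c → All (_< v) w → Av r w →
               (∀ {z c′} → z ⊨ c′ → All (_≤ v) z → Av r z → φ z ≡ f c′) →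
               ∑ (ins 1 v w) (λ z → ⟦ av? r z ⟧ * φ z) ≡ U f c

  backward-by-shape : ∀ {H} ω {h w c} → All (Bounded 1) ω → w ⊨ c → All (_< h) w → Av r w →
    backward r ω (h , w) (H , []) ≡ value H ω h c
  backward-by-shape {H} [] {h} {w} {[]} bs s w<h a rewrite ⊨-empty s =
    ⟦⟧-cong ((h , []) ≟ˢ (H , [])) (h ≟ H) (λ { refl → refl }) (λ { refl → refl })
  backward-by-shape {H} [] {h} {w} {_ ∷ _} bs s w<h a =
    ⟦⟧-no ((h , w) ≟ˢ (H , [])) λ { refl → ⊨-∷ s refl }
  backward-by-shape (add ∷ ω) {w = []} {[]} bs s w<h a = refl
  backward-by-shape (add ∷ ω) {w = []} {_ ∷ _} bs s w<h a = contradiction refl (⊨-∷ s)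
  backward-by-shape (add ∷ ω) {w = u ∷ w} (_ ∷ bs) s (_ ∷ w<h) a with ⊨-drop s
  ... | c′ , s′ , eq = trans (backward-add r u w ω _ _)
                             (trans (backward-by-shape ω bs s′ w<h (av-∷⁻ a)) (sym (eq _)))
  backward-by-shape (del 0 ∷ ω) {w = w} (_ ∷ bs) s w<h a =
    trans (backward-del r 0 ω _ w _)
    (trans (ℕₚ.+-identityʳ _)
    (trans (cong (_* backward r ω _ _) (⟦⟧-yes (av? r w) a))
    (trans (ℕₚ.*-identityˡ _) (backward-by-shape ω bs s (All.map ℕₚ.m<n⇒m<1+n w<h) a))))
  backward-by-shape (del 1 ∷ ω) {w = w} (_ ∷ bs) s w<h a =
    trans (backward-del r 1 ω _ w _)
          (⊨-insert _ _ s w<h a λ sz z≤h az → backward-by-shape ω bs sz (All.map ℕ.s≤s z≤h) az)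
  backward-by-shape (del (suc (suc m)) ∷ ω) (ℕ.s≤s () ∷ bs) s w<h a

module Runs-312 where

  private
    r : List ℕ
    r = 2 ∷ 1 ∷ 3 ∷ []

  -- Strict comparisons suffice, as at most one copy of each value is ever inserted. The first part
  -- is the ascending run at the front of the state.
  data Runs : List ℕ → Composition → Set where
    []   : Runs [] []
    [-]  : ∀ {x} → Runs [ x ] (0 ∷ [])
    asc  : ∀ {x y w n rs} → x < y → Runs (y ∷ w) (n ∷ rs) → Runs (x ∷ y ∷ w) (suc n ∷ rs)
    desc : ∀ {x y w c} → y < x → Runs (y ∷ w) c → Runs (x ∷ y ∷ w) (0 ∷ c)

  runs-drop : ∀ {u w c} → Runs (u ∷ w) c → ∃ λ c′ → Runs w c′ × (∀ f → drop₁ f c ≡ f c′)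
  runs-drop [-]         = [] , [] , λ f → refl
  runs-drop (asc _ ρ)   = _ , ρ , λ f → refl
  runs-drop (desc _ ρ)  = _ , ρ , λ f → refl

  runs-top : ∀ {v w c} → Runs w c → All (_< v) w → Runs (v ∷ w) (0 ∷ c)
  runs-top []         []        = [-]
  runs-top [-]        (x<v ∷ _) = desc x<v [-]
  runs-top (asc l ρ)  (x<v ∷ _) = desc x<v (asc l ρ)
  runs-top (desc l ρ) (x<v ∷ _) = desc x<v (desc l ρ)

  av-top : ∀ {v w} → All (_< v) w → Av r w → Av r (v ∷ w)
  av-top w<v a = av-∷⁺ a λ
    { {_ ∷ c ∷ []} sub ((_ ∷ so ∷ []) ∷ _) → ℕₚ.<-asym (so-< so) (All.head (All.tail (Subₚ.All-resp-⊆ sub w<v))) }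

  private
    keep : ∀ {v x w z} → x < v → Inserted 1 v w z → Av r (x ∷ w) → Av r z →
           (∀ {y} → y ∷ v ∷ [] ⊆ z → ¬ y < x) → Av r (x ∷ z)
    keep {v} {x} x<v i a az no-descent = av-∷⁺ az new
      where
      new : ∀ {l} → l ⊆ _ → ¬ x ∷ l ≅ r
      new {y ∷ c ∷ []} sub e@((so ∷ so′ ∷ []) ∷ _) with c ≟ v
      ... | yes refl = no-descent sub (so-> so)
      ... | no c≢v   = a (_ , refl ∷ inserted-old i sub
        (ℕₚ.<-trans (so-> so) x<v ∷ ℕₚ.≤∧≢⇒< (All.head (All.tail (Subₚ.All-resp-⊆ sub (Inserted.bound i)))) c≢v ∷ []) , e)

  open Splitting

  private
    front : ∀ {v w c} (φ : List ℕ → ℕ) (f : Composition → ℕ) → Runs w c → All (_< v) w → Av r w →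
      (∀ {z c′} → Inserted 1 v w z → Runs z c′ → Av r z → φ z ≡ f c′) →
      ⟦ av? r (v ∷ w) ⟧ * φ (v ∷ w) + 0 ≡ f (0 ∷ c)
    front {v} {w} φ f ρ w<v a hyp =
      trans (ℕₚ.+-identityʳ _)
      (trans (cong (_* φ (v ∷ w)) (⟦⟧-yes (av? r (v ∷ w)) (av-top w<v a)))
      (trans (ℕₚ.*-identityˡ _) (hyp (inserted-new (inserted-none w<v)) (runs-top ρ w<v) (av-top w<v a))))

    head : ∀ {v y w u z} → Inserted 1 v (y ∷ w) (u ∷ z) → u ≡ v ⊎ u ≡ y
    head {v} {y} {w} {u} {z} i with u <? v
    ... | yes u<v = inj₂ (∷-injectiveˡ (trans (sym (filter-accept (_<? v) {xs = z} u<v)) (Inserted.rest i)))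
    ... | no u≮v  = inj₁ (ℕₚ.≤-antisym (All.head (Inserted.bound i)) (ℕₚ.≮⇒≥ u≮v))

  -- Unlike `⊨-insert` this passes `Inserted` to the hypothesis: it shows that behind an ascent the
  -- next letter is the new or the old one, both above `x`, so that `x` still prolongs the run.
  runs-insert : ∀ {v w c} (φ : List ℕ → ℕ) f → Runs w c → All (_< v) w → Av r w →
    (∀ {z c′} → Inserted 1 v w z → Runs z c′ → Av r z → φ z ≡ f c′) →
    ∑ (ins 1 v w) (λ z → ⟦ av? r z ⟧ * φ z) ≡ U f c
  runs-insert {v} φ f [] w<v a hyp =
    trans (∑-ins-[] 0 v (λ z → ⟦ av? r z ⟧ * φ z)) (front φ f [] [] a hyp)
  runs-insert {v} {x ∷ []} φ f [-] (x<v ∷ []) a hyp =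
    trans (∑-ins-∷ 0 v x [] (λ z → ⟦ av? r z ⟧ * φ z))
    (trans (cong₂ _+_ (front φ f [-] (x<v ∷ []) a hyp)
              (trans (∑-ins-[] 0 v (λ z → ⟦ av? r (x ∷ z) ⟧ * φ (x ∷ z)))
              (trans (ℕₚ.+-identityʳ _)
              (trans (cong (_* φ (x ∷ v ∷ [])) (⟦⟧-yes (av? r (x ∷ v ∷ [])) av′))
              (trans (ℕₚ.*-identityˡ _) (hyp (inserted-∷ x<v (inserted-new (inserted-none []))) (asc x<v [-]) av′))))))
           (ℕₚ.+-comm (f (0 ∷ 0 ∷ [])) (f (1 ∷ []))))
    where
    av′ : Av r (x ∷ v ∷ [])
    av′ = keep x<v (inserted-new (inserted-none [])) a (av-top [] av-[]) λ { (refl ∷ ()) ; (_ ∷ʳ ()) }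
  runs-insert {v} {x ∷ y ∷ w} φ f (asc {n = n} {rs} x<y ρ) (x<v ∷ w<v) a hyp =
    trans (∑-ins-∷ 0 v x (y ∷ w) (λ z → ⟦ av? r z ⟧ * φ z))
    (trans (cong₂ _+_ (front φ f (asc x<y ρ) (x<v ∷ w<v) a hyp)
              (trans (∑-ins-cong 1 (y ∷ w) w<v λ {z} i → cong (_* φ (x ∷ z))
                        (av-swap {z = x ∷ z} {z} av-∷⁻ (extend i)))
                     (runs-insert (φ ∘ (x ∷_)) (grow f) ρ w<v (av-∷⁻ a) hyp′)))
           (order (f (0 ∷ suc n ∷ rs)) (f (suc (suc n) ∷ rs)) (splits (grow f) n rs)))
    where
    order : ∀ a b c → a + (b + c) ≡ b + (a + c)
    order = solve-∀
    no-descent : ∀ {z u} → Inserted 1 v (y ∷ w) z → Av r z → u ∷ v ∷ [] ⊆ z → ¬ u < x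
    no-descent {u′ ∷ z} {u} i az sub u<x with head i | sub
    ... | inj₁ refl | refl ∷ _  = ℕₚ.<-asym u<x x<v
    ... | inj₁ refl | _ ∷ʳ sub′ = ℕₚ.<⇒≱ (ℕₚ.n<1+n 1)
      (ℕₚ.≤-trans (replicate-⊆⇒count 1 2 (v ∷ z) (refl ∷ ⊆-trans (u ∷ʳ ⊆-refl) sub′)) (ℕₚ.≤-reflexive (Inserted.total i)))
    ... | inj₂ refl | refl ∷ _  = ℕₚ.<-asym u<x x<y
    ... | inj₂ refl | _ ∷ʳ sub′ = az (_ , refl ∷ sub′ ,
      (so->⁺ (ℕₚ.<-trans u<x x<y) ∷ so-<⁺ (All.head w<v) ∷ []) ∷ (so-<⁺ (ℕₚ.<-trans u<x x<v) ∷ []) ∷ [] ∷ [])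
    extend : ∀ {z} → Inserted 1 v (y ∷ w) z → Av r z → Av r (x ∷ z)
    extend i az = keep x<v i a az (no-descent i az)
    hyp′ : ∀ {z c′} → Inserted 1 v (y ∷ w) z → Runs z c′ → Av r z → φ (x ∷ z) ≡ grow f c′
    hyp′ {[]} {[]} i σ az with () ← Inserted.long i
    hyp′ {u ∷ z} {_ ∷ _} i σ az = hyp (inserted-∷ x<v i) (asc (x<u (head i)) σ) (extend i az)
      where
      x<u : u ≡ v ⊎ u ≡ y → x < u
      x<u (inj₁ refl) = x<v
      x<u (inj₂ refl) = x<y
  runs-insert {v} {x ∷ y ∷ w} φ f (desc {c = c} y<x ρ) (x<v ∷ y<v ∷ w<v) a hyp =
    trans (∑-ins-∷ 0 v x (y ∷ w) (λ z → ⟦ av? r z ⟧ * φ z))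
    (trans (cong₂ _+_ (front φ f (desc y<x ρ) (x<v ∷ y<v ∷ w<v) a hyp)
              (trans (∑-ins-∷ 0 v y w (λ z → ⟦ av? r (x ∷ z) ⟧ * φ (x ∷ z)))
                     -- Behind the descent from `x` to `y` the new maximum would complete the
                     -- reversed pattern 213.
                     (cong₂ _+_ second (∑-ins-vanish 1 w w<v λ {z} i → cong (_* φ (x ∷ y ∷ z))
                       (⟦⟧-no (av? r (x ∷ y ∷ z)) λ az → az (_ , refl ∷ refl ∷ count-⊆ z (ℕₚ.≤-reflexive (sym (Inserted.total i)))
                          , (so->⁺ y<x ∷ so-<⁺ x<v ∷ []) ∷ (so-<⁺ y<v ∷ []) ∷ [] ∷ []))))))
           (order (f (0 ∷ 0 ∷ c)) (f (1 ∷ c))))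
    where
    order : ∀ a b → a + (b + 0) ≡ b + a
    order = solve-∀
    i₁ : Inserted 1 v (y ∷ w) (v ∷ y ∷ w)
    i₁ = inserted-new (inserted-none (y<v ∷ w<v))
    av′ : Av r (x ∷ v ∷ y ∷ w)
    av′ = keep x<v i₁ a (av-top (y<v ∷ w<v) (av-∷⁻ a)) λ
      { (refl ∷ _) v<x → ℕₚ.<-asym v<x x<v
      ; (_ ∷ʳ sub) _ → ℕₚ.<-irrefl refl (All.head (All.tail (Subₚ.All-resp-⊆ sub (y<v ∷ w<v)))) }
    second : ⟦ av? r (x ∷ v ∷ y ∷ w) ⟧ * φ (x ∷ v ∷ y ∷ w) + 0 ≡ f (1 ∷ c)
    second = trans (ℕₚ.+-identityʳ _)
      (trans (cong (_* φ (x ∷ v ∷ y ∷ w)) (⟦⟧-yes (av? r (x ∷ v ∷ y ∷ w)) av′))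
      (trans (ℕₚ.*-identityˡ _) (hyp (inserted-∷ x<v i₁) (asc x<v (runs-top ρ (y<v ∷ w<v))) av′)))

  shape : Shape r insertion
  shape = record
    { _⊨_ = Runs ; ⊨-[] = [] ; ⊨-∷ = λ { [-] () ; (asc _ _) () ; (desc _ _) () } ; ⊨-empty = λ { [] → refl }
    ; ⊨-drop = runs-drop
    ; ⊨-insert = λ φ f ρ w<v a hyp → runs-insert φ f ρ w<v a λ i σ az → hyp σ (Inserted.bound i) az }

module Blocks-231 where

  private
    r : List ℕ
    r = 1 ∷ 3 ∷ 2 ∷ []

  -- The components of the word: each of them starts with its maximum (in reversed words: ends
  -- with it) and is below the components to its right.
  data Blocks : List ℕ → Composition → Set where
    []    : Blocks [] []
    block : ∀ {p x w c} → All (_< x) p → All (λ y → y < x × All (y <_) p) w → Blocks w c →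
            Blocks (p ++ x ∷ w) (length p ∷ c)

  blocks-drop : ∀ {u w c} → Blocks (u ∷ w) c → ∃ λ c′ → Blocks w c′ × (∀ f → drop₁ f c ≡ f c′)
  blocks-drop β = go β refl
    where
    go : ∀ {u w z c} → Blocks z c → z ≡ u ∷ w → ∃ λ c′ → Blocks w c′ × (∀ f → drop₁ f c ≡ f c′)
    go (block {[]}    _         _  β) refl = _ , β , λ f → refl
    go (block {_ ∷ p} (_ ∷ p<x) <w β) refl =
      _ , block p<x (All.map (λ (y<x , y<p) → y<x , All.tail y<p) <w) β , λ f → refl

  open Merging

  Above : List ℕ → List ℕ → Set
  Above c w = All (λ y → All (y <_) c) w

  private
    -- At a boundary everything in front is larger than everything behind, so the maximum cannot
    -- play the 3 of the reversed pattern 132.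
    av-insert : ∀ {v} c w → All (_< v) c → All (_< v) w → Above c w → Av r (c ʳ++ w) → Av r (c ʳ++ v ∷ w)
    av-insert {v} c w c<v w<v above a (l , sub , e) with ⊆-++⁻ (reverse c) (subst (l ⊆_) (ʳ++-defn c) sub)
    ... | l₁ , l₂ , refl , s₁ , (_ ∷ʳ s₂) =
      a (l₁ ++ l₂ , subst (l₁ ++ l₂ ⊆_) (sym (ʳ++-defn c)) (Subₚ.++⁺ s₁ s₂) , e)
    ... | l₁ , _ ∷ l₂ , refl , s₁ , (refl ∷ s₂) = clash l₁ e s₁ s₂
      where
      clash : ∀ l₁ {l₂} → l₁ ++ v ∷ l₂ ≅ r → l₁ ⊆ reverse c → l₂ ⊆ w → ⊥
      clash [] ((so ∷ _ ∷ []) ∷ _) s₁ s₂ = ℕₚ.<-asym (so-< so) (All.head (Subₚ.All-resp-⊆ s₂ w<v))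
      clash (x ∷ []) ((_ ∷ so ∷ []) ∷ _) s₁ s₂ =
        ℕₚ.<-asym (so-< so) (All.head (Subₚ.All-resp-⊆ s₁ (All-reverse⁺ (All.head (Subₚ.All-resp-⊆ s₂ above)))))
      clash (x ∷ y ∷ []) (_ ∷ (so ∷ []) ∷ _) s₁ s₂ =
        ℕₚ.<-asym (so-> so) (All.head (All.tail (Subₚ.All-resp-⊆ s₁ (All-reverse⁺ c<v))))
      clash (_ ∷ _ ∷ _ ∷ []) ((_ ∷ _ ∷ ()) ∷ _)
      clash (_ ∷ _ ∷ _ ∷ _ ∷ _) ((_ ∷ _ ∷ ()) ∷ _)

  module _ {v : ℕ} (φ : List ℕ → ℕ) (f : Composition → ℕ)
           (hyp : ∀ {z c′} → Blocks z c′ → All (_≤ v) z → Av r z → φ z ≡ f c′) where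

    private
      g : List ℕ → ℕ
      g z = ⟦ av? r z ⟧ * φ z

      front : ∀ c {w rs} → All (_< v) c → All (_< v) w → Above c w → Av r (c ʳ++ w) → Blocks w rs →
              g (c ʳ++ v ∷ w) ≡ f (length c ∷ rs)
      front c {w} {rs} c<v w<v above a β =
        trans (cong (_* φ (c ʳ++ v ∷ w)) (⟦⟧-yes (av? r (c ʳ++ v ∷ w)) av′))
        (trans (ℕₚ.*-identityˡ _) (hyp β′ (All-ʳ++⁺ (All.map ℕₚ.<⇒≤ c<v) (ℕₚ.≤-refl ∷ All.map ℕₚ.<⇒≤ w<v)) av′))
        where
        av′ = av-insert c w c<v w<v above a
        β′ : Blocks (c ʳ++ v ∷ w) (length c ∷ rs)
        β′ = subst₂ Blocks (sym (ʳ++-defn c)) (cong (_∷ rs) (length-reverse c))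
          (block (All-reverse⁺ c<v) (All.zipWith (λ (y<v , y<c) → y<v , All-reverse⁺ y<c) (w<v , above)) β)

      -- Inside a block the new maximum would complete a 231.
      inside : ∀ c p {x w} → (∃ λ a → a ∈ c × a < x) → x < v →
        ∑ (ins 1 v (p ++ x ∷ w)) (λ z → g (c ʳ++ z)) ≡ ∑ (ins 1 v w) (λ z → g ((x ∷ (p ʳ++ c)) ʳ++ z))
      inside c [] {x} {w} (a , a∈ , a<x) x<v =
        trans (∑-ins-∷ 0 v x w (λ z → g (c ʳ++ z)))
              (cong (λ n → n * φ (c ʳ++ v ∷ x ∷ w) + 0 + ∑ (ins 1 v w) (λ z → g ((x ∷ c) ʳ++ z))) (⟦⟧-no (av? r (c ʳ++ v ∷ x ∷ w)) λ av →
                av (_ , ⊆-trans (refl ∷ refl ∷ refl ∷ minimum w) (∈-ʳ++ c a∈)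
                   , (so-<⁺ (ℕₚ.<-trans a<x x<v) ∷ so-<⁺ a<x ∷ []) ∷ (so->⁺ x<v ∷ []) ∷ [] ∷ [])))
      inside c (y ∷ p) {x} {w} (a , a∈ , a<x) x<v =
        trans (∑-ins-∷ 0 v y (p ++ x ∷ w) (λ z → g (c ʳ++ z)))
        (trans (cong (λ n → n * φ (c ʳ++ v ∷ y ∷ p ++ x ∷ w) + 0 + ∑ (ins 1 v (p ++ x ∷ w)) (λ z → g ((y ∷ c) ʳ++ z))) (⟦⟧-no (av? r (c ʳ++ v ∷ y ∷ p ++ x ∷ w)) λ av →
                 av (_ , ⊆-trans (refl ∷ refl ∷ y ∷ʳ Subₚ.++⁺ˡ p (refl ∷ minimum w)) (∈-ʳ++ c a∈)
                    , (so-<⁺ (ℕₚ.<-trans a<x x<v) ∷ so-<⁺ a<x ∷ []) ∷ (so->⁺ x<v ∷ []) ∷ [] ∷ [])))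
               (inside (y ∷ c) p {x} {w} (a , there a∈ , a<x) x<v))

      past : ∀ c p {x w} → All (_< x) p → x < v →
        ∑ (ins 1 v (p ++ x ∷ w)) (λ z → g (c ʳ++ z)) ≡
        g (c ʳ++ v ∷ p ++ x ∷ w) + ∑ (ins 1 v w) (λ z → g ((x ∷ (p ʳ++ c)) ʳ++ z))
      past c [] {x} {w} [] x<v =
        trans (∑-ins-∷ 0 v x w (λ z → g (c ʳ++ z))) (cong (_+ ∑ (ins 1 v w) (λ z → g ((x ∷ c) ʳ++ z))) (ℕₚ.+-identityʳ (g (c ʳ++ v ∷ x ∷ w))))
      past c (y ∷ p) {x} {w} (y<x ∷ p<x) x<v =
        trans (∑-ins-∷ 0 v y (p ++ x ∷ w) (λ z → g (c ʳ++ z)))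
              (cong₂ _+_ (ℕₚ.+-identityʳ (g (c ʳ++ v ∷ y ∷ p ++ x ∷ w)))
                         (inside (y ∷ c) p (y , here refl , y<x) x<v))

    -- The blocks already passed are collected in `c`: placed behind them, the maximum unites them
    -- all to one block.
    blocks-insert-after : ∀ c {w rs} → All (_< v) c → All (_< v) w → Above c w → Av r (c ʳ++ w) → Blocks w rs →
      ∑ (ins 1 v w) (λ z → g (c ʳ++ z)) ≡ f (length c ∷ rs) + θ f (length c ∷ rs)
    blocks-insert-after c c<v w<v above a [] =
      trans (∑-ins-[] 0 v (λ z → g (c ʳ++ z))) (cong (_+ 0) (front c c<v [] [] a []))
    blocks-insert-after c c<v w<v above a (block {p} {x} {w} {rs} p<x w<p β) =
      trans (past c p p<x (All.head x∷w<v))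
      (cong₂ _+_ (front c c<v w<v above a (block p<x w<p β))
        (trans (blocks-insert-after (x ∷ (p ʳ++ c)) (All.head x∷w<v ∷ All-ʳ++⁺ (Allₚ.++⁻ˡ p w<v) c<v) (All.tail x∷w<v)
                  (All.zipWith (λ ((y<x , y<p) , y<c) → y<x ∷ All-ʳ++⁺ y<p y<c) (w<p , All.tail (Allₚ.++⁻ʳ p above)))
                  (subst (Av r) (ʳ++-shift p c) a) β)
               (cong (λ n → f (n ∷ rs) + θ f (n ∷ rs)) len)))
      where
      x∷w<v = Allₚ.++⁻ʳ p w<v
      ʳ++-shift : ∀ p c → c ʳ++ p ++ x ∷ w ≡ (p ʳ++ c) ʳ++ x ∷ w
      ʳ++-shift []      c = refl
      ʳ++-shift (y ∷ p) c = ʳ++-shift p (y ∷ c)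
      len : suc (length (p ʳ++ c)) ≡ length c + suc (length p)
      len = trans (cong suc (trans (length-ʳ++ p) (ℕₚ.+-comm (length p) (length c)))) (sym (ℕₚ.+-suc (length c) (length p)))

    blocks-insert : ∀ {w c} → Blocks w c → All (_< v) w → Av r w → ∑ (ins 1 v w) g ≡ U f c
    blocks-insert []                w<v a = trans (blocks-insert-after [] [] w<v [] a []) (ℕₚ.+-identityʳ _)
    blocks-insert (block p<x w<p β) w<v a = blocks-insert-after [] [] w<v (All.universal (λ _ → []) _) a (block p<x w<p β)

  shape : Shape r insertion
  shape = record
    { _⊨_ = Blocks ; ⊨-[] = [] ; ⊨-∷ = λ { (block {[]} _ _ _) () ; (block {_ ∷ _} _ _ _) () } ; ⊨-empty = λ { [] → refl }
    ; ⊨-drop = blocks-drop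
    ; ⊨-insert = λ φ f β w<v a hyp → blocks-insert φ f hyp β w<v a }

backward-231≡312 : ∀ ω H → All (Bounded 1) ω →
  backward (1 ∷ 3 ∷ 2 ∷ []) ω (0 , []) (H , []) ≡ backward (2 ∷ 1 ∷ 3 ∷ []) ω (0 , []) (H , [])
backward-231≡312 ω H bs = trans (Shape.backward-by-shape Blocks-231.shape ω bs Blocks-231.[] [] av-[])
  (trans (run-value Merging.insertion Splitting.insertion H ω 0 [])
         (sym (Shape.backward-by-shape Runs-312.shape ω bs Runs-312.[] [] av-[])))

-- Walks on partitions with at most two rows.

-- Partitions with two rows: (e , b) stands for the partition with rows b + e and b.
-- iₐ and iᵦ add a box to the first and the second row, xₐ and xᵦ remove it.
module Walk where

  Weight : Set
  Weight = ℕ → ℕ → ℕ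

  iₐ iᵦ xₐ xᵦ : Weight → Weight
  iₐ F e       b       = F (suc e) b
  iᵦ F zero    b       = 0
  iᵦ F (suc e) b       = F e (suc b)
  xₐ F zero    b       = 0
  xₐ F (suc e) b       = F e b
  xᵦ F e       zero    = 0
  xᵦ F e       (suc b) = F (suc e) b

  -- Adding a horizontal strip of m boxes, from left to right (m ≤ 2 suffices).
  I : ℕ → Weight → Weight
  I 0 F e b = F e b
  I 1 F e b = iₐ F e b + iᵦ F e b
  I (suc (suc m)) F e b = iᵦ (iᵦ F) e b + iᵦ (iₐ F) e b + iₐ (iₐ F) e b

  X : Weight → Weight
  X F e b = xₐ F e b + xᵦ F e b

  π : Weight → Weight
  π F e zero    = F e zero
  π F e (suc b) = 0

  I-cong : ∀ m {F G} → (∀ e b → F e b ≡ G e b) → ∀ e b → I m F e b ≡ I m G e b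
  I-cong 0 q e b = q e b
  I-cong 1 q zero    b = cong (_+ 0) (q 1 b)
  I-cong 1 q (suc e) b = cong₂ _+_ (q (suc (suc e)) b) (q e (suc b))
  I-cong (suc (suc m)) q zero          b = q 2 b
  I-cong (suc (suc m)) q (suc zero)    b = cong₂ _+_ (q 1 (suc b)) (q 3 b)
  I-cong (suc (suc m)) q (suc (suc e)) b =
    cong₂ _+_ (cong₂ _+_ (q e (suc (suc b))) (q (suc (suc e)) (suc b))) (q (suc (suc (suc (suc e)))) b)

  private
    +-interchange : ∀ a b c d → a + b + (c + d) ≡ a + c + (b + d)
    +-interchange = solve-∀

  I-+ : ∀ m F G e b → I m (λ e b → F e b + G e b) e b ≡ I m F e b + I m G e b
  I-+ 0 F G e b = refl
  I-+ 1 F G zero    b = solve₁ (F 1 b) (G 1 b)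
    where
    solve₁ : ∀ a b → a + b + 0 ≡ a + 0 + (b + 0)
    solve₁ = solve-∀
  I-+ 1 F G (suc e) b = +-interchange (F (suc (suc e)) b) (G (suc (suc e)) b) (F e (suc b)) (G e (suc b))
  I-+ (suc (suc m)) F G zero b = refl
  I-+ (suc (suc m)) F G (suc zero) b = +-interchange (F 1 (suc b)) (G 1 (suc b)) (F 3 b) (G 3 b)
  I-+ (suc (suc m)) F G (suc (suc e)) b =
    solve₆ (F e (suc (suc b))) (G e (suc (suc b))) (F (suc (suc e)) (suc b)) (G (suc (suc e)) (suc b))
           (F (suc (suc (suc (suc e)))) b) (G (suc (suc (suc (suc e)))) b)
    where
    solve₆ : ∀ a a′ b b′ c c′ → a + a′ + (b + b′) + (c + c′) ≡ a + b + c + (a′ + b′ + c′)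
    solve₆ = solve-∀

  I-zero : ∀ m e b → I m (λ _ _ → 0) e b ≡ 0
  I-zero 0 e b = refl
  I-zero 1 zero b = refl
  I-zero 1 (suc e) b = refl
  I-zero (suc (suc m)) zero b = refl
  I-zero (suc (suc m)) (suc zero) b = refl
  I-zero (suc (suc m)) (suc (suc e)) b = refl

  -- If the second row is empty after adding the strip, all of its boxes went to the first row.
  I-π : ∀ m F → m ≤ 2 → ∀ e b → I m (π F) e b ≡ π (λ e b → F (m + e) b) e b
  I-π 0 F _ e       b       = refl
  I-π 1 F _ zero    zero    = ℕₚ.+-identityʳ _
  I-π 1 F _ zero    (suc b) = refl
  I-π 1 F _ (suc e) zero    = ℕₚ.+-identityʳ _
  I-π 1 F _ (suc e) (suc b) = refl
  I-π 2 F _ zero          zero    = refl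
  I-π 2 F _ zero          (suc b) = refl
  I-π 2 F _ (suc zero)    zero    = refl
  I-π 2 F _ (suc zero)    (suc b) = refl
  I-π 2 F _ (suc (suc e)) zero    = refl
  I-π 2 F _ (suc (suc e)) (suc b) = refl
  I-π (suc (suc (suc m))) F (ℕ.s≤s (ℕ.s≤s ()))

  -- For partitions with any number of rows the correction would be `I m F` throughout. Restricting
  -- to two rows loses the strips with one box in a third row, which the removal would take away
  -- again; they exist when the second row is nonempty and account for just this correction.
  I-X : ∀ m F → m ≤ 1 → ∀ e b → I (suc m) (X F) e b ≡ X (I (suc m) F) e b + π (I m F) e b
  I-X 0 F _ zero    zero    = r (F 0 0)
    where
    r : ∀ a → a + 0 + 0 ≡ 0 + a
    r = solve-∀
  I-X 0 F _ zero    (suc b) = r (F 0 (suc b)) (F 2 b)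
    where
    r : ∀ a b → a + b + 0 ≡ b + a + 0
    r = solve-∀
  I-X 0 F _ (suc zero) zero = r (F 1 0)
    where
    r : ∀ a → a + 0 + (0 + a) ≡ a + 0 + 0 + a
    r = solve-∀
  I-X 0 F _ (suc (suc e)) zero = r (F (suc (suc e)) 0) (F e 1)
    where
    r : ∀ a b → a + 0 + (b + a) ≡ a + b + 0 + a
    r = solve-∀
  I-X 0 F _ (suc zero) (suc b) = r (F 1 (suc b)) (F 3 b)
    where
    r : ∀ a b → a + b + (0 + a) ≡ a + 0 + (b + a) + 0
    r = solve-∀
  I-X 0 F _ (suc (suc e)) (suc b) = r (F (suc (suc e)) (suc b)) (F (suc (suc (suc (suc e)))) b) (F e (suc (suc b)))
    where
    r : ∀ a b c → a + b + (c + a) ≡ a + c + (b + a) + 0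
    r = solve-∀
  I-X 1 F _ zero zero = r (F 1 0)
    where
    r : ∀ a → a + 0 ≡ a + 0
    r = solve-∀
  I-X 1 F _ zero (suc b) = r (F 1 (suc b)) (F 3 b)
    where
    r : ∀ a b → a + b ≡ a + b + 0
    r = solve-∀
  I-X 1 F _ (suc zero) zero = r (F 0 1) (F 2 0)
    where
    r : ∀ a b → a + b + (b + 0) ≡ b + 0 + (b + a)
    r = solve-∀
  I-X 1 F _ (suc zero) (suc b) = r (F 0 (suc (suc b))) (F 2 (suc b)) (F 4 b)
    where
    r : ∀ a b c → a + b + (b + c) ≡ b + (a + b + c) + 0
    r = solve-∀
  I-X 1 F _ (suc (suc zero)) zero = r (F 1 1) (F 3 0)
    where
    r : ∀ a b → 0 + a + (a + b) + (b + 0) ≡ a + b + 0 + (b + a)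
    r = solve-∀
  I-X 1 F _ (suc (suc zero)) (suc b) = r (F 1 (suc (suc b))) (F 3 (suc b)) (F 5 b)
    where
    r : ∀ a b c → 0 + a + (a + b) + (b + c) ≡ a + b + (a + b + c) + 0
    r = solve-∀
  I-X 1 F _ (suc (suc (suc e))) zero = r (F e 2) (F (suc (suc e)) 1) (F (suc (suc (suc (suc e)))) 0)
    where
    r : ∀ a b c → a + b + (b + c) + (c + 0) ≡ a + b + c + 0 + (c + b)
    r = solve-∀
  I-X 1 F _ (suc (suc (suc e))) (suc b) = r (F e (suc (suc (suc b)))) (F (suc (suc e)) (suc (suc b))) (F (suc (suc (suc (suc e)))) (suc b)) (F (suc (suc (suc (suc (suc (suc e)))))) b)
    where
    r : ∀ a b c d → a + b + (b + c) + (c + d) ≡ a + b + c + (b + c + d) + 0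
    r = solve-∀
  I-X (suc (suc m)) F (ℕ.s≤s ())

  run : ℕ → List ℕ → Weight → ℕ
  run n []       F = F n 0
  run n (m ∷ ms) F = run n ms (I m F)

  run-cong : ∀ n ms {F G} → (∀ e b → F e b ≡ G e b) → run n ms F ≡ run n ms G
  run-cong n []       q = q n 0
  run-cong n (m ∷ ms) q = run-cong n ms (I-cong m q)

  run-+ : ∀ n ms F G → run n ms (λ e b → F e b + G e b) ≡ run n ms F + run n ms G
  run-+ n []       F G = refl
  run-+ n (m ∷ ms) F G = trans (run-cong n ms (I-+ m F G)) (run-+ n ms (I m F) (I m G))

  run-zero : ∀ n ms → run n ms (λ _ _ → 0) ≡ 0
  run-zero n []       = refl
  run-zero n (m ∷ ms) = trans (run-cong n ms (I-zero m)) (run-zero n ms)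

  run-π : ∀ n ms F → All (_≤ 2) ms → run n ms (π F) ≡ F (sum ms + n) 0
  run-π n []       F []        = refl
  run-π n (m ∷ ms) F (m≤ ∷ ms≤) =
    trans (run-cong n ms (I-π m F m≤))
    (trans (run-π n ms (λ e b → F (m + e) b) ms≤) (cong (λ e → F e 0) (sym (ℕₚ.+-assoc m (sum ms) n))))

  value : ℕ → List Op → ℕ → Weight
  value H []          h zero    zero    = ⟦ h ≟ H ⟧
  value H []          h zero    (suc b) = 0
  value H []          h (suc e) b       = 0
  value H (add ∷ ω)   h e       b       = X (value H ω h) e b
  value H (del m ∷ ω) h e       b       = I m (value H ω (suc h)) e b

  value-[] : ∀ m H h e b → I (suc m) (value H [] h) e b ≡ 0
  value-[] zero    H h zero                b = refl
  value-[] zero    H h (suc zero)          b = refl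
  value-[] zero    H h (suc (suc e))       b = refl
  value-[] (suc m) H h zero                b = refl
  value-[] (suc m) H h (suc zero)          b = refl
  value-[] (suc m) H h (suc (suc zero))    b = refl
  value-[] (suc m) H h (suc (suc (suc e))) b = refl

-- The patterns 123 and 213.

-- Patterns (reversed) of the form 3 p with p ∈ {12, 21}. A state avoiding p is called pure: it
-- has exactly one pure extension by copies of a new maximum.
record Pure (p : List ℕ) : Set where
  field
    p<3      : All (_< 3) p
    p≢[]     : p ≢ []
    extend   : ℕ → ℕ → List ℕ → List ℕ
    long     : ∀ m v w → length (extend m v w) ≡ m + length w
    bound    : ∀ m {v} w → All (_≤ v) w → All (_≤ v) (extend m v w)
    pure     : ∀ m {v} w → All (_< v) w → Av p w → Av p (extend m v w)
    ∑-pure   : ∀ m {v} w (φ : List ℕ → ℕ) → All (_< v) w →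
               ∑ (ins m v w) (λ z → ⟦ av? p z ⟧ * φ z) ≡ ⟦ av? p w ⟧ * φ (extend m v w)

module Words (p : List ℕ) (P : Pure p) where

  open Pure P

  private
    r : List ℕ
    r = 3 ∷ p

  pure⇒av : ∀ {w} → Av p w → Av r w
  pure⇒av a (x ∷ l , sub , _ ∷ e) = a (l , ⊆-trans (x ∷ʳ ⊆-refl) sub , e)

  X : (List ℕ → ℕ) → List ℕ → ℕ
  X φ []      = 0
  X φ (u ∷ w) = φ w

  I : ℕ → ℕ → (List ℕ → ℕ) → List ℕ → ℕ
  I m v φ w = ∑ (ins m v w) λ z → ⟦ av? r z ⟧ * φ z

  private
    all-< : ∀ {x l} ρ → All (_< 3) ρ → Pointwise (SameOrder x 3) l ρ → All (_< x) l
    all-< []      []         []        = []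
    all-< (_ ∷ ρ) (lt ∷ lts) (so ∷ h) = Equivalence.from (proj₂ so) lt ∷ all-< ρ lts h

    above : ∀ {v l ρ} → l ≅ ρ → All (_< 3) ρ → All (_< v) l → Pointwise (SameOrder v 3) l ρ
    above []      []         []         = []
    above (_ ∷ e) (lt ∷ lts) (lv ∷ lvs) = pair ∷ above e lts lvs
      where
      pair : SameOrder _ 3 _ _
      pair = mk⇔ (λ v<y → contradiction v<y (ℕₚ.<-asym lv)) (λ 3<s → contradiction 3<s (ℕₚ.<-asym lt))
           , mk⇔ (λ _ → lt) (λ _ → lv)

  module _ {m v : ℕ} {w : List ℕ} (w<v : All (_< v) w) where

    av-top : ∀ {z} → Inserted m v w z → ⟦ av? r (v ∷ z) ⟧ ≡ ⟦ av? p w ⟧ * ⟦ av? r z ⟧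
    av-top {z} i =
      trans (⟦⟧-cong (av? r (v ∷ z)) (av? p w ×-dec av? r z)
        (λ a → (λ (l , sub , e) → a (v ∷ l , refl ∷ ⊆-trans sub (inserted-⊆ i)
                                    , above e p<3 (Subₚ.All-resp-⊆ sub w<v) ∷ e)) , av-∷⁻ a)
        (λ (a′ , az) → av-∷⁺ az λ { sub (h ∷ e) → a′ (_ , inserted-old i sub (all-< p p<3 h) , e) }))
      (⟦⟧-× (av? p w) (av? r z))

    av-old : ∀ {x z} → x < v → Av r (x ∷ w) → Inserted m v w z → ⟦ av? r (x ∷ z) ⟧ ≡ ⟦ av? r z ⟧
    av-old {x} {z} x<v a i = av-swap {z = x ∷ z} {z} av-∷⁻ λ az → av-∷⁺ az λ
      { sub (h ∷ e) → a (_ , refl ∷ inserted-old i sub (All.map (λ lt → ℕₚ.<-trans lt x<v) (all-< p p<3 h)) , h ∷ e) }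

  -- The last letter of the word is either old or one of the new maxima; the latter forces the
  -- word to be pure.
  I-X : ∀ m {v} φ w → All (_< v) w → Av r w →
        I (suc m) v (X φ) w ≡ X (I (suc m) v φ) w + ⟦ av? p w ⟧ * I m v φ w
  I-X m {v} φ w w<v a = split w w<v a
    where
    top : ∀ w → All (_< v) w → ∑ (ins m v w) (λ z → ⟦ av? r (v ∷ z) ⟧ * φ z) ≡ ⟦ av? p w ⟧ * I m v φ w
    top w w<v = trans (∑-ins-cong m w w<v λ {z} i → trans (cong (_* φ z) (av-top w<v i)) (ℕₚ.*-assoc ⟦ av? p w ⟧ _ _))
                      (∑-*ˡ ⟦ av? p w ⟧ (ins m v w) _)
    split : ∀ w → All (_< v) w → Av r w →
      I (suc m) v (X φ) w ≡ X (I (suc m) v φ) w + ⟦ av? p w ⟧ * I m v φ w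
    split []      w<v a = trans (∑-ins-[] m v (λ z → ⟦ av? r z ⟧ * X φ z)) (top [] [])
    split (x ∷ w) (x<v ∷ w<v) a =
      trans (∑-ins-∷ m v x w (λ z → ⟦ av? r z ⟧ * X φ z))
      (trans (cong₂ _+_ (top (x ∷ w) (x<v ∷ w<v))
                        (∑-ins-cong (suc m) w w<v λ {z} i → cong (_* φ z) (av-old w<v x<v a i)))
             (ℕₚ.+-comm (⟦ av? p (x ∷ w) ⟧ * I m v φ (x ∷ w)) _))

  I-0 : ∀ {v} φ w → Av r w → I 0 v φ w ≡ φ w
  I-0 φ w a = trans (ℕₚ.+-identityʳ _) (trans (cong (_* φ w) (⟦⟧-yes (av? r w) a)) (ℕₚ.*-identityˡ (φ w)))

  -- Insertions of ms copies of h, h + 1, … (last one first), starting from d.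
  run : ℕ → List ℕ → List ℕ → (List ℕ → ℕ) → ℕ
  run h d []       φ = φ d
  run h d (m ∷ ms) φ = run h d ms (I m (length ms + h) φ)

  module _ {h : ℕ} {d : List ℕ} (d<h : All (_< h) d) (ad : Av r d) where

    run-cong : ∀ ms {φ ψ} → (∀ w → All (_< length ms + h) w → Av r w → φ w ≡ ψ w) → run h d ms φ ≡ run h d ms ψ
    run-cong []       q = q d d<h ad
    run-cong (m ∷ ms) q = run-cong ms λ w w< a → ∑-ins-cong m w w< λ {z} i →
      ⟦⟧*-cong (av? r z) λ az → q z (All.map ℕ.s≤s (Inserted.bound i)) az

    run-+ : ∀ ms φ ψ → run h d ms (λ w → φ w + ψ w) ≡ run h d ms φ + run h d ms ψ
    run-+ []       φ ψ = refl
    run-+ (m ∷ ms) φ ψ =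
      trans (run-cong ms λ w _ _ → trans (∑-cong (ins m (length ms + h) w) λ z → ℕₚ.*-distribˡ-+ ⟦ av? r z ⟧ (φ z) (ψ z))
                                         (∑-+ (ins m (length ms + h) w) _ _))
            (run-+ ms (I m (length ms + h) φ) (I m (length ms + h) ψ))

    run-zero : ∀ ms → run h d ms (λ _ → 0) ≡ 0
    run-zero []       = refl
    run-zero (m ∷ ms) = trans (run-cong ms λ w _ _ →
        ∑-vanish (ins m (length ms + h) w) (All.universal (λ z → ℕₚ.*-zeroʳ ⟦ av? r z ⟧) _))
      (run-zero ms)

    extends : List ℕ → List ℕ
    extends []       = d
    extends (m ∷ ms) = extend m (length ms + h) (extends ms)

    -- Purity of the last state forces purity of all earlier ones, and pure states extend in one
    -- way; the counterpart for partitions is `Walk.run-π`.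
    run-pure : Av p d → ∀ ms (φ : List ℕ → ℕ) → run h d ms (λ w → ⟦ av? p w ⟧ * φ w) ≡ φ (extends ms)
    run-pure pd []       φ = trans (cong (_* φ d) (⟦⟧-yes (av? p d) pd)) (ℕₚ.*-identityˡ (φ d))
    run-pure pd (m ∷ ms) φ = trans
      (run-cong ms λ w w< a → trans (∑-cong (ins m (length ms + h) w) λ z → absorb z) (∑-pure m w φ w<))
      (run-pure pd ms (φ ∘ extend m (length ms + h)))
      where
      absorb : ∀ z → ⟦ av? r z ⟧ * (⟦ av? p z ⟧ * φ z) ≡ ⟦ av? p z ⟧ * φ z
      absorb z with av? p z
      ... | yes pz = trans (cong (_* (1 * φ z)) (⟦⟧-yes (av? r z) (pure⇒av pz))) (ℕₚ.*-identityˡ _)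
      ... | no _   = ℕₚ.*-zeroʳ ⟦ av? r z ⟧

    extends-size : ∀ ms → length (extends ms) ≡ sum ms + length d
    extends-size []       = refl
    extends-size (m ∷ ms) = trans (long m _ (extends ms))
      (trans (cong (m +_) (extends-size ms)) (sym (ℕₚ.+-assoc m (sum ms) (length d))))

    extends-< : ∀ ms → All (_< length ms + h) (extends ms)
    extends-< []       = d<h
    extends-< (m ∷ ms) = All.map ℕ.s≤s (bound m (extends ms) (All.map ℕₚ.<⇒≤ (extends-< ms)))

    extends-pure : Av p d → ∀ ms → Av p (extends ms)
    extends-pure pd []       = pd
    extends-pure pd (m ∷ ms) = pure m (extends ms) (extends-< ms) (extends-pure pd ms)

  Corresponds : ℕ → (List ℕ → ℕ) → Walk.Weight → Set
  Corresponds h φ F = ∀ {h₀ d} ms → All (_< h₀) d → Av p d → All (_≤ 2) ms → length ms + h₀ ≡ h →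
    run h₀ d ms φ ≡ Walk.run (length d) ms F

  corresponds-I : ∀ m {h φ F} → m ≤ 2 → Corresponds (suc h) φ F → Corresponds h (I m h φ) (Walk.I m F)
  corresponds-I m m≤2 c {h₀} ms d<h pd ms≤ refl = c (m ∷ ms) d<h pd (m≤2 ∷ ms≤) refl

  -- The removal moves towards the start, past one insertion at a time. Each correction term
  -- evaluates at a pure state on one side and, on the other, at the single row of as many boxes.
  corresponds-X : ∀ {h φ F} → Corresponds h φ F → Corresponds h (X φ) (Walk.X F)
  corresponds-X {φ = φ} {F} c {d = []}    [] d<h pd ms≤ eq = refl
  corresponds-X {φ = φ} {F} c {d = u ∷ d} [] (_ ∷ d<h) pd ms≤ eq =
    trans (c [] d<h (av-∷⁻ pd) [] eq) (sym (ℕₚ.+-identityʳ _))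
  corresponds-X {φ = φ} {F} c {h₀} {d} (zero ∷ ms) d<h pd (_ ∷ ms≤) refl =
    trans (run-cong d<h (pure⇒av {d} pd) ms λ { [] _ a → I-0 {length ms + h₀} (X φ) [] a
                                          ; (u ∷ w) _ a → trans (I-0 {length ms + h₀} (X φ) (u ∷ w) a) (sym (I-0 {length ms + h₀} φ w (av-∷⁻ {r} {u} a))) })
          (corresponds-X (corresponds-I 0 ℕ.z≤n c) ms d<h pd ms≤ refl)
  corresponds-X {φ = φ} {F} c {h₀} {d} (suc m ∷ ms) d<h pd (m≤ ∷ ms≤) refl = begin
    run h₀ d ms (I (suc m) v (X φ))
      ≡⟨ run-cong d<h ad ms (I-X m φ) ⟩
    run h₀ d ms (λ w → X (I (suc m) v φ) w + ⟦ av? p w ⟧ * I m v φ w)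
      ≡⟨ run-+ d<h ad ms _ _ ⟩
    run h₀ d ms (X (I (suc m) v φ)) + run h₀ d ms (λ w → ⟦ av? p w ⟧ * I m v φ w)
      ≡⟨ cong₂ _+_ (corresponds-X (corresponds-I (suc m) m≤ c) ms d<h pd ms≤ refl) (run-pure d<h ad pd ms (I m v φ)) ⟩
    Walk.run n ms (Walk.X (Walk.I (suc m) F)) + I m v φ (extends d<h ad ms)
      ≡⟨ cong (Walk.run n ms (Walk.X (Walk.I (suc m) F)) +_)
           (c [ m ] (extends-< d<h ad ms) (extends-pure d<h ad pd ms) (m≤2 ∷ []) refl) ⟩
    Walk.run n ms (Walk.X (Walk.I (suc m) F)) + Walk.I m F (length (extends d<h ad ms)) 0
      ≡⟨ cong (λ l → Walk.run n ms (Walk.X (Walk.I (suc m) F)) + Walk.I m F l 0) (extends-size d<h ad ms) ⟩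
    Walk.run n ms (Walk.X (Walk.I (suc m) F)) + Walk.I m F (sum ms + n) 0
      ≡⟨ cong (Walk.run n ms (Walk.X (Walk.I (suc m) F)) +_) (sym (Walk.run-π n ms (Walk.I m F) ms≤)) ⟩
    Walk.run n ms (Walk.X (Walk.I (suc m) F)) + Walk.run n ms (Walk.π (Walk.I m F))
      ≡⟨ sym (Walk.run-+ n ms _ _) ⟩
    Walk.run n ms (λ e b → Walk.X (Walk.I (suc m) F) e b + Walk.π (Walk.I m F) e b)
      ≡⟨ Walk.run-cong n ms (λ e b → sym (Walk.I-X m F (ℕ.s≤s⁻¹ m≤) e b)) ⟩
    Walk.run n ms (Walk.I (suc m) (Walk.X F))
      ∎
    where
    open ≡-Reasoning
    v = length ms + h₀
    n = length d
    ad = pure⇒av pd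
    m≤2 : m ≤ 2
    m≤2 = ℕₚ.≤-trans (ℕₚ.n≤1+n m) m≤

  corresponds-[] : ∀ {H} k → Corresponds k (λ w → ⟦ (k ≟ H) ×-dec (length w ≟ 0) ⟧) (Walk.value H [] k)
  corresponds-[] {H} k {h₀} {d} ms d<h pd ms≤ eq = go ms
    where
    ad = pure⇒av pd
    φ : List ℕ → ℕ
    φ w = ⟦ (k ≟ H) ×-dec (length w ≟ 0) ⟧
    base : ∀ d → φ d ≡ Walk.value H [] k (length d) 0
    base []      = ⟦⟧-cong ((k ≟ H) ×-dec (0 ≟ 0)) (k ≟ H) proj₁ (_, refl)
    base (u ∷ d) = ⟦⟧-no ((k ≟ H) ×-dec (suc (length d) ≟ 0)) λ ()
    go : ∀ ms → run h₀ d ms φ ≡ Walk.run (length d) ms (Walk.value H [] k)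
    go []           = base d
    go (zero ∷ ms)  = trans (run-cong d<h ad ms λ w _ a → I-0 {length ms + h₀} φ w a) (go ms)
    go (suc m ∷ ms) = trans
      (trans (run-cong d<h ad ms λ w w< a → ∑-ins-vanish (suc m) w w< λ {z} i →
                trans (cong (⟦ av? r z ⟧ *_) (⟦⟧-no ((k ≟ H) ×-dec (length z ≟ 0)) λ (_ , e) →
                         contradiction (trans (sym (Inserted.long i)) e) λ ()))
                      (ℕₚ.*-zeroʳ ⟦ av? r z ⟧))
             (run-zero d<h ad ms))
      (sym (trans (Walk.run-cong (length d) ms (Walk.value-[] m H k)) (Walk.run-zero (length d) ms)))

  corresponds-cong : ∀ {h φ ψ F} → (∀ w → All (_< h) w → Av r w → φ w ≡ ψ w) → Corresponds h ψ F → Corresponds h φ F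
  corresponds-cong q c ms d<h pd ms≤ refl = trans (run-cong d<h (pure⇒av pd) ms q) (c ms d<h pd ms≤ refl)

  backward-corresponds : ∀ H ω h → All (Bounded 2) ω →
    Corresponds h (λ w → backward r ω (h , w) (H , [])) (Walk.value H ω h)
  backward-corresponds H [] h [] = corresponds-cong (λ w _ _ → backward-[] r h w H) (corresponds-[] h)
  backward-corresponds H (add ∷ ω) h (_ ∷ bs) = corresponds-cong
    (λ { [] _ _ → refl ; (u ∷ w) _ _ → backward-add r u w ω h (H , []) })
    (corresponds-X (backward-corresponds H ω h bs))
  backward-corresponds H (del m ∷ ω) h (m≤2 ∷ bs) = corresponds-cong
    (λ w _ _ → backward-del r m ω h w (H , []))
    (corresponds-I m m≤2 (backward-corresponds H ω (suc h) bs))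

  backward≡walk : Av p [] → ∀ ω H → All (Bounded 2) ω → backward r ω (0 , []) (H , []) ≡ Walk.value H ω 0 0 0
  backward≡walk a ω H bs = backward-corresponds H ω 0 bs [] [] a [] refl

pure-21 : Pure (2 ∷ 1 ∷ [])
pure-21 = record
  { p<3    = ℕ.s≤s (ℕ.s≤s (ℕ.s≤s ℕ.z≤n)) ∷ ℕ.s≤s (ℕ.s≤s ℕ.z≤n) ∷ []
  ; p≢[]   = λ ()
  ; extend = λ m v w → w ++ replicate m v
  ; long   = λ m v w → trans (length-++ w) (trans (cong (length w +_) (length-replicate m)) (ℕₚ.+-comm (length w) m))
  ; bound  = λ m w w≤v → Allₚ.++⁺ w≤v (Allₚ.replicate⁺ m ℕₚ.≤-refl)
  ; pure   = λ m w w<v → pure m w w<v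
  ; ∑-pure = ∑-pure }
  where
  p : List ℕ
  p = 2 ∷ 1 ∷ []

  constant : ∀ m v → Av p (replicate m v)
  constant zero    v = av-[]
  constant (suc m) v = av-∷⁺ (constant m v) λ
    { {y ∷ []} sub ((so ∷ []) ∷ _) →
      ℕₚ.<-irrefl (All.head (Subₚ.All-resp-⊆ sub (Allₚ.replicate⁺ {P = _≡ v} m refl))) (so-> so) }

  pure : ∀ m {v} w → All (_< v) w → Av p w → Av p (w ++ replicate m v)
  pure m {v} []      w<v a = constant m v
  pure m {v} (x ∷ w) (x<v ∷ w<v) a = av-∷⁺ (pure m w w<v (av-∷⁻ a)) λ
    { {y ∷ []} sub ((so ∷ []) ∷ _) → All.head (Subₚ.All-resp-⊆ sub
        (Allₚ.++⁺ (All.tabulate λ {z} z∈ z<x → a (_ , refl ∷ from∈ z∈ , (so->⁺ z<x ∷ []) ∷ [] ∷ []))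
                  (Allₚ.replicate⁺ m (ℕₚ.<-asym x<v))))
        (so-> so) }

  ∑-pure : ∀ m {v} w (φ : List ℕ → ℕ) → All (_< v) w →
           ∑ (ins m v w) (λ z → ⟦ av? p z ⟧ * φ z) ≡ ⟦ av? p w ⟧ * φ (w ++ replicate m v)
  ∑-pure zero    w φ w<v = trans (ℕₚ.+-identityʳ _) (cong (λ z → ⟦ av? p w ⟧ * φ z) (sym (++-identityʳ w)))
  ∑-pure (suc m) {v} [] φ [] =
    trans (∑-ins-[] m v (λ z → ⟦ av? p z ⟧ * φ z))
    (trans (∑-ins-cong m [] [] λ {z} i → cong (_* φ (v ∷ z)) (av-swap {z = v ∷ z} {z} av-∷⁻ λ az → av-∷⁺ az λ
             { {x ∷ []} sub ((so ∷ []) ∷ _) → contradiction (inserted-old i sub (so-> so ∷ [])) λ () }))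
           (∑-pure m [] (φ ∘ (v ∷_)) []))
  ∑-pure (suc m) {v} (x ∷ w) φ (x<v ∷ w<v) =
    trans (∑-ins-∷ m v x w (λ z → ⟦ av? p z ⟧ * φ z))
    (trans (cong₂ _+_
      (∑-ins-vanish m (x ∷ w) (x<v ∷ w<v) λ {z} i → cong (_* φ (v ∷ z)) (⟦⟧-no (av? p (v ∷ z)) λ az →
         az (_ , refl ∷ ⊆-trans (refl ∷ minimum w) (inserted-⊆ i) , (so->⁺ x<v ∷ []) ∷ [] ∷ [])))
      (trans (∑-ins-cong (suc m) w w<v λ {z} i → trans (cong (_* φ (x ∷ z)) (step i)) (ℕₚ.*-assoc ⟦ av? p (x ∷ w) ⟧ _ _))
             (∑-*ˡ ⟦ av? p (x ∷ w) ⟧ (ins (suc m) v w) _)))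
    (⟦⟧*-cong (av? p (x ∷ w)) λ a → trans (∑-pure (suc m) w (φ ∘ (x ∷_)) w<v)
      (trans (cong (_* φ (x ∷ w ++ replicate (suc m) v)) (⟦⟧-yes (av? p w) (av-∷⁻ a))) (ℕₚ.*-identityˡ _))))
    where
    step : ∀ {z} → Inserted (suc m) v w z → ⟦ av? p (x ∷ z) ⟧ ≡ ⟦ av? p (x ∷ w) ⟧ * ⟦ av? p z ⟧
    step {z} i = trans (⟦⟧-cong (av? p (x ∷ z)) (av? p (x ∷ w) ×-dec av? p z)
      (λ a → Av-⊆ (refl ∷ inserted-⊆ i) a , av-∷⁻ a)
      (λ (a , az) → av-∷⁺ az λ
        { {y ∷ []} sub e@((so ∷ []) ∷ _) → a (_ , refl ∷ inserted-old i sub (ℕₚ.<-trans (so-> so) x<v ∷ []) , e) }))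
      (⟦⟧-× (av? p (x ∷ w)) (av? p z))

pure-12 : Pure (1 ∷ 2 ∷ [])
pure-12 = record
  { p<3    = ℕ.s≤s (ℕ.s≤s ℕ.z≤n) ∷ ℕ.s≤s (ℕ.s≤s (ℕ.s≤s ℕ.z≤n)) ∷ []
  ; p≢[]   = λ ()
  ; extend = λ m v w → replicate m v ++ w
  ; long   = λ m v w → trans (length-++ (replicate m v)) (cong (_+ length w) (length-replicate m))
  ; bound  = λ m w w≤v → Allₚ.++⁺ (Allₚ.replicate⁺ m ℕₚ.≤-refl) w≤v
  ; pure   = λ m w w<v → pure m w w<v
  ; ∑-pure = ∑-pure }
  where
  p : List ℕ
  p = 1 ∷ 2 ∷ []

  pure : ∀ m {v} w → All (_< v) w → Av p w → Av p (replicate m v ++ w)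
  pure zero    w w<v a = a
  pure (suc m) w w<v a = av-∷⁺ (pure m w w<v a) λ
    { {y ∷ []} sub ((so ∷ []) ∷ _) → ℕₚ.<⇒≱ (so-< so) (All.head (Subₚ.All-resp-⊆ sub
        (Allₚ.++⁺ (Allₚ.replicate⁺ m ℕₚ.≤-refl) (All.map ℕₚ.<⇒≤ w<v)))) }

  ∑-pure : ∀ m {v} w (φ : List ℕ → ℕ) → All (_< v) w →
           ∑ (ins m v w) (λ z → ⟦ av? p z ⟧ * φ z) ≡ ⟦ av? p w ⟧ * φ (replicate m v ++ w)
  ∑-pure zero    w φ w<v = ℕₚ.+-identityʳ _
  ∑-pure (suc m) {v} w φ w<v = split w w<v
    where
    front : ∀ w → All (_< v) w →
            ∑ (ins m v w) (λ z → ⟦ av? p (v ∷ z) ⟧ * φ (v ∷ z)) ≡ ⟦ av? p w ⟧ * φ (v ∷ replicate m v ++ w)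
    front w w<v =
      trans (∑-ins-cong m w w<v λ {z} i → cong (_* φ (v ∷ z)) (av-swap {z = v ∷ z} {z} av-∷⁻ λ az → av-∷⁺ az λ
               { {x ∷ []} sub ((so ∷ []) ∷ _) →
                 ℕₚ.<⇒≱ (so-< so) (All.head (Subₚ.All-resp-⊆ sub (Inserted.bound i))) }))
            (∑-pure m w (φ ∘ (v ∷_)) w<v)
    split : ∀ w → All (_< v) w →
      ∑ (ins (suc m) v w) (λ z → ⟦ av? p z ⟧ * φ z) ≡ ⟦ av? p w ⟧ * φ (v ∷ replicate m v ++ w)
    split []      w<v = trans (∑-ins-[] m v (λ z → ⟦ av? p z ⟧ * φ z)) (front [] w<v)
    split (x ∷ w) (x<v ∷ w<v) =
      trans (∑-ins-∷ m v x w (λ z → ⟦ av? p z ⟧ * φ z))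
      (trans (cong₂ _+_ (front (x ∷ w) (x<v ∷ w<v))
        (∑-ins-vanish (suc m) w w<v λ {z} i → cong (_* φ (x ∷ z)) (⟦⟧-no (av? p (x ∷ z)) λ az →
           az (_ , refl ∷ count-⊆ z (ℕₚ.≤-trans (ℕ.s≤s ℕ.z≤n) (ℕₚ.≤-reflexive (sym (Inserted.total i))))
              , (so-<⁺ x<v ∷ []) ∷ [] ∷ []))))
      (ℕₚ.+-identityʳ _))

backward-123≡walk : ∀ ω H → All (Bounded 2) ω →
  backward (3 ∷ 2 ∷ 1 ∷ []) ω (0 , []) (H , []) ≡ Walk.value H ω 0 0 0
backward-123≡walk = Words.backward≡walk _ pure-21 av-[]

backward-213≡walk : ∀ ω H → All (Bounded 2) ω →
  backward (3 ∷ 1 ∷ 2 ∷ []) ω (0 , []) (H , []) ≡ Walk.value H ω 0 0 0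
backward-213≡walk = Words.backward≡walk _ pure-12 av-[]

-- The pattern 321.

module Pattern-321 where

  private
    r : List ℕ
    r = 1 ∷ 2 ∷ 3 ∷ []

  -- The length of a longest weakly decreasing subsequence starting at most at b; in the words
  -- themselves, which are reversed here, it is weakly increasing.
  decreasing≤ : ℕ → List ℕ → ℕ
  decreasing≤ b []      = 0
  decreasing≤ b (x ∷ w) with x ≤? b
  ... | yes _ = suc (decreasing≤ x w) ⊔ decreasing≤ b w
  ... | no _  = decreasing≤ b w

  decreasing : List ℕ → ℕ
  decreasing []      = 0
  decreasing (x ∷ w) = suc (decreasing≤ x w) ⊔ decreasing w

  decreasing≤-∷ : ∀ {b x} w → x ≤ b → decreasing≤ b (x ∷ w) ≡ suc (decreasing≤ x w) ⊔ decreasing≤ b w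
  decreasing≤-∷ {b} {x} w x≤b with x ≤? b
  ... | yes _  = refl
  ... | no x≰b = contradiction x≤b x≰b

  decreasing≤-skip : ∀ {b x} w → ¬ x ≤ b → decreasing≤ b (x ∷ w) ≡ decreasing≤ b w
  decreasing≤-skip {b} {x} w x≰b with x ≤? b
  ... | yes x≤b = contradiction x≤b x≰b
  ... | no _    = refl

  decreasing≤-≤ : ∀ b w → decreasing≤ b w ≤ decreasing w
  decreasing≤-≤ b []      = ℕ.z≤n
  decreasing≤-≤ b (x ∷ w) with x ≤? b
  ... | yes _ = ℕₚ.⊔-monoʳ-≤ (suc (decreasing≤ x w)) (decreasing≤-≤ b w)
  ... | no _  = ℕₚ.≤-trans (decreasing≤-≤ b w) (ℕₚ.m≤n⊔m _ _)

  decreasing≤-all : ∀ b w → All (_≤ b) w → decreasing≤ b w ≡ decreasing w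
  decreasing≤-all b []      []          = refl
  decreasing≤-all b (x ∷ w) (x≤b ∷ w≤b) =
    trans (decreasing≤-∷ w x≤b) (cong (suc (decreasing≤ x w) ⊔_) (decreasing≤-all b w w≤b))

  decreasing≤-mono : ∀ {b c} w → b ≤ c → decreasing≤ b w ≤ decreasing≤ c w
  decreasing≤-mono []      b≤c = ℕ.z≤n
  decreasing≤-mono {b} {c} (x ∷ w) b≤c with x ≤? b | x ≤? c
  ... | yes _   | yes _  = ℕₚ.⊔-monoʳ-≤ (suc (decreasing≤ x w)) (decreasing≤-mono w b≤c)
  ... | yes x≤b | no x≰c = contradiction (ℕₚ.≤-trans x≤b b≤c) x≰c
  ... | no _    | yes _  = ℕₚ.≤-trans (decreasing≤-mono w b≤c) (ℕₚ.m≤n⊔m _ _)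
  ... | no _    | no _   = decreasing≤-mono w b≤c

  decreasing-++ʳ : ∀ p {q} → decreasing q ≤ decreasing (p ++ q)
  decreasing-++ʳ []      = ℕₚ.≤-refl
  decreasing-++ʳ (x ∷ p) = ℕₚ.≤-trans (decreasing-++ʳ p) (ℕₚ.m≤n⊔m _ _)

  -- The increasing pairs of positions determine these lengths and whether 321 is avoided.
  infix 4 _≈_
  data _≈_ : List ℕ → List ℕ → Set where
    []  : [] ≈ []
    _∷_ : ∀ {x x′ w w′} → Pointwise (λ y y′ → x < y ⇔ x′ < y′) w w′ → w ≈ w′ → x ∷ w ≈ x′ ∷ w′

  ≈-refl : ∀ w → w ≈ w
  ≈-refl []      = []
  ≈-refl (x ∷ w) = Pw.refl ⇔-refl ∷ ≈-refl w

  ≈-sym : ∀ {w w′} → w ≈ w′ → w′ ≈ w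
  ≈-sym []      = []
  ≈-sym (h ∷ s) = Pw.symmetric (λ e → ⇔-sym e) h ∷ ≈-sym s

  private
    ⇔-true : ∀ {A B : Set} → A → B → A ⇔ B
    ⇔-true a b = mk⇔ (λ _ → b) (λ _ → a)

    ⇔-false : ∀ {A B : Set} → ¬ A → ¬ B → A ⇔ B
    ⇔-false ¬a ¬b = mk⇔ (λ a → contradiction a ¬a) (λ b → contradiction b ¬b)

  ≈-top : ∀ {v v′ w w′} → w ≈ w′ → All (_≤ v) w → All (_≤ v′) w′ → v ∷ w ≈ v′ ∷ w′
  ≈-top s w≤v w′≤v′ = go s w≤v w′≤v′ ∷ s
    where
    go : ∀ {v v′ w w′} → w ≈ w′ → All (_≤ v) w → All (_≤ v′) w′ → Pointwise (λ y y′ → v < y ⇔ v′ < y′) w w′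
    go []      []          []          = []
    go (_ ∷ s) (a ∷ as) (b ∷ bs) = ⇔-false (ℕₚ.≤⇒≯ a) (ℕₚ.≤⇒≯ b) ∷ go s as bs

  decreasing≤-≈ : ∀ {b b′ w w′} → Pointwise (λ y y′ → b < y ⇔ b′ < y′) w w′ → w ≈ w′ → decreasing≤ b w ≡ decreasing≤ b′ w′
  decreasing≤-≈ [] [] = refl
  decreasing≤-≈ {b} {b′} {x ∷ w} {x′ ∷ w′} (e ∷ h) (h′ ∷ s) with x ≤? b | x′ ≤? b′
  ... | yes _   | yes _    = cong₂ (λ m n → suc m ⊔ n) (decreasing≤-≈ h′ s) (decreasing≤-≈ h s)
  ... | no _    | no _     = decreasing≤-≈ h s
  ... | yes x≤b | no x′≰b′ = contradiction (Equivalence.from e (ℕₚ.≰⇒> x′≰b′)) (ℕₚ.≤⇒≯ x≤b)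
  ... | no x≰b  | yes x′≤b′ = contradiction (Equivalence.to e (ℕₚ.≰⇒> x≰b)) (ℕₚ.≤⇒≯ x′≤b′)

  decreasing-≈ : ∀ {w w′} → w ≈ w′ → decreasing w ≡ decreasing w′
  decreasing-≈ []      = refl
  decreasing-≈ (h ∷ s) = cong₂ (λ m n → suc m ⊔ n) (decreasing≤-≈ h s) (decreasing-≈ s)

  private
    both : ∀ {R S : ℕ → ℕ → Set} {w w′} → Pointwise R w w′ → Pointwise S w w′ → Pointwise (λ y y′ → R y y′ × S y y′) w w′
    both []      []      = []
    both (p ∷ h) (q ∷ k) = (p , q) ∷ both h k

    ≈-⊆-with : ∀ {R : ℕ → ℕ → Set} {w w′ l} → Pointwise R w w′ → w ≈ w′ → l ⊆ w →
               ∃ λ l′ → l′ ⊆ w′ × l ≈ l′ × Pointwise R l l′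
    ≈-⊆-with []      []       []         = [] , [] , [] , []
    ≈-⊆-with (_ ∷ h) (_ ∷ s)  (_ ∷ʳ sub) = let l′ , sub′ , s′ , h′ = ≈-⊆-with h s sub in l′ , _ ∷ʳ sub′ , s′ , h′
    ≈-⊆-with (e ∷ h) (h₁ ∷ s) (refl ∷ sub) =
      let l′ , sub′ , s′ , h′ = ≈-⊆-with (both h h₁) s sub
      in _ ∷ l′ , refl ∷ sub′ , Pw.map proj₂ h′ ∷ s′ , e ∷ Pw.map proj₁ h′

  ≈-⊆ : ∀ {w w′ l} → w ≈ w′ → l ⊆ w → ∃ λ l′ → l′ ⊆ w′ × l ≈ l′
  ≈-⊆ {w} {w′} s sub = let l′ , sub′ , s′ , _ = ≈-⊆-with (trivial s) s sub in l′ , sub′ , s′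
    where
    trivial : ∀ {w w′} → w ≈ w′ → Pointwise (λ _ _ → 0 ≤ 0) w w′
    trivial []      = []
    trivial (_ ∷ s) = ℕ.z≤n ∷ trivial s

  av-≈ : ∀ {w w′} → w ≈ w′ → Av r w → Av r w′
  av-≈ s a (l′ , sub , e) with ≈-⊆ (≈-sym s) sub
  av-≈ s a (x ∷ y ∷ z ∷ [] , sub , (s₁ ∷ s₂ ∷ []) ∷ (s₃ ∷ []) ∷ _)
    | x′ ∷ y′ ∷ z′ ∷ [] , sub′ , (e₁ ∷ e₂ ∷ []) ∷ (e₃ ∷ []) ∷ _ =
    a (_ , sub′ , (so-<⁺ (Equivalence.to e₁ (so-< s₁)) ∷ so-<⁺ (Equivalence.to e₂ (so-< s₂)) ∷ [])
                 ∷ (so-<⁺ (Equivalence.to e₃ (so-< s₃)) ∷ []) ∷ [] ∷ [])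

  ins-≈ : ∀ {v v′ w w′} → w ≈ w′ → All (_< v) w → All (_< v′) w′ → Pointwise _≈_ (ins 1 v w) (ins 1 v′ w′)
  ins-≈ {v} {v′} {w} {w′} s w<v w′<v′ = go w w′ s w<v w′<v′
    where
    parametric : ∀ {R : ℕ → ℕ → Set} {w w′} → R v v′ → Pointwise R w w′ → Pointwise (Pointwise R) (ins 1 v w) (ins 1 v′ w′)
    parametric e []      = (e ∷ []) ∷ []
    parametric e (p ∷ h) = (e ∷ p ∷ h) ∷ Pw.map⁺ _ _ (Pw.map (p ∷_) (parametric e h))

    zip : ∀ {R S : List ℕ → List ℕ → Set} {xs ys} → Pointwise R xs ys → Pointwise S xs ys → Pointwise (λ x y → R x y × S x y) xs ys
    zip []      []      = []
    zip (p ∷ h) (q ∷ k) = (p , q) ∷ zip h k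

    go : ∀ w w′ → w ≈ w′ → All (_< v) w → All (_< v′) w′ → Pointwise _≈_ (ins 1 v w) (ins 1 v′ w′)
    go [] [] s w<v w′<v′ = ([] ∷ []) ∷ []
    go (x ∷ w) (x′ ∷ w′) (h ∷ s) (x<v ∷ w<v) (x′<v′ ∷ w′<v′) =
      ≈-top (h ∷ s) (All.map ℕₚ.<⇒≤ (x<v ∷ w<v)) (All.map ℕₚ.<⇒≤ (x′<v′ ∷ w′<v′))
      ∷ Pw.map⁺ _ _ (Pw.map (λ (p , q) → p ∷ q) (zip (parametric (⇔-true x<v x′<v′) h) (go w w′ s w<v w′<v′)))

  ∑-Pointwise : ∀ {A : Set} {R : A → A → Set} {xs ys} {f g : A → ℕ} → Pointwise R xs ys → (∀ {x y} → R x y → f x ≡ g y) →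
                ∑ xs f ≡ ∑ ys g
  ∑-Pointwise []      e = refl
  ∑-Pointwise (p ∷ h) e = cong₂ _+_ (e p) (∑-Pointwise h e)

  Respects : (List ℕ → ℕ) → Set
  Respects φ = ∀ {w w′} → w ≈ w′ → φ w ≡ φ w′

  ∑-ins-≈ : ∀ {φ} → Respects φ → ∀ {v v′ w w′} → w ≈ w′ → All (_< v) w → All (_< v′) w′ → ∑ (ins 1 v w) φ ≡ ∑ (ins 1 v′ w′) φ
  ∑-ins-≈ ρ s w<v w′<v′ = ∑-Pointwise (ins-≈ s w<v w′<v′) ρ

  -- Functions respecting `≈` do not depend on the value of an inserted maximum; a canonical choice
  -- makes the row insertions operators without a parameter.
  fresh : List ℕ → ℕ
  fresh []      = 0
  fresh (x ∷ w) = suc x ⊔ fresh w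

  <-fresh : ∀ w → All (_< fresh w) w
  <-fresh []      = []
  <-fresh (x ∷ w) = ℕₚ.m≤m⊔n (suc x) (fresh w)
                  ∷ All.map (λ lt → ℕₚ.≤-trans lt (ℕₚ.m≤n⊔m (suc x) (fresh w))) (<-fresh w)

  opaque
    δ : ℕ → ℕ → ℕ
    δ m n = ⟦ m ≟ n ⟧

    δ-≡ : ∀ n → δ n n ≡ 1
    δ-≡ n = ⟦⟧-yes (n ≟ n) refl

    δ-suc : ∀ n → δ n (suc n) ≡ 0
    δ-suc n = ⟦⟧-no (n ≟ suc n) λ ()

    δ-pred : ∀ n → δ (suc n) n ≡ 0
    δ-pred n = ⟦⟧-no (suc n ≟ n) λ ()

  -- The insertions of a new maximum and the removals of the last letter, according to whether
  -- the length of the longest weakly increasing subsequence changes.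
  iₐ iᵦ xₐ xᵦ : (List ℕ → ℕ) → List ℕ → ℕ
  iₐ φ w = ∑ (ins 1 (fresh w) w) λ z → ⟦ av? r z ⟧ * (δ (decreasing z) (suc (decreasing w)) * φ z)
  iᵦ φ w = ∑ (ins 1 (fresh w) w) λ z → ⟦ av? r z ⟧ * (δ (decreasing z) (decreasing w) * φ z)
  xₐ φ []      = 0
  xₐ φ (u ∷ w) = δ (decreasing (u ∷ w)) (suc (decreasing w)) * φ w
  xᵦ φ []      = 0
  xᵦ φ (u ∷ w) = δ (decreasing (u ∷ w)) (decreasing w) * φ w

  ⟦av⟧-≈ : ∀ {w w′} → w ≈ w′ → ⟦ av? r w ⟧ ≡ ⟦ av? r w′ ⟧
  ⟦av⟧-≈ {w} {w′} s = ⟦⟧-cong (av? r w) (av? r w′) (av-≈ s) (av-≈ (≈-sym s))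

  module _ {φ : List ℕ → ℕ} (ρ : Respects φ) where

    weighted : ℕ → List ℕ → ℕ
    weighted n z = ⟦ av? r z ⟧ * (δ (decreasing z) n * φ z)

    weighted-≈ : ∀ n → Respects (weighted n)
    weighted-≈ n s = cong₂ _*_ (⟦av⟧-≈ s) (cong₂ (λ m k → δ m n * k) (decreasing-≈ s) (ρ s))

    iₐ-≈ : Respects (iₐ φ)
    iₐ-≈ {w} {w′} s = trans (∑-ins-≈ (weighted-≈ (suc (decreasing w))) s (<-fresh w) (<-fresh w′))
      (cong (λ n → ∑ (ins 1 (fresh w′) w′) (weighted (suc n))) (decreasing-≈ s))

    iᵦ-≈ : Respects (iᵦ φ)
    iᵦ-≈ {w} {w′} s = trans (∑-ins-≈ (weighted-≈ (decreasing w)) s (<-fresh w) (<-fresh w′))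
      (cong (λ n → ∑ (ins 1 (fresh w′) w′) (weighted n)) (decreasing-≈ s))

    xₐ-≈ : Respects (xₐ φ)
    xₐ-≈ []      = refl
    xₐ-≈ (h ∷ s) = cong₂ _*_ (cong₂ (λ m n → δ m (suc n)) (decreasing-≈ (h ∷ s)) (decreasing-≈ s)) (ρ s)

    xᵦ-≈ : Respects (xᵦ φ)
    xᵦ-≈ []      = refl
    xᵦ-≈ (h ∷ s) = cong₂ _*_ (cong₂ δ (decreasing-≈ (h ∷ s)) (decreasing-≈ s)) (ρ s)

  ins-split : ∀ v y → All (λ z → ∃ λ p → ∃ λ q → y ≡ p ++ q × z ≡ p ++ v ∷ q) (ins 1 v y)
  ins-split v []      = ([] , [] , refl , refl) ∷ []
  ins-split v (x ∷ y) = ([] , x ∷ y , refl , refl)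
    ∷ Allₚ.map⁺ (All.map (λ (p , q , e , e′) → x ∷ p , q , cong (x ∷_) e , cong (x ∷_) e′) (ins-split v y))

  decreasing≤-insert : ∀ {u v} p {q} → u < v → decreasing≤ u (p ++ v ∷ q) ≡ decreasing≤ u (p ++ q)
  decreasing≤-insert [] {q} u<v = decreasing≤-skip q (ℕₚ.<⇒≱ u<v)
  decreasing≤-insert {u} (x ∷ p) u<v with x ≤? u
  ... | yes x≤u = cong₂ (λ m n → suc m ⊔ n) (decreasing≤-insert p (ℕₚ.≤-<-trans x≤u u<v)) (decreasing≤-insert p u<v)
  ... | no _    = decreasing≤-insert p u<v

  -- A subsequence through the new maximum has to begin with it, and any weakly decreasing one of
  -- `q` may follow.
  decreasing-insert : ∀ {v} p {q} → All (_< v) (p ++ q) → decreasing (p ++ v ∷ q) ≡ decreasing (p ++ q) ⊔ suc (decreasing q)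
  decreasing-insert {v} [] {q} q<v =
    trans (cong (λ n → suc n ⊔ decreasing q) (decreasing≤-all v q (All.map ℕₚ.<⇒≤ q<v))) (ℕₚ.⊔-comm (suc (decreasing q)) (decreasing q))
  decreasing-insert {v} (x ∷ p) {q} (x<v ∷ pq<v) =
    trans (cong₂ (λ m n → suc m ⊔ n) (decreasing≤-insert p x<v) (decreasing-insert p pq<v))
          (sym (ℕₚ.⊔-assoc (suc (decreasing≤ x (p ++ q))) (decreasing (p ++ q)) (suc (decreasing q))))

  -- A longest one begins in `p`, hence with a letter of at most `u`, or lies in `q`.
  decreasing-bounded : ∀ u p {q} → All (_≤ u) p → decreasing (p ++ q) ≤ decreasing≤ u (p ++ q) ⊔ decreasing q
  decreasing-bounded u []      {q} []          = ℕₚ.m≤n⊔m (decreasing≤ u q) (decreasing q)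
  decreasing-bounded u (x ∷ p) {q} (x≤u ∷ p≤u) rewrite decreasing≤-∷ (p ++ q) x≤u =
    ℕₚ.≤-trans (ℕₚ.⊔-monoʳ-≤ (suc (decreasing≤ x (p ++ q))) (decreasing-bounded u p p≤u))
               (ℕₚ.≤-reflexive (sym (ℕₚ.⊔-assoc (suc (decreasing≤ x (p ++ q))) (decreasing≤ u (p ++ q)) (decreasing q))))

  decreasing≤-skip-++ : ∀ u p {q} → All (u <_) p → decreasing≤ u (p ++ q) ≡ decreasing≤ u q
  decreasing≤-skip-++ u []      []          = refl
  decreasing≤-skip-++ u (x ∷ p) (u<x ∷ u<p) = trans (decreasing≤-skip (p ++ _) (ℕₚ.<⇒≱ u<x)) (decreasing≤-skip-++ u p u<p)

  ⊔-suc : ∀ {m n} → m ≤ n → n ⊔ suc m ≡ n ⊎ n ⊔ suc m ≡ suc n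
  ⊔-suc {m} {n} m≤n with m ≟ n
  ... | yes refl = inj₂ (ℕₚ.m≤n⇒m⊔n≡n (ℕₚ.n≤1+n n))
  ... | no m≢n   = inj₁ (ℕₚ.m≥n⇒m⊔n≡m (ℕₚ.≤∧≢⇒< m≤n m≢n))

  -- With y = p q a word avoiding 321, adding the last letter u and the maximum v simultaneously
  -- creates a 321 exactly when neither of them alone creates a longer weakly increasing subsequence.
  module _ {u v : ℕ} (p q : List ℕ) (u<v : u < v) (y<v : All (_< v) (p ++ q)) where

    private
      y z : List ℕ
      y = p ++ q
      z = p ++ v ∷ q

    -- Otherwise no letter of `p` exceeds `u`, so a longest subsequence of `y` may be preceded by
    -- `u`, or else lies in `q` and may be preceded by `v`; either way a longer one arises.
    stuck⇒¬av : decreasing (u ∷ y) ≡ decreasing y → decreasing z ≡ decreasing y → ¬ Av r (u ∷ z)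
    stuck⇒¬av e₁ e₂ a = ℕₚ.<-irrefl refl (begin-strict
      decreasing y                            ≤⟨ decreasing-bounded u p p≤u ⟩
      decreasing≤ u y ⊔ decreasing q          <⟨ ℕₚ.n<1+n _ ⟩
      suc (decreasing≤ u y) ⊔ suc (decreasing q)
        ≤⟨ ℕₚ.⊔-lub (ℕₚ.≤-trans (ℕₚ.m≤m⊔n (suc (decreasing≤ u y)) (decreasing y)) (ℕₚ.≤-reflexive e₁))
                    (ℕₚ.≤-trans (ℕₚ.m≤n⊔m (decreasing y) (suc (decreasing q)))
                                (ℕₚ.≤-reflexive (trans (sym (decreasing-insert p y<v)) e₂))) ⟩
      decreasing y                            ∎)
      where
      open ℕₚ.≤-Reasoning
      p≤u : All (_≤ u) p
      p≤u = All.tabulate λ {x} x∈ → ℕₚ.≮⇒≥ λ u<x → a (_ , refl ∷ Subₚ.++⁺ (from∈ x∈) (refl ∷ minimum q)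
        , (so-<⁺ u<x ∷ so-<⁺ u<v ∷ []) ∷ (so-<⁺ (All.lookup (Allₚ.++⁻ˡ p y<v) x∈) ∷ []) ∷ [] ∷ [])

    -- A forbidden occurrence using both `u` and `v` has a letter `b` between them. Since neither
    -- word alone contains one, `b` is at least every later letter of `y` and at most every earlier
    -- one; so `b` can stand in for `u` and for `v`, and neither of them gains length.
    av⇐¬stuck : Av r (u ∷ y) → Av r z → ¬ (decreasing (u ∷ y) ≡ decreasing y × decreasing z ≡ decreasing y) → Av r (u ∷ z)
    av⇐¬stuck au az ¬stuck = av-∷⁺ az new
      where
      new : ∀ {l} → l ⊆ z → ¬ u ∷ l ≅ r
      new {b ∷ c ∷ []} sub e@((s₁ ∷ s₂ ∷ []) ∷ (s₃ ∷ []) ∷ _) = go (c <? v)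
        where
        u<b = so-< s₁
        b<c = so-< s₃
        old : ∀ {l} p {q} → All (_< v) (p ++ q) → l ⊆ p ++ v ∷ q → All (_< v) l → l ⊆ p ++ q
        old [] q<v (_ ∷ʳ sub) l<v = sub
        old [] q<v (refl ∷ sub) (v<v ∷ _) = contradiction v<v (ℕₚ.<-irrefl refl)
        old (x ∷ p) (_ ∷ pq<v) (_ ∷ʳ sub) l<v = x ∷ʳ old p pq<v sub l<v
        old (x ∷ p) (_ ∷ pq<v) (refl ∷ sub) (_ ∷ l<v) = refl ∷ old p pq<v sub l<v
        before-v : ∀ p {q} → All (_< v) (p ++ q) → b ∷ c ∷ [] ⊆ p ++ v ∷ q → ¬ c < v → ∃ λ p₁ → ∃ λ p₂ → p ≡ p₁ ++ b ∷ p₂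
        before-v [] q<v (_ ∷ʳ sub) c≮v = contradiction (All.head (All.tail (Subₚ.All-resp-⊆ sub q<v))) c≮v
        before-v [] q<v (refl ∷ sub) c≮v = contradiction (All.head (Subₚ.All-resp-⊆ sub q<v)) c≮v
        before-v (x ∷ p) (_ ∷ pq<v) (_ ∷ʳ sub) c≮v = let p₁ , p₂ , eq = before-v p pq<v sub c≮v in x ∷ p₁ , p₂ , cong (x ∷_) eq
        before-v (x ∷ p) (_ ∷ pq<v) (refl ∷ sub) c≮v = [] , p , refl
        go : Dec (c < v) → _
        go (yes c<v) = au (_ , refl ∷ old p y<v sub (ℕₚ.<-trans b<c c<v ∷ c<v ∷ []) , e)
        go (no c≮v) with before-v p y<v sub c≮v
        ... | p₁ , p₂ , refl = ¬stuck
          ( ℕₚ.m≤n⇒m⊔n≡n (ℕₚ.≤-trans (ℕ.s≤s (begin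
              decreasing≤ u y                        ≡⟨ cong (decreasing≤ u) (++-assoc p₁ (b ∷ p₂) q) ⟩
              decreasing≤ u (p₁ ++ b ∷ p₂ ++ q)      ≡⟨ decreasing≤-skip-++ u p₁ (All.map (ℕₚ.<-≤-trans u<b) b≤p₁) ⟩
              decreasing≤ u (b ∷ p₂ ++ q)            ≡⟨ decreasing≤-skip (p₂ ++ q) (ℕₚ.<⇒≱ u<b) ⟩
              decreasing≤ u (p₂ ++ q)                ≤⟨ decreasing≤-mono (p₂ ++ q) (ℕₚ.<⇒≤ u<b) ⟩
              decreasing≤ b (p₂ ++ q)                ∎)) through-b)
          , trans (decreasing-insert p y<v) (ℕₚ.m≥n⇒m⊔n≡m (ℕₚ.≤-trans (ℕ.s≤s (begin
              decreasing q             ≤⟨ decreasing-++ʳ p₂ ⟩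
              decreasing (p₂ ++ q)     ≡⟨ sym (decreasing≤-all b (p₂ ++ q) after-b) ⟩
              decreasing≤ b (p₂ ++ q)  ∎)) through-b)))
          where
          open ℕₚ.≤-Reasoning
          b<v : b < v
          b<v = All.head (Allₚ.++⁻ʳ p₁ (Allₚ.++⁻ˡ p y<v))
          b⊆y : b ∷ p₂ ++ q ⊆ y
          b⊆y = subst (b ∷ p₂ ++ q ⊆_) (sym (++-assoc p₁ (b ∷ p₂) q)) (Subₚ.++⁺ˡ p₁ ⊆-refl)
          after-b : All (_≤ b) (p₂ ++ q)
          after-b = All.tabulate λ {x} x∈ → ℕₚ.≮⇒≥ λ b<x → au (_ , refl ∷ ⊆-trans (refl ∷ from∈ x∈) b⊆y
            , (so-<⁺ u<b ∷ so-<⁺ (ℕₚ.<-trans u<b b<x) ∷ []) ∷ (so-<⁺ b<x ∷ []) ∷ [] ∷ [])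
          b≤p₁ : All (b ≤_) p₁
          b≤p₁ = All.tabulate λ {x} x∈ → ℕₚ.≮⇒≥ λ x<b → az (_
            , Subₚ.++⁺ (Subₚ.++⁺ (from∈ x∈) (refl ∷ minimum p₂)) (refl ∷ minimum q)
            , (so-<⁺ x<b ∷ so-<⁺ (ℕₚ.<-trans x<b b<v) ∷ []) ∷ (so-<⁺ b<v ∷ []) ∷ [] ∷ [])
          through-b : suc (decreasing≤ b (p₂ ++ q)) ≤ decreasing y
          through-b = ℕₚ.≤-trans (ℕₚ.m≤m⊔n _ (decreasing (p₂ ++ q)))
            (ℕₚ.≤-trans (decreasing-++ʳ p₁) (ℕₚ.≤-reflexive (cong decreasing (sym (++-assoc p₁ (b ∷ p₂) q)))))

    -- The letter `u` precedes `v` in the list and is smaller, so no weakly decreasing subsequence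
    -- contains both.
    decreasing-both : decreasing (u ∷ z) ≡ decreasing (u ∷ y) ⊔ decreasing z
    decreasing-both = trans (cong (λ n → suc n ⊔ decreasing z) (decreasing≤-insert p u<v))
      (begin-equality
        suc (decreasing≤ u y) ⊔ decreasing z                  ≡⟨ cong (suc (decreasing≤ u y) ⊔_) (sym (ℕₚ.m≤n⇒m⊔n≡n y≤z)) ⟩
        suc (decreasing≤ u y) ⊔ (decreasing y ⊔ decreasing z) ≡⟨ sym (ℕₚ.⊔-assoc (suc (decreasing≤ u y)) (decreasing y) (decreasing z)) ⟩
        decreasing (u ∷ y) ⊔ decreasing z                     ∎)
      where
      open ℕₚ.≤-Reasoning
      y≤z : decreasing y ≤ decreasing z
      y≤z = ℕₚ.≤-trans (ℕₚ.m≤m⊔n (decreasing y) (suc (decreasing q))) (ℕₚ.≤-reflexive (sym (decreasing-insert p y<v)))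

    step-z : decreasing z ≡ decreasing y ⊎ decreasing z ≡ suc (decreasing y)
    step-z with ⊔-suc (decreasing-++ʳ p)
    ... | inj₁ e = inj₁ (trans (decreasing-insert p y<v) e)
    ... | inj₂ e = inj₂ (trans (decreasing-insert p y<v) e)

  step-∷ : ∀ u y → decreasing (u ∷ y) ≡ decreasing y ⊎ decreasing (u ∷ y) ≡ suc (decreasing y)
  step-∷ u y with ⊔-suc (decreasing≤-≤ u y)
  ... | inj₁ e = inj₁ (trans (ℕₚ.⊔-comm (suc (decreasing≤ u y)) (decreasing y)) e)
  ... | inj₂ e = inj₂ (trans (ℕₚ.⊔-comm (suc (decreasing≤ u y)) (decreasing y)) e)


  -- A, L, Z, N are the lengths for y, for y with the last letter u, with the maximum v, with both;
  -- a and b indicate whether y with v and y with both avoid 321.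
  data Lengths (A a : ℕ) : (L Z N b : ℕ) → Set where
    none : Lengths A a A A A 0
    max  : Lengths A a A (suc A) (suc A) a
    last : Lengths A a (suc A) A (suc A) a
    each : Lengths A a (suc A) (suc A) (suc A) a

  module _ {A a : ℕ} (f : ℕ) where

    -- In the four names the first letter is the row gained by the insertion and the second the row
    -- lost by the removal following it.
    lengths-aa : ∀ {L Z N b} → Lengths A a L Z N b → b * (δ N (suc L) * (δ N (suc Z) * f)) ≡ 0
    lengths-aa none = refl
    lengths-aa max  rewrite δ-suc (suc A) | ℕₚ.*-zeroʳ (δ (suc A) (suc A)) = ℕₚ.*-zeroʳ a
    lengths-aa last rewrite δ-suc (suc A) = ℕₚ.*-zeroʳ a
    lengths-aa each rewrite δ-suc (suc A) = ℕₚ.*-zeroʳ a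

    lengths-bb : ∀ {L Z N b} → Lengths A a L Z N b →
                 b * (δ N L * (δ N Z * f)) ≡ δ L (suc A) * (a * (δ Z (suc A) * f))
    lengths-bb none rewrite δ-suc A = refl
    lengths-bb max  rewrite δ-suc A | δ-pred A = ℕₚ.*-zeroʳ a
    lengths-bb last rewrite δ-suc A | δ-pred A | δ-≡ (suc A) =
      trans (ℕₚ.*-zeroʳ a) (sym (trans (ℕₚ.+-identityʳ _) (ℕₚ.*-zeroʳ a)))
    lengths-bb each rewrite δ-≡ (suc A) = sym (trans (ℕₚ.+-identityʳ _) (cong (a *_) (sym (ℕₚ.+-identityʳ (f + 0)))))

    lengths-ab : ∀ {L Z N b} → Lengths A a L Z N b →
                 b * (δ N (suc L) * (δ N Z * f)) ≡ δ L A * (a * (δ Z (suc A) * f))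
    lengths-ab none rewrite δ-suc A | δ-≡ A = sym (trans (ℕₚ.+-identityʳ _) (ℕₚ.*-zeroʳ a))
    lengths-ab max  rewrite δ-≡ A | δ-≡ (suc A) = sym (trans (ℕₚ.+-identityʳ _) (cong (a *_) (sym (ℕₚ.+-identityʳ (f + 0)))))
    lengths-ab last rewrite δ-pred A | δ-suc (suc A) = ℕₚ.*-zeroʳ a
    lengths-ab each rewrite δ-pred A | δ-suc (suc A) = ℕₚ.*-zeroʳ a

    lengths-ba : ∀ {L Z N b} → Lengths A a L Z N b →
                 b * (δ N L * (δ N (suc Z) * f)) ≡ δ L (suc A) * (a * (δ Z A * f))
    lengths-ba none rewrite δ-suc A = refl
    lengths-ba max  rewrite δ-suc A | δ-pred A = ℕₚ.*-zeroʳ a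
    lengths-ba last rewrite δ-≡ (suc A) | δ-≡ A = sym (trans (ℕₚ.+-identityʳ _) (cong (a *_) (sym (ℕₚ.+-identityʳ (f + 0)))))
    lengths-ba each rewrite δ-≡ (suc A) | δ-suc (suc A) | δ-pred A =
      trans (ℕₚ.*-zeroʳ a) (sym (trans (ℕₚ.+-identityʳ _) (ℕₚ.*-zeroʳ a)))

  lengths : ∀ {A a L Z N b} → L ≡ A ⊎ L ≡ suc A → Z ≡ A ⊎ Z ≡ suc A → N ≡ L ⊔ Z →
            (L ≡ A × Z ≡ A → b ≡ 0) → (¬ (L ≡ A × Z ≡ A) → b ≡ a) → Lengths A a L Z N b
  lengths {A} (inj₁ refl) (inj₁ refl) eq b≡0 b≡a rewrite eq | ℕₚ.⊔-idem A | b≡0 (refl , refl) = none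
  lengths {A} (inj₁ refl) (inj₂ refl) eq b≡0 b≡a
    rewrite eq | ℕₚ.m≤n⇒m⊔n≡n (ℕₚ.n≤1+n A) | b≡a (λ ()) = max
  lengths {A} (inj₂ refl) (inj₁ refl) eq b≡0 b≡a
    rewrite eq | ℕₚ.m≥n⇒m⊔n≡m (ℕₚ.n≤1+n A) | b≡a (λ ()) = last
  lengths {A} (inj₂ refl) (inj₂ refl) eq b≡0 b≡a
    rewrite eq | ℕₚ.⊔-idem A | b≡a (λ ()) = each

  ins-lengths : ∀ {u v y} → u < v → All (_< v) y → Av r (u ∷ y) →
    All (λ z → Lengths (decreasing y) ⟦ av? r z ⟧ (decreasing (u ∷ y)) (decreasing z) (decreasing (u ∷ z)) ⟦ av? r (u ∷ z) ⟧)
        (ins 1 v y)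
  ins-lengths {u} {v} {y} u<v y<v a = All.map (λ { (p , q , refl , refl) → go p q y<v a }) (ins-split v y)
    where
    go : ∀ p q → All (_< v) (p ++ q) → Av r (u ∷ p ++ q) →
      Lengths (decreasing (p ++ q)) ⟦ av? r (p ++ v ∷ q) ⟧ (decreasing (u ∷ p ++ q)) (decreasing (p ++ v ∷ q))
              (decreasing (u ∷ p ++ v ∷ q)) ⟦ av? r (u ∷ p ++ v ∷ q) ⟧
    go p q y<v a = lengths (step-∷ u (p ++ q)) (step-z p q u<v y<v) (decreasing-both p q u<v y<v)
      (λ (e₁ , e₂) → ⟦⟧-no (av? r (u ∷ p ++ v ∷ q)) (stuck⇒¬av p q u<v y<v e₁ e₂))
      (λ ¬stuck → av-swap {z = u ∷ p ++ v ∷ q} {p ++ v ∷ q} av-∷⁻ λ az → av⇐¬stuck p q u<v y<v a az ¬stuck)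

  av-top : ∀ {v w} → All (_≤ v) w → Av r w → Av r (v ∷ w)
  av-top w≤v a = av-∷⁺ a λ
    { {b ∷ c ∷ []} sub ((so ∷ _ ∷ []) ∷ _) → ℕₚ.<⇒≱ (so-< so) (All.head (Subₚ.All-resp-⊆ sub w≤v)) }

  decreasing-top : ∀ {v} w → All (_≤ v) w → decreasing (v ∷ w) ≡ suc (decreasing w)
  decreasing-top {v} w w≤v = trans (cong (λ n → suc n ⊔ decreasing w) (decreasing≤-all v w w≤v))
                                   (ℕₚ.m≥n⇒m⊔n≡m (ℕₚ.n≤1+n (decreasing w)))

  -- The relations between adding and removing boxes in the two rows of a partition.
  module _ {φ : List ℕ → ℕ} (ρ : Respects φ) where

    private
      old-fresh : ∀ {n} u y → ∑ (ins 1 (fresh (u ∷ y)) y) (weighted ρ n) ≡ ∑ (ins 1 (fresh y) y) (weighted ρ n)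
      old-fresh {n} u y = ∑-ins-≈ (weighted-≈ ρ n) (≈-refl y) (All.tail (<-fresh (u ∷ y))) (<-fresh y)

      pull : ∀ c {n} u y → ∑ (ins 1 (fresh (u ∷ y)) y) (λ z → c * weighted ρ n z) ≡ c * ∑ (ins 1 (fresh y) y) (weighted ρ n)
      pull c u y = trans (∑-*ˡ c (ins 1 (fresh (u ∷ y)) y) _) (cong (c *_) (old-fresh u y))

      new-top : ∀ w → let v = fresh w in ∀ {m n k} → δ (decreasing (v ∷ w)) m ≡ k → Av r w →
        ⟦ av? r (v ∷ w) ⟧ * (δ (decreasing (v ∷ w)) m * n) + 0 ≡ k * n
      new-top w {m} {n} eq a = trans (ℕₚ.+-identityʳ _)
        (trans (cong₂ (λ b c → b * (c * n)) (⟦⟧-yes (av? r (fresh w ∷ w)) (av-top (All.map ℕₚ.<⇒≤ (<-fresh w)) a)) eq)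
               (ℕₚ.*-identityˡ _))

      top-length : ∀ w → decreasing (fresh w ∷ w) ≡ suc (decreasing w)
      top-length w = decreasing-top w (All.map ℕₚ.<⇒≤ (<-fresh w))

      grows : ∀ w → δ (decreasing (fresh w ∷ w)) (suc (decreasing w)) ≡ 1
      grows w = trans (cong (λ n → δ n (suc (decreasing w))) (top-length w)) (δ-≡ (suc (decreasing w)))

      ¬stays : ∀ w → δ (decreasing (fresh w ∷ w)) (decreasing w) ≡ 0
      ¬stays w = trans (cong (λ n → δ n (decreasing w)) (top-length w)) (δ-pred (decreasing w))

    -- Only the maximum at the front, which the removal takes away again, contributes; all other
    -- insertions cancel by `lengths-aa`.
    iₐ-xₐ : ∀ w → Av r w → iₐ (xₐ φ) w ≡ φ w
    iₐ-xₐ [] a = trans (∑-ins-[] 0 0 (λ z → ⟦ av? r z ⟧ * (δ (decreasing z) 1 * xₐ φ z)))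
      (trans (new-top [] (grows []) a) (trans (ℕₚ.*-identityˡ _) (trans (cong (_* φ []) (grows [])) (ℕₚ.*-identityˡ _))))
    iₐ-xₐ (u ∷ y) a = trans (∑-ins-∷ 0 (fresh (u ∷ y)) u y (λ z → ⟦ av? r z ⟧ * (δ (decreasing z) (suc (decreasing (u ∷ y))) * xₐ φ z)))
      (trans (cong₂ _+_ (trans (new-top (u ∷ y) (grows (u ∷ y)) a)
                               (trans (ℕₚ.*-identityˡ _) (trans (cong (_* φ (u ∷ y)) (grows (u ∷ y))) (ℕₚ.*-identityˡ _))))
                        (∑-vanish (ins 1 (fresh (u ∷ y)) y) (All.map (λ {z} l → lengths-aa (φ z) l)
                          (ins-lengths (All.head (<-fresh (u ∷ y))) (All.tail (<-fresh (u ∷ y))) a))))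
             (ℕₚ.+-identityʳ (φ (u ∷ y))))

    iᵦ-xᵦ : ∀ w → Av r w → iᵦ (xᵦ φ) w ≡ xₐ (iₐ φ) w
    iᵦ-xᵦ [] a = trans (∑-ins-[] 0 0 (λ z → ⟦ av? r z ⟧ * (δ (decreasing z) 0 * xᵦ φ z))) (new-top [] (¬stays []) a)
    iᵦ-xᵦ (u ∷ y) a = trans (∑-ins-∷ 0 (fresh (u ∷ y)) u y (λ z → ⟦ av? r z ⟧ * (δ (decreasing z) (decreasing (u ∷ y)) * xᵦ φ z)))
      (cong₂ _+_ (new-top (u ∷ y) (¬stays (u ∷ y)) a)
        (trans (∑-cong-All (ins 1 (fresh (u ∷ y)) y) (All.map (λ {z} l → lengths-bb (φ z) l)
                 (ins-lengths (All.head (<-fresh (u ∷ y))) (All.tail (<-fresh (u ∷ y))) a)))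
               (pull (δ (decreasing (u ∷ y)) (suc (decreasing y))) u y)))

    iₐ-xᵦ : ∀ w → Av r w → iₐ (xᵦ φ) w ≡ xᵦ (iₐ φ) w
    iₐ-xᵦ [] a = trans (∑-ins-[] 0 0 (λ z → ⟦ av? r z ⟧ * (δ (decreasing z) 1 * xᵦ φ z)))
      (trans (new-top [] (grows []) a) (trans (ℕₚ.*-identityˡ _) (cong (_* φ []) (¬stays []))))
    iₐ-xᵦ (u ∷ y) a = trans (∑-ins-∷ 0 (fresh (u ∷ y)) u y (λ z → ⟦ av? r z ⟧ * (δ (decreasing z) (suc (decreasing (u ∷ y))) * xᵦ φ z)))
      (cong₂ _+_ (trans (new-top (u ∷ y) (grows (u ∷ y)) a) (trans (ℕₚ.*-identityˡ _) (cong (_* φ (u ∷ y)) (¬stays (u ∷ y)))))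
        (trans (∑-cong-All (ins 1 (fresh (u ∷ y)) y) (All.map (λ {z} l → lengths-ab (φ z) l)
                 (ins-lengths (All.head (<-fresh (u ∷ y))) (All.tail (<-fresh (u ∷ y))) a)))
               (pull (δ (decreasing (u ∷ y)) (decreasing y)) u y)))

    iᵦ-xₐ : ∀ w → Av r w → iᵦ (xₐ φ) w ≡ xₐ (iᵦ φ) w
    iᵦ-xₐ [] a = trans (∑-ins-[] 0 0 (λ z → ⟦ av? r z ⟧ * (δ (decreasing z) 0 * xₐ φ z))) (new-top [] (¬stays []) a)
    iᵦ-xₐ (u ∷ y) a = trans (∑-ins-∷ 0 (fresh (u ∷ y)) u y (λ z → ⟦ av? r z ⟧ * (δ (decreasing z) (decreasing (u ∷ y)) * xₐ φ z)))
      (cong₂ _+_ (new-top (u ∷ y) (¬stays (u ∷ y)) a)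
        (trans (∑-cong-All (ins 1 (fresh (u ∷ y)) y) (All.map (λ {z} l → lengths-ba (φ z) l)
                 (ins-lengths (All.head (<-fresh (u ∷ y))) (All.tail (<-fresh (u ∷ y))) a)))
               (pull (δ (decreasing (u ∷ y)) (suc (decreasing y))) u y)))

  private
    split-at : ∀ {v : ℕ} p {q} s {t} → p ++ v ∷ q ≡ s ++ t →
      (∃ λ p₂ → p ≡ s ++ p₂ × t ≡ p₂ ++ v ∷ q) ⊎ (∃ λ q₁ → s ≡ p ++ v ∷ q₁ × q ≡ q₁ ++ t)
    split-at p       []      refl = inj₁ (p , refl , refl)
    split-at []      (_ ∷ s) refl = inj₂ (s , refl , refl)
    split-at (x ∷ p) (y ∷ s) eq with ∷-injective eq
    ... | refl , eq′ with split-at p s eq′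
    ...   | inj₁ (p₂ , e , e′) = inj₁ (p₂ , cong (x ∷_) e , e′)
    ...   | inj₂ (q₁ , e , e′) = inj₂ (q₁ , cong (x ∷_) e , e′)

  module _ (v : ℕ) where

    before : List ℕ → ℕ
    before []      = 0
    before (x ∷ z) with x ≟ suc v | x ≟ v
    ... | yes _ | _     = 1
    ... | no _  | yes _ = 0
    ... | no _  | no _  = before z

    before-old : ∀ {x} z → x < v → before (x ∷ z) ≡ before z
    before-old {x} z x<v with x ≟ suc v | x ≟ v
    ... | yes refl | _        = contradiction (ℕₚ.m<n⇒m<1+n x<v) (ℕₚ.<-irrefl refl)
    ... | no _     | yes refl = contradiction x<v (ℕₚ.<-irrefl refl)
    ... | no _     | no _     = refl

    before-suc : ∀ s {t} → All (_< v) s → before (s ++ suc v ∷ t) ≡ 1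
    before-suc [] [] with suc v ≟ suc v
    ... | yes _ = refl
    ... | no ne = contradiction refl ne
    before-suc (x ∷ s) (x<v ∷ s<v) = trans (before-old _ x<v) (before-suc s s<v)

    before-v : ∀ s {t} → All (_< v) s → before (s ++ v ∷ t) ≡ 0
    before-v [] [] with v ≟ suc v | v ≟ v
    ... | yes () | _
    ... | no _   | yes _ = refl
    ... | no _   | no ne = contradiction refl ne
    before-v (x ∷ s) (x<v ∷ s<v) = trans (before-old _ x<v) (before-v s s<v)

    -- Two equal maxima can be told apart, provided that the right one (in the word) is larger.
    ∑-ins-2 : ∀ w (g : List ℕ → ℕ) → All (_< v) w →
      (∀ p {l} → All (_< v) p → All (_≤ v) l → g (p ++ suc v ∷ l) ≡ g (p ++ v ∷ l)) →
      ∑ (ins 1 v w) (λ z₁ → ∑ (ins 1 (suc v) z₁) λ z₂ → before z₂ * g z₂) ≡ ∑ (ins 2 v w) g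
    ∑-ins-2 [] g [] same = trans (ℕₚ.+-identityʳ _)
      (trans (cong₂ _+_ (trans (cong (_* g (suc v ∷ v ∷ [])) (before-suc [] []))
                               (trans (ℕₚ.*-identityˡ _) (same [] [] (ℕₚ.≤-refl ∷ []))))
                        (trans (ℕₚ.+-identityʳ _) (cong (_* g (v ∷ suc v ∷ [])) (before-v [] [])))) refl)
    ∑-ins-2 (x ∷ w) g (x<v ∷ w<v) same = begin
      ∑ (ins 1 v (x ∷ w)) (λ z₁ → ∑ (ins 1 (suc v) z₁) h)
        ≡⟨ ∑-ins-∷ 0 v x w (λ z₁ → ∑ (ins 1 (suc v) z₁) h) ⟩
      ∑ (ins 1 (suc v) (v ∷ x ∷ w)) h + 0 + ∑ (ins 1 v w) (λ z₁ → ∑ (ins 1 (suc v) (x ∷ z₁)) h)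
        ≡⟨ cong₂ _+_ (trans (ℕₚ.+-identityʳ _) (trans (∑-ins-∷ 0 (suc v) v (x ∷ w) h)
             (cong₂ _+_ (trans (ℕₚ.+-identityʳ _) (new (v ∷ x ∷ w) (ℕₚ.≤-refl ∷ ℕₚ.<⇒≤ x<v ∷ All.map ℕₚ.<⇒≤ w<v)))
               (∑-vanish (ins 1 (suc v) (x ∷ w)) (All.universal (λ z → cong (_* g (v ∷ z)) (before-v [] [])) _)))))
             (trans (∑-cong (ins 1 v w) λ z₁ → ∑-ins-∷ 0 (suc v) x z₁ h) (∑-+ (ins 1 v w) _ _)) ⟩
      g (v ∷ v ∷ x ∷ w) + 0 + (∑ (ins 1 v w) (λ z₁ → h (suc v ∷ x ∷ z₁) + 0) +
                               ∑ (ins 1 v w) (λ z₁ → ∑ (ins 1 (suc v) z₁) (h ∘ (x ∷_))))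
        ≡⟨ cong₂ (λ m n → g (v ∷ v ∷ x ∷ w) + 0 + (m + n))
             (∑-ins-cong 1 w w<v λ {z₁} i → trans (ℕₚ.+-identityʳ _) (new (x ∷ z₁) (ℕₚ.<⇒≤ x<v ∷ Inserted.bound i)))
             (trans (∑-cong (ins 1 v w) λ z₁ → ∑-cong (ins 1 (suc v) z₁) λ z₂ → cong (_* g (x ∷ z₂)) (before-old z₂ x<v))
                    (∑-ins-2 w (g ∘ (x ∷_)) w<v λ p p<v → same (x ∷ p) (x<v ∷ p<v))) ⟩
      g (v ∷ v ∷ x ∷ w) + 0 + (∑ (ins 1 v w) (λ z₁ → g (v ∷ x ∷ z₁)) + ∑ (ins 2 v w) (g ∘ (x ∷_)))
        ≡⟨ sym (ℕₚ.+-assoc (g (v ∷ v ∷ x ∷ w) + 0) _ _) ⟩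
      g (v ∷ v ∷ x ∷ w) + 0 + ∑ (ins 1 v w) (λ z₁ → g (v ∷ x ∷ z₁)) + ∑ (ins 2 v w) (g ∘ (x ∷_))
        ≡⟨ cong (_+ ∑ (ins 2 v w) (g ∘ (x ∷_))) (sym (∑-ins-∷ 0 v x w (g ∘ (v ∷_)))) ⟩
      ∑ (ins 1 v (x ∷ w)) (g ∘ (v ∷_)) + ∑ (ins 2 v w) (g ∘ (x ∷_))
        ≡⟨ sym (∑-ins-∷ 1 v x w g) ⟩
      ∑ (ins 2 v (x ∷ w)) g
        ∎
      where
      open ≡-Reasoning
      h : List ℕ → ℕ
      h z = before z * g z
      new : ∀ l → All (_≤ v) l → h (suc v ∷ l) ≡ g (v ∷ l)
      new l l≤v = trans (cong (_* g (suc v ∷ l)) (before-suc [] [])) (trans (ℕₚ.*-identityˡ _) (same [] [] l≤v))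

  module _ {φ : List ℕ → ℕ} (ρ : Respects φ) {v : ℕ} where

    private
      ≈-rename : ∀ p {l} → All (_< v) p → All (_≤ v) l → p ++ suc v ∷ l ≈ p ++ v ∷ l
      ≈-rename []      []          l≤v = ≈-top (≈-refl _) (All.map ℕₚ.m≤n⇒m≤1+n l≤v) l≤v
      ≈-rename (x ∷ p) {l} (x<v ∷ p<v) l≤v = go p ∷ ≈-rename p p<v l≤v
        where
        go : ∀ p → Pointwise (λ y y′ → x < y ⇔ x < y′) (p ++ suc v ∷ l) (p ++ v ∷ l)
        go []      = ⇔-true (ℕₚ.m<n⇒m<1+n x<v) x<v ∷ Pw.refl ⇔-refl
        go (_ ∷ p) = ⇔-refl ∷ go p

      -- Three of the four ways in which two insertions can gain boxes. Missing is the first row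
      -- followed by the second, which does not fill a horizontal strip from left to right.
      choices : (A L N f : ℕ) → ℕ
      choices A L N f = δ L A * (δ N L * f) + δ L A * (δ N (suc L) * f) + δ L (suc A) * (δ N (suc L) * f)

      choices-1 : ∀ A {L N} f → (L ≡ A × (N ≡ L ⊎ N ≡ suc L)) ⊎ (L ≡ suc A × N ≡ suc L) → choices A L N f ≡ f
      choices-1 A f (inj₁ (refl , inj₁ refl)) rewrite δ-≡ A | δ-suc A = unit f
        where
        unit : ∀ f → 1 * (1 * f) + 1 * (0 * f) + 0 * (0 * f) ≡ f
        unit = solve-∀
      choices-1 A f (inj₁ (refl , inj₂ refl)) rewrite δ-≡ A | δ-suc A | δ-pred A | δ-≡ (suc A) = unit f
        where
        unit : ∀ f → 1 * (0 * f) + 1 * (1 * f) + 0 * (1 * f) ≡ f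
        unit = solve-∀
      choices-1 A f (inj₂ (refl , refl)) rewrite δ-pred A | δ-≡ (suc A) | δ-≡ (suc (suc A)) = unit f
        where
        unit : ∀ f → 0 * (δ (suc (suc A)) (suc A) * f) + 0 * (1 * f) + 1 * (1 * f) ≡ f
        unit f = trans (ℕₚ.*-identityˡ _) (ℕₚ.*-identityˡ f)

      choices-0 : ∀ A {L N} f → L ≡ suc A → N ≡ L → choices A L N f ≡ 0
      choices-0 A f refl refl rewrite δ-pred A | δ-suc (suc A) = ℕₚ.*-zeroʳ (δ (suc A) (suc A))

      -- The lengths after inserting v into p q and then suc v into p v q = s t.
      coefficient : ∀ p q s t f → p ++ v ∷ q ≡ s ++ t → All (_< v) (p ++ q) → Av r (s ++ suc v ∷ t) →
        choices (decreasing (p ++ q)) (decreasing (p ++ v ∷ q)) (decreasing (s ++ suc v ∷ t)) f ≡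
        before v (s ++ suc v ∷ t) * f
      coefficient p q s t f eq w<v a with split-at p s eq
      ... | inj₁ (p₂ , refl , refl) =
        trans (choices-1 (decreasing ((s ++ p₂) ++ q)) f (go (step-insert (s ++ p₂) w<v) (step-insert s z<)))
              (sym (trans (cong (_* f) (before-suc v s {p₂ ++ v ∷ q} (Allₚ.++⁻ˡ s (Allₚ.++⁻ˡ (s ++ p₂) w<v)))) (ℕₚ.*-identityˡ f)))
        where
        A = decreasing ((s ++ p₂) ++ q)
        L = decreasing ((s ++ p₂) ++ v ∷ q)
        L′ = decreasing (s ++ p₂ ++ v ∷ q)
        N = decreasing (s ++ suc v ∷ p₂ ++ v ∷ q)
        L≡L′ : L ≡ L′
        L≡L′ = cong decreasing (++-assoc s p₂ (v ∷ q))
        z< : All (_< suc v) (s ++ p₂ ++ v ∷ q)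
        z< = subst (All (_< suc v)) (++-assoc s p₂ (v ∷ q))
          (Allₚ.++⁺ (All.map ℕₚ.m<n⇒m<1+n (Allₚ.++⁻ˡ (s ++ p₂) w<v))
                    (ℕₚ.n<1+n v ∷ All.map ℕₚ.m<n⇒m<1+n (Allₚ.++⁻ʳ (s ++ p₂) w<v)))
        step-insert : ∀ {x} p {q} → All (_< x) (p ++ q) →
          decreasing (p ++ x ∷ q) ≡ decreasing (p ++ q) ⊎ decreasing (p ++ x ∷ q) ≡ suc (decreasing (p ++ q))
        step-insert p pq< rewrite decreasing-insert p pq< = ⊔-suc (decreasing-++ʳ p)
        -- If `v` gains length, a longest subsequence starts with it, and the larger letter in front
        -- of it gains once more.
        grows : L ≡ suc A → L < N
        grows L≡ = begin-strict
          L                              ≡⟨ trans L≡ (sym (top (ℕₚ.⊔-sel A (suc (decreasing q))))) ⟩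
          suc (decreasing q)             ≡⟨ sym (decreasing-top q (All.map ℕₚ.<⇒≤ (Allₚ.++⁻ʳ (s ++ p₂) w<v))) ⟩
          decreasing (v ∷ q)             ≤⟨ decreasing-++ʳ p₂ ⟩
          decreasing (p₂ ++ v ∷ q)       <⟨ ℕₚ.m≤n⊔m L′ (suc (decreasing (p₂ ++ v ∷ q))) ⟩
          L′ ⊔ suc (decreasing (p₂ ++ v ∷ q)) ≡⟨ sym (decreasing-insert s z<) ⟩
          N                              ∎
          where
          open ℕₚ.≤-Reasoning
          top : A ⊔ suc (decreasing q) ≡ A ⊎ A ⊔ suc (decreasing q) ≡ suc (decreasing q) → suc (decreasing q) ≡ suc A
          top (inj₁ e) = contradiction (trans (sym L≡) (trans (decreasing-insert (s ++ p₂) w<v) e)) ℕₚ.1+n≢n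
          top (inj₂ e) = trans (sym e) (trans (sym (decreasing-insert (s ++ p₂) w<v)) L≡)
        go : L ≡ A ⊎ L ≡ suc A → N ≡ L′ ⊎ N ≡ suc L′ → (L ≡ A × (N ≡ L ⊎ N ≡ suc L)) ⊎ (L ≡ suc A × N ≡ suc L)
        go (inj₁ e) n         = inj₁ (e , subst (λ l → N ≡ l ⊎ N ≡ suc l) (sym L≡L′) n)
        go (inj₂ e) (inj₁ e′) = contradiction (grows e) (ℕₚ.<-irrefl (trans L≡L′ (sym e′)))
        go (inj₂ e) (inj₂ e′) = inj₂ (e , trans e′ (cong suc (sym L≡L′)))
      -- Now `suc v` stands behind `v`. With `v` at the front the first insertion gains length and
      -- the second does not: the missing case of `choices`.
      coefficient [] q .(v ∷ q₁) t f eq w<v a | inj₂ (q₁ , refl , refl) =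
        trans (choices-0 (decreasing (q₁ ++ t)) f (decreasing-top (q₁ ++ t) w≤v)
                (trans (decreasing-insert (v ∷ q₁) (ℕₚ.n<1+n v ∷ All.map ℕₚ.m<n⇒m<1+n w<v))
                       (ℕₚ.m≥n⇒m⊔n≡m (ℕₚ.≤-trans (ℕ.s≤s (decreasing-++ʳ q₁)) (ℕₚ.≤-reflexive (sym (decreasing-top (q₁ ++ t) w≤v)))))))
              (sym (cong (_* f) (before-v v [] {q₁ ++ suc v ∷ t} [])))
        where
        w≤v = All.map ℕₚ.<⇒≤ w<v
      -- A letter in front of `v` would form the reversed 321 with `v` and `suc v`.
      coefficient (x ∷ p) q s t f eq (x<v ∷ w<v) a | inj₂ (q₁ , refl , refl) = contradiction
        (_ , Subₚ.++⁺ (refl ∷ Subₚ.++⁺ˡ p (refl ∷ minimum q₁)) (refl ∷ minimum t)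
           , (so-<⁺ x<v ∷ so-<⁺ (ℕₚ.m<n⇒m<1+n x<v) ∷ []) ∷ (so-<⁺ (ℕₚ.n<1+n v) ∷ []) ∷ [] ∷ []) a

    insert-1 : ∀ w → All (_< v) w → ∑ (ins 1 v w) (λ z → ⟦ av? r z ⟧ * φ z) ≡ iₐ φ w + iᵦ φ w
    insert-1 w w<v = trans (∑-ins-≈ {λ z → ⟦ av? r z ⟧ * φ z} (λ s → cong₂ _*_ (⟦av⟧-≈ s) (ρ s)) (≈-refl w) w<v (<-fresh w))
      (trans (∑-cong-All (ins 1 (fresh w) w) (All.map (λ { {z} (p , q , refl , refl) → term p q (<-fresh (p ++ q)) }) (ins-split (fresh w) w)))
             (∑-+ (ins 1 (fresh w) w) _ _))
      where
      term : ∀ p q {x} → All (_< x) (p ++ q) → ⟦ av? r (p ++ x ∷ q) ⟧ * φ (p ++ x ∷ q) ≡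
        ⟦ av? r (p ++ x ∷ q) ⟧ * (δ (decreasing (p ++ x ∷ q)) (suc (decreasing (p ++ q))) * φ (p ++ x ∷ q)) +
        ⟦ av? r (p ++ x ∷ q) ⟧ * (δ (decreasing (p ++ x ∷ q)) (decreasing (p ++ q)) * φ (p ++ x ∷ q))
      term p q {x} pq<x rewrite decreasing-insert p pq<x with ⊔-suc (decreasing-++ʳ p {q})
      ... | inj₁ e rewrite e | δ-suc (decreasing (p ++ q)) | δ-≡ (decreasing (p ++ q)) = unit ⟦ av? r (p ++ x ∷ q) ⟧ (φ (p ++ x ∷ q))
        where
        unit : ∀ a f → a * f ≡ a * (0 * f) + a * (1 * f)
        unit = solve-∀
      ... | inj₂ e rewrite e | δ-pred (decreasing (p ++ q)) | δ-≡ (suc (decreasing (p ++ q))) = unit ⟦ av? r (p ++ x ∷ q) ⟧ (φ (p ++ x ∷ q))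
        where
        unit : ∀ a f → a * f ≡ a * (1 * f) + a * (0 * f)
        unit = solve-∀

    insert-2 : ∀ w → All (_< v) w → ∑ (ins 2 v w) (λ z → ⟦ av? r z ⟧ * φ z) ≡ iᵦ (iᵦ φ) w + iᵦ (iₐ φ) w + iₐ (iₐ φ) w
    insert-2 w w<v = sym (begin
      iᵦ (iᵦ φ) w + iᵦ (iₐ φ) w + iₐ (iₐ φ) w
        ≡⟨ cong₂ _+_ (cong₂ _+_ (outer (iᵦ-≈ ρ) A) (outer (iₐ-≈ ρ) A)) (outer (iₐ-≈ ρ) (suc A)) ⟩
      ∑ (ins 1 v w) (weighted (iᵦ-≈ ρ) A) + ∑ (ins 1 v w) (weighted (iₐ-≈ ρ) A) + ∑ (ins 1 v w) (weighted (iₐ-≈ ρ) (suc A))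
        ≡⟨ sym (trans (∑-+ (ins 1 v w) _ _) (cong (_+ ∑ (ins 1 v w) (weighted (iₐ-≈ ρ) (suc A))) (∑-+ (ins 1 v w) _ _))) ⟩
      ∑ (ins 1 v w) (λ z₁ → weighted (iᵦ-≈ ρ) A z₁ + weighted (iₐ-≈ ρ) A z₁ + weighted (iₐ-≈ ρ) (suc A) z₁)
        ≡⟨ ∑-ins-cong 1 w w<v (λ {z₁} i → trans (inner z₁ (All.map ℕ.s≤s (Inserted.bound i))) refl) ⟩
      ∑ (ins 1 v w) (λ z₁ → ∑ (ins 1 (suc v) z₁) λ z₂ →
        ⟦ av? r z₁ ⟧ * (⟦ av? r z₂ ⟧ * choices A (decreasing z₁) (decreasing z₂) (φ z₂)))
        ≡⟨ ∑-cong-All (ins 1 v w) (All.map (λ { (p , q , refl , refl) →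
             ∑-cong-All (ins 1 (suc v) (p ++ v ∷ q)) (All.map (λ { (s , t , eq , refl) → term p q s t eq w<v })
                                                              (ins-split (suc v) (p ++ v ∷ q))) }) (ins-split v w)) ⟩
      ∑ (ins 1 v w) (λ z₁ → ∑ (ins 1 (suc v) z₁) λ z₂ → before v z₂ * (⟦ av? r z₂ ⟧ * φ z₂))
        ≡⟨ ∑-ins-2 v w (λ z → ⟦ av? r z ⟧ * φ z) w<v
             (λ p p<v l≤v → let s = ≈-rename p p<v l≤v in cong₂ _*_ (⟦av⟧-≈ s) (ρ s)) ⟩
      ∑ (ins 2 v w) (λ z → ⟦ av? r z ⟧ * φ z)
        ∎)
      where
      open ≡-Reasoning
      A = decreasing w
      outer : ∀ {ψ} (σ : Respects ψ) n → ∑ (ins 1 (fresh w) w) (weighted σ n) ≡ ∑ (ins 1 v w) (weighted σ n)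
      outer σ n = ∑-ins-≈ (weighted-≈ σ n) (≈-refl w) (<-fresh w) w<v
      inner : ∀ z₁ → All (_< suc v) z₁ →
        weighted (iᵦ-≈ ρ) A z₁ + weighted (iₐ-≈ ρ) A z₁ + weighted (iₐ-≈ ρ) (suc A) z₁ ≡
        ∑ (ins 1 (suc v) z₁) (λ z₂ → ⟦ av? r z₁ ⟧ * (⟦ av? r z₂ ⟧ * choices A (decreasing z₁) (decreasing z₂) (φ z₂)))
      inner z₁ z₁<
        rewrite ∑-ins-≈ (weighted-≈ ρ (decreasing z₁)) (≈-refl z₁) (<-fresh z₁) z₁<
              | ∑-ins-≈ (weighted-≈ ρ (suc (decreasing z₁))) (≈-refl z₁) (<-fresh z₁) z₁< = sym (begin
        ∑ zs (λ z₂ → a * (b z₂ * (δ L A * (δ (N z₂) L * φ z₂) + δ L A * (δ (N z₂) (suc L) * φ z₂) + δ L (suc A) * (δ (N z₂) (suc L) * φ z₂))))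
          ≡⟨ ∑-cong zs (λ z₂ → distribute a (b z₂) (δ L A) (δ L (suc A)) (δ (N z₂) L * φ z₂) (δ (N z₂) (suc L) * φ z₂)) ⟩
        ∑ zs (λ z₂ → a * δ L A * weighted ρ L z₂ + a * δ L A * weighted ρ (suc L) z₂ + a * δ L (suc A) * weighted ρ (suc L) z₂)
          ≡⟨ trans (∑-+ zs _ _) (cong₂ _+_ (trans (∑-+ zs _ _) (cong₂ _+_ (∑-*ˡ (a * δ L A) zs _) (∑-*ˡ (a * δ L A) zs _)))
                                           (∑-*ˡ (a * δ L (suc A)) zs _)) ⟩
        a * δ L A * ∑ zs (weighted ρ L) + a * δ L A * ∑ zs (weighted ρ (suc L)) + a * δ L (suc A) * ∑ zs (weighted ρ (suc L))
          ≡⟨ cong₂ _+_ (cong₂ _+_ (ℕₚ.*-assoc a (δ L A) _) (ℕₚ.*-assoc a (δ L A) _)) (ℕₚ.*-assoc a (δ L (suc A)) _) ⟩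
        _ ∎)
        where
        zs = ins 1 (suc v) z₁
        L = decreasing z₁
        a = ⟦ av? r z₁ ⟧
        b : List ℕ → ℕ
        b z₂ = ⟦ av? r z₂ ⟧
        N : List ℕ → ℕ
        N = decreasing
        distribute : ∀ a b c d e f → a * (b * (c * e + c * f + d * f)) ≡ a * c * (b * e) + a * c * (b * f) + a * d * (b * f)
        distribute = solve-∀
      term : ∀ p q s t → p ++ v ∷ q ≡ s ++ t → All (_< v) (p ++ q) →
        ⟦ av? r (p ++ v ∷ q) ⟧ * (⟦ av? r (s ++ suc v ∷ t) ⟧ *
          choices (decreasing (p ++ q)) (decreasing (p ++ v ∷ q)) (decreasing (s ++ suc v ∷ t)) (φ (s ++ suc v ∷ t))) ≡
        before v (s ++ suc v ∷ t) * (⟦ av? r (s ++ suc v ∷ t) ⟧ * φ (s ++ suc v ∷ t))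
      term p q s t eq w<v = begin
        ⟦ av? r z₁ ⟧ * (⟦ av? r z₂ ⟧ * c) ≡⟨ swap-* ⟦ av? r z₁ ⟧ ⟦ av? r z₂ ⟧ c ⟩
        ⟦ av? r z₂ ⟧ * (⟦ av? r z₁ ⟧ * c)
          ≡⟨ ⟦⟧*-cong (av? r z₂) (λ a₂ → trans (cong (_* c) (⟦⟧-yes (av? r z₁) (Av-⊆ z₁⊆z₂ a₂)))
               (trans (ℕₚ.*-identityˡ c) (coefficient p q s t (φ z₂) eq w<v a₂))) ⟩
        ⟦ av? r z₂ ⟧ * (before v z₂ * φ z₂) ≡⟨ swap-* ⟦ av? r z₂ ⟧ (before v z₂) (φ z₂) ⟩
        before v z₂ * (⟦ av? r z₂ ⟧ * φ z₂) ∎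
        where
        z₁ = p ++ v ∷ q
        z₂ = s ++ suc v ∷ t
        c = choices (decreasing (p ++ q)) (decreasing z₁) (decreasing z₂) (φ z₂)
        z₁⊆z₂ : z₁ ⊆ z₂
        z₁⊆z₂ = subst (_⊆ z₂) (sym eq) (Subₚ.++⁺ (⊆-refl {x = s}) (suc v ∷ʳ ⊆-refl))
        swap-* : ∀ a b c → a * (b * c) ≡ b * (a * c)
        swap-* = solve-∀

  private module W = Walk

  data Row : Set where
    fst snd : Row

  insertᴿ : Row → (List ℕ → ℕ) → List ℕ → ℕ
  insertᴿ fst = iₐ
  insertᴿ snd = iᵦ

  insertᵂ : Row → W.Weight → W.Weight
  insertᵂ fst = W.iₐ
  insertᵂ snd = W.iᵦ

  run : List Row → (List ℕ → ℕ) → ℕ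
  run []       φ = φ []
  run (i ∷ is) φ = run is (insertᴿ i φ)

  runᵂ : List Row → W.Weight → ℕ
  runᵂ []       F = F 0 0
  runᵂ (i ∷ is) F = runᵂ is (insertᵂ i F)

  insertᴿ-cong : ∀ i {φ ψ} → (∀ w → Av r w → φ w ≡ ψ w) → ∀ w → insertᴿ i φ w ≡ insertᴿ i ψ w
  insertᴿ-cong fst e w = ∑-cong (ins 1 (fresh w) w) λ z →
    ⟦⟧*-cong (av? r z) λ a → cong (δ (decreasing z) (suc (decreasing w)) *_) (e z a)
  insertᴿ-cong snd e w = ∑-cong (ins 1 (fresh w) w) λ z →
    ⟦⟧*-cong (av? r z) λ a → cong (δ (decreasing z) (decreasing w) *_) (e z a)

  run-cong : ∀ is {φ ψ} → (∀ w → Av r w → φ w ≡ ψ w) → run is φ ≡ run is ψ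
  run-cong []       e = e [] av-[]
  run-cong (i ∷ is) e = run-cong is λ w _ → insertᴿ-cong i e w

  insertᵂ-cong : ∀ i {F G} → (∀ e b → F e b ≡ G e b) → ∀ e b → insertᵂ i F e b ≡ insertᵂ i G e b
  insertᵂ-cong fst q e       b = q (suc e) b
  insertᵂ-cong snd q zero    b = refl
  insertᵂ-cong snd q (suc e) b = q e (suc b)

  runᵂ-cong : ∀ is {F G} → (∀ e b → F e b ≡ G e b) → runᵂ is F ≡ runᵂ is G
  runᵂ-cong []       q = q 0 0
  runᵂ-cong (i ∷ is) q = runᵂ-cong is (insertᵂ-cong i q)

  insertᴿ-+ : ∀ i φ ψ w → insertᴿ i (λ w → φ w + ψ w) w ≡ insertᴿ i φ w + insertᴿ i ψ w
  insertᴿ-+ i φ ψ w = go i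
    where
    distribute : ∀ a b c d → a * (b * (c + d)) ≡ a * (b * c) + a * (b * d)
    distribute = solve-∀
    go : ∀ i → insertᴿ i (λ w → φ w + ψ w) w ≡ insertᴿ i φ w + insertᴿ i ψ w
    go fst = trans (∑-cong (ins 1 (fresh w) w) λ z → distribute ⟦ av? r z ⟧ (δ (decreasing z) (suc (decreasing w))) (φ z) (ψ z))
                   (∑-+ (ins 1 (fresh w) w) _ _)
    go snd = trans (∑-cong (ins 1 (fresh w) w) λ z → distribute ⟦ av? r z ⟧ (δ (decreasing z) (decreasing w)) (φ z) (ψ z))
                   (∑-+ (ins 1 (fresh w) w) _ _)

  insertᵂ-+ : ∀ i F G e b → insertᵂ i (λ e b → F e b + G e b) e b ≡ insertᵂ i F e b + insertᵂ i G e b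
  insertᵂ-+ fst F G e       b = refl
  insertᵂ-+ snd F G zero    b = refl
  insertᵂ-+ snd F G (suc e) b = refl

  run-+ : ∀ is φ ψ → run is (λ w → φ w + ψ w) ≡ run is φ + run is ψ
  run-+ []       φ ψ = refl
  run-+ (i ∷ is) φ ψ = trans (run-cong is λ w _ → insertᴿ-+ i φ ψ w) (run-+ is (insertᴿ i φ) (insertᴿ i ψ))

  runᵂ-+ : ∀ is F G → runᵂ is (λ e b → F e b + G e b) ≡ runᵂ is F + runᵂ is G
  runᵂ-+ []       F G = refl
  runᵂ-+ (i ∷ is) F G = trans (runᵂ-cong is (insertᵂ-+ i F G)) (runᵂ-+ is (insertᵂ i F) (insertᵂ i G))

  Corresponds : (List ℕ → ℕ) → W.Weight → Set
  Corresponds φ F = ∀ is → run is φ ≡ runᵂ is F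

  corresponds-+ : ∀ {φ ψ F G} → Corresponds φ F → Corresponds ψ G → Corresponds (λ w → φ w + ψ w) (λ e b → F e b + G e b)
  corresponds-+ {φ} {ψ} {F} {G} c d is = trans (run-+ is φ ψ) (trans (cong₂ _+_ (c is) (d is)) (sym (runᵂ-+ is F G)))

  -- The same relations hold on partitions, so on both sides the removal is pushed through the row
  -- insertions in the same way, until one cancels it or it vanishes at the empty start.
  corresponds-x : ∀ {φ F} → Respects φ → Corresponds φ F → Corresponds (xₐ φ) (W.xₐ F) × Corresponds (xᵦ φ) (W.xᵦ F)
  corresponds-x ρ c = (λ is → proj₁ (go is ρ c)) , (λ is → proj₂ (go is ρ c))
    where
    go : ∀ is {φ F} → Respects φ → Corresponds φ F → (run is (xₐ φ) ≡ runᵂ is (W.xₐ F)) × (run is (xᵦ φ) ≡ runᵂ is (W.xᵦ F))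
    go [] ρ c = refl , refl
    go (fst ∷ is) {φ} {F} ρ c =
      trans (run-cong is (iₐ-xₐ ρ)) (c is)
      , trans (run-cong is (iₐ-xᵦ ρ)) (trans (proj₂ (go is (iₐ-≈ ρ) (λ js → c (fst ∷ js))))
                                             (runᵂ-cong is λ { e zero → refl ; e (suc b) → refl }))
    go (snd ∷ is) {φ} {F} ρ c =
      trans (run-cong is (iᵦ-xₐ ρ)) (trans (proj₁ (go is (iᵦ-≈ ρ) (λ js → c (snd ∷ js))))
                                           (runᵂ-cong is λ { zero b → refl ; (suc zero) b → refl ; (suc (suc e)) b → refl }))
      , trans (run-cong is (iᵦ-xᵦ ρ)) (trans (proj₁ (go is (iₐ-≈ ρ) (λ js → c (fst ∷ js))))
                                             (runᵂ-cong is λ { zero b → refl ; (suc e) b → refl }))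

  value : ℕ → List Op → ℕ → List ℕ → ℕ
  value H []                       h w = ⟦ (h ≟ H) ×-dec (length w ≟ 0) ⟧
  value H (add ∷ ω)                h w = xₐ (value H ω h) w + xᵦ (value H ω h) w
  value H (del 0 ∷ ω)              h w = value H ω (suc h) w
  value H (del 1 ∷ ω)              h w = iₐ (value H ω (suc h)) w + iᵦ (value H ω (suc h)) w
  value H (del (suc (suc _)) ∷ ω)  h w =
    iᵦ (iᵦ (value H ω (suc h))) w + iᵦ (iₐ (value H ω (suc h))) w + iₐ (iₐ (value H ω (suc h))) w

  ≈-length : ∀ {w w′} → w ≈ w′ → length w ≡ length w′
  ≈-length []      = refl
  ≈-length (_ ∷ s) = cong suc (≈-length s)

  value-≈ : ∀ H ω h → Respects (value H ω h)
  value-≈ H []                      h s = cong (λ n → ⟦ (h ≟ H) ×-dec (n ≟ 0) ⟧) (≈-length s)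
  value-≈ H (add ∷ ω)               h s = cong₂ _+_ (xₐ-≈ (value-≈ H ω h) s) (xᵦ-≈ (value-≈ H ω h) s)
  value-≈ H (del 0 ∷ ω)             h s = value-≈ H ω (suc h) s
  value-≈ H (del 1 ∷ ω)             h s = cong₂ _+_ (iₐ-≈ (value-≈ H ω (suc h)) s) (iᵦ-≈ (value-≈ H ω (suc h)) s)
  value-≈ H (del (suc (suc _)) ∷ ω) h s =
    cong₂ _+_ (cong₂ _+_ (iᵦ-≈ (iᵦ-≈ (value-≈ H ω (suc h))) s) (iᵦ-≈ (iₐ-≈ (value-≈ H ω (suc h))) s))
              (iₐ-≈ (iₐ-≈ (value-≈ H ω (suc h))) s)

  corresponds-value : ∀ H ω h → Corresponds (value H ω h) (W.value H ω h)
  corresponds-value H [] h [] = ⟦⟧-cong ((h ≟ H) ×-dec (0 ≟ 0)) (h ≟ H) proj₁ (_, refl)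
  corresponds-value H [] h (i ∷ is) = trans (runs-vanish is) (sym (walks is))
    where
    vanish : ∀ i w → insertᴿ i (value H [] h) w ≡ 0
    vanish i w = go i
      where
      zero′ : ∀ z → Inserted 1 (fresh w) w z → ∀ a b → a * (b * value H [] h z) ≡ 0
      zero′ z i a b rewrite ⟦⟧-no ((h ≟ H) ×-dec (length z ≟ 0)) (λ (_ , e) → contradiction (trans (sym (Inserted.long i)) e) λ ()) =
        trans (cong (a *_) (ℕₚ.*-zeroʳ b)) (ℕₚ.*-zeroʳ a)
      go : ∀ i → insertᴿ i (value H [] h) w ≡ 0
      go fst = ∑-ins-vanish 1 w (<-fresh w) λ {z} i → zero′ z i ⟦ av? r z ⟧ (δ (decreasing z) (suc (decreasing w)))
      go snd = ∑-ins-vanish 1 w (<-fresh w) λ {z} i → zero′ z i ⟦ av? r z ⟧ (δ (decreasing z) (decreasing w))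
    vanishᵂ : ∀ i e b → insertᵂ i (W.value H [] h) e b ≡ 0
    vanishᵂ fst e             b = refl
    vanishᵂ snd zero          b = refl
    vanishᵂ snd (suc zero)    b = refl
    vanishᵂ snd (suc (suc e)) b = refl
    run-zero : ∀ is → run is (λ _ → 0) ≡ 0
    run-zero []       = refl
    run-zero (i ∷ is) = trans (run-cong is λ w _ → go i w) (run-zero is)
      where
      0-right : ∀ a b → a * (b * 0) ≡ 0
      0-right = solve-∀
      go : ∀ i w → insertᴿ i (λ _ → 0) w ≡ 0
      go fst w = ∑-vanish (ins 1 (fresh w) w) (All.universal (λ z → 0-right ⟦ av? r z ⟧ (δ (decreasing z) (suc (decreasing w)))) _)
      go snd w = ∑-vanish (ins 1 (fresh w) w) (All.universal (λ z → 0-right ⟦ av? r z ⟧ (δ (decreasing z) (decreasing w))) _)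
    runᵂ-zero : ∀ is → runᵂ is (λ _ _ → 0) ≡ 0
    runᵂ-zero []         = refl
    runᵂ-zero (fst ∷ is) = runᵂ-zero is
    runᵂ-zero (snd ∷ is) = trans (runᵂ-cong is λ { zero b → refl ; (suc e) b → refl }) (runᵂ-zero is)
    runs-vanish : ∀ is → run is (insertᴿ i (value H [] h)) ≡ 0
    runs-vanish is = trans (run-cong is λ w _ → vanish i w) (run-zero is)
    walks : ∀ is → runᵂ is (insertᵂ i (W.value H [] h)) ≡ 0
    walks is = trans (runᵂ-cong is (vanishᵂ i)) (runᵂ-zero is)
  corresponds-value H (add ∷ ω) h =
    let cₐ , cᵦ = corresponds-x (value-≈ H ω h) (corresponds-value H ω h) in corresponds-+ cₐ cᵦ
  corresponds-value H (del 0 ∷ ω) h is = corresponds-value H ω (suc h) is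
  corresponds-value H (del 1 ∷ ω) h =
    corresponds-+ (λ is → corresponds-value H ω (suc h) (fst ∷ is)) (λ is → corresponds-value H ω (suc h) (snd ∷ is))
  corresponds-value H (del (suc (suc m)) ∷ ω) h =
    corresponds-+ (corresponds-+ (λ is → corresponds-value H ω (suc h) (snd ∷ snd ∷ is))
                                 (λ is → corresponds-value H ω (suc h) (fst ∷ snd ∷ is)))
                  (λ is → corresponds-value H ω (suc h) (fst ∷ fst ∷ is))

  x-split : ∀ (φ : List ℕ → ℕ) u w → xₐ φ (u ∷ w) + xᵦ φ (u ∷ w) ≡ φ w
  x-split φ u w with step-∷ u w
  ... | inj₁ e rewrite e | δ-suc (decreasing w) | δ-≡ (decreasing w) = ℕₚ.+-identityʳ (φ w)
  ... | inj₂ e rewrite e | δ-pred (decreasing w) | δ-≡ (suc (decreasing w)) = trans (ℕₚ.+-identityʳ _) (ℕₚ.+-identityʳ (φ w))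

  backward≡value : ∀ H ω h w → All (Bounded 2) ω → All (_< h) w → Av r w → backward r ω (h , w) (H , []) ≡ value H ω h w
  backward≡value H [] h w [] w<h a = backward-[] r h w H
  backward≡value H (add ∷ ω) h [] bs w<h a = refl
  backward≡value H (add ∷ ω) h (u ∷ w) (_ ∷ bs) (_ ∷ w<h) a =
    trans (backward-add r u w ω h (H , [])) (trans (backward≡value H ω h w bs w<h (av-∷⁻ a)) (sym (x-split (value H ω h) u w)))
  backward≡value H (del m ∷ ω) h w (m≤2 ∷ bs) w<h a =
    trans (backward-del r m ω h w (H , []))
    (trans (∑-ins-cong m w w<h λ {z} i → ⟦⟧*-cong (av? r z) λ az →
              backward≡value H ω (suc h) z bs (All.map ℕ.s≤s (Inserted.bound i)) az)
           (strip m m≤2))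
    where
    strip : ∀ m → m ≤ 2 → ∑ (ins m h w) (λ z → ⟦ av? r z ⟧ * value H ω (suc h) z) ≡ value H (del m ∷ ω) h w
    strip 0 _ = trans (ℕₚ.+-identityʳ _) (trans (cong (_* value H ω (suc h) w) (⟦⟧-yes (av? r w) a)) (ℕₚ.*-identityˡ _))
    strip 1 _ = insert-1 (value-≈ H ω (suc h)) w w<h
    strip 2 _ = insert-2 (value-≈ H ω (suc h)) w w<h
    strip (suc (suc (suc m))) (ℕ.s≤s (ℕ.s≤s ()))

  backward-321≡walk : ∀ ω H → All (Bounded 2) ω →
    backward (1 ∷ 2 ∷ 3 ∷ []) ω (0 , []) (H , []) ≡ Walk.value H ω 0 0 0
  backward-321≡walk ω H bs = trans (backward≡value H ω 0 [] bs [] av-[]) (corresponds-value H ω 0 [])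

open Pattern-321 using (backward-321≡walk)

-- Reverse complements.

∑-reverse : ∀ {A : Set} (xs : List A) (f : A → ℕ) → ∑ (reverse xs) f ≡ ∑ xs f
∑-reverse []       f = refl
∑-reverse (x ∷ xs) f = trans (cong (λ ys → ∑ ys f) (unfold-reverse x xs))
  (trans (∑-++ (reverse xs) [ x ] f) (trans (cong₂ _+_ (∑-reverse xs f) (ℕₚ.+-identityʳ (f x))) (ℕₚ.+-comm (∑ xs f) (f x))))

length-∑ : ∀ {A : Set} (xs : List A) → length xs ≡ ∑ xs λ _ → 1
length-∑ []       = refl
length-∑ (x ∷ xs) = cong suc (length-∑ xs)

-- Double counting of the pairs consisting of an element and its image.
length-bijection : ∀ {A B : Set} (_≟ᴬ_ : DecidableEquality A) (_≟ᴮ_ : DecidableEquality B) (f : A → B) (g : B → A) →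
  (∀ x → g (f x) ≡ x) → (∀ y → f (g y) ≡ y) → ∀ {xs ys} → Unique xs → Unique ys →
  (∀ x → x ∈ xs → f x ∈ ys) → (∀ y → y ∈ ys → g y ∈ xs) → length xs ≡ length ys
length-bijection _≟ᴬ_ _≟ᴮ_ f g gf fg {xs} {ys} xs! ys! f⁺ g⁺ = begin
  length xs                                ≡⟨ length-∑ xs ⟩
  ∑ xs (λ _ → 1)                           ≡⟨ ∑-cong-All xs (All.tabulate λ x∈ → sym (∑-≟ _≟ᴮ_ (λ _ → 1) ys! (f⁺ _ x∈))) ⟩
  ∑ xs (λ x → ∑ ys λ y → ⟦ f x ≟ᴮ y ⟧ * 1)  ≡⟨ ∑-swap xs ys _ ⟩
  ∑ ys (λ y → ∑ xs λ x → ⟦ f x ≟ᴮ y ⟧ * 1)  ≡⟨ ∑-cong ys (λ y → ∑-cong xs λ x → cong (_* 1) (⟦⟧-cong (f x ≟ᴮ y) (g y ≟ᴬ x)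
                                                 (λ { refl → gf x }) (λ { refl → fg y }))) ⟩
  ∑ ys (λ y → ∑ xs λ x → ⟦ g y ≟ᴬ x ⟧ * 1)  ≡⟨ ∑-cong-All ys (All.tabulate λ y∈ → ∑-≟ _≟ᴬ_ (λ _ → 1) xs! (g⁺ _ y∈)) ⟩
  ∑ ys (λ _ → 1)                           ≡⟨ sym (length-∑ ys) ⟩
  length ys                                ∎
  where open ≡-Reasoning

av-bijection : ∀ S T {P Q} (f : Word (k S) → Word (k T)) (g : Word (k T) → Word (k S)) →
  (∀ π → g (f π) ≡ π) → (∀ π → f (g π) ≡ π) →
  (∀ π → IsMultiperm S π → IsMultiperm T (f π)) → (∀ π → IsMultiperm T π → IsMultiperm S (g π)) →
  (∀ π → AvoidsAll P π → AvoidsAll Q (f π)) → (∀ π → AvoidsAll Q π → AvoidsAll P (g π)) → av S P ≡ av T Q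
av-bijection S T {P} {Q} f g gf fg fᵐ gᵐ fᵃ gᵃ =
  length-bijection (Listₚ.≡-dec Finₚ._≟_) (Listₚ.≡-dec Finₚ._≟_) f g gf fg
    (Uniqueₚ.filter⁺ (avoidsAll? P) (multiperms-unique S)) (Uniqueₚ.filter⁺ (avoidsAll? Q) (multiperms-unique T))
    (transport S T f fᵐ fᵃ) (transport T S g gᵐ gᵃ)
  where
  transport : ∀ S T {P Q} (f : Word (k S) → Word (k T)) → (∀ π → IsMultiperm S π → IsMultiperm T (f π)) →
    (∀ π → AvoidsAll P π → AvoidsAll Q (f π)) →
    ∀ π → π ∈ filter (avoidsAll? P) (multiperms S) → f π ∈ filter (avoidsAll? Q) (multiperms T)
  transport S T {P} {Q} f fᵐ fᵃ π π∈ = let π∈S , as = ∈-filter⁻ (avoidsAll? P) {xs = multiperms S} π∈ in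
    ∈-filter⁺ (avoidsAll? Q)
      (Equivalence.from (∈-multiperms T (f π)) (fᵐ π (Equivalence.to (∈-multiperms S π) π∈S))) (fᵃ π as)

reverseMultiset : Multiset → Multiset
reverseMultiset S = record { k = k S ; k≥1 = k≥1 S ; mult = mult S ∘ opposite ; mult≥1 = mult≥1 S ∘ opposite }

rc : ∀ {k} → Word k → Word k
rc π = reverse (map opposite π)

rc-involutive : ∀ {k} (π : Word k) → rc (rc π) ≡ π
rc-involutive π = trans (cong reverse (reverse-map opposite (map opposite π)))
  (trans (reverse-involutive (map opposite (map opposite π))) (trans (sym (map-∘ π)) (trans (map-cong Finₚ.opposite-involutive π) (map-id π))))

occurrences-rc : ∀ {k} i (π : Word k) → occurrences i (rc π) ≡ occurrences (opposite i) π
occurrences-rc i π = begin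
  occurrences i (rc π)                              ≡⟨ length-filter (Finₚ._≟ i) (rc π) ⟩
  ∑ (rc π) (λ x → ⟦ x Finₚ.≟ i ⟧)                   ≡⟨ ∑-reverse (map opposite π) _ ⟩
  ∑ (map opposite π) (λ x → ⟦ x Finₚ.≟ i ⟧)         ≡⟨ ∑-map opposite π _ ⟩
  ∑ π (λ x → ⟦ opposite x Finₚ.≟ i ⟧)               ≡⟨ ∑-cong π (λ x → ⟦⟧-cong (opposite x Finₚ.≟ i) (x Finₚ.≟ opposite i)
                                                         (λ { refl → sym (Finₚ.opposite-involutive x) })
                                                         (λ { refl → Finₚ.opposite-involutive i })) ⟩
  ∑ π (λ x → ⟦ x Finₚ.≟ opposite i ⟧)               ≡⟨ sym (length-filter (Finₚ._≟ opposite i) π) ⟩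
  occurrences (opposite i) π                        ∎
  where open ≡-Reasoning

-- With `c` one more than the largest letter, the letters of the result start from 1 again; hence
-- the constants 2, 4 and 5 below.
rcPattern : ℕ → Pattern → Pattern
rcPattern c ρ = reverse (map (c ∸_) ρ)

private
  ∸-<-⇔ : ∀ {m x y} → x ≤ m → y ≤ m → (m ∸ x < m ∸ y) ⇔ (y < x)
  ∸-<-⇔ {m} {x} {y} x≤m y≤m = mk⇔ (λ lt → ℕₚ.≰⇒> λ x≤y → ℕₚ.<⇒≱ lt (ℕₚ.∸-monoʳ-≤ m x≤y)) (λ y<x → ℕₚ.∸-monoʳ-< y<x x≤m)

≅-complement : ∀ {m c l ρ} → All (_≤ m) l → All (_≤ c) ρ → l ≅ ρ → map (m ∸_) l ≅ map (c ∸_) ρ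
≅-complement []        []        []      = []
≅-complement {m} {c} {x ∷ _} {r ∷ _} (x≤m ∷ l≤m) (r≤c ∷ ρ≤c) (h ∷ e) = go l≤m ρ≤c h ∷ ≅-complement l≤m ρ≤c e
  where
  reflects : ∀ {x y r s} → x ≤ m → y ≤ m → r ≤ c → s ≤ c → y < x ⇔ s < r → (m ∸ x < m ∸ y) ⇔ (c ∸ r < c ∸ s)
  reflects {x} {y} {r} {s} x≤m y≤m r≤c s≤c e =
    ⇔-trans (∸-<-⇔ {m} {x} {y} x≤m y≤m) (⇔-trans e (⇔-sym (∸-<-⇔ {c} {r} {s} r≤c s≤c)))
  go : ∀ {l ρ} → All (_≤ m) l → All (_≤ c) ρ → Pointwise (SameOrder x r) l ρ →
       Pointwise (SameOrder (m ∸ x) (c ∸ r)) (map (m ∸_) l) (map (c ∸_) ρ)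
  go []          []          []             = []
  go {y ∷ _} {s ∷ _} (y≤m ∷ l≤m) (s≤c ∷ ρ≤c) ((p , q) ∷ h) =
    (reflects {x} {y} {r} {s} x≤m y≤m r≤c s≤c q , reflects {y} {x} {s} {r} y≤m x≤m s≤c r≤c p) ∷ go l≤m ρ≤c h

letters-rc : ∀ {k} (π : Word (suc k)) → letters (rc π) ≡ reverse (map (k ∸_) (letters π))
letters-rc {k} π = trans (reverse-map toℕ (map opposite π))
  (cong reverse (trans (sym (map-∘ π)) (trans (map-cong Finₚ.opposite-prop π) (map-∘ π))))

contains-rc : ∀ {k c ρ} {π : Word k} → All (_≤ c) ρ → Contains π ρ → Contains (rc π) (rcPattern c ρ)
contains-rc {zero}  {c} {[]}    {[]} ρ≤c con = con
contains-rc {zero}  {c} {_ ∷ _} {[]} ρ≤c (ι , _) with () ← ι zero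
contains-rc {suc k} {c} {ρ} {π} ρ≤c con with contains⇒has con
... | l , sub , e = has⇒contains (subst (Has (rcPattern c ρ)) (sym (letters-rc π))
  (has-reverse (map (k ∸_) l , Subₚ.map⁺ (k ∸_) sub
               , ≅-complement (Subₚ.All-resp-⊆ sub (All.map ℕ.s≤s⁻¹ (letters-< π))) ρ≤c e)))

rcPattern-involutive : ∀ c {ρ} → All (_≤ c) ρ → rcPattern c (rcPattern c ρ) ≡ ρ
rcPattern-involutive c {ρ} ρ≤c =
  trans (cong reverse (reverse-map (c ∸_) (map (c ∸_) ρ)))
  (trans (reverse-involutive _) (trans (sym (map-∘ ρ)) (Listₚ.map-id-local (All.map (λ r≤c → ℕₚ.m∸[m∸n]≡n r≤c) ρ≤c))))

rcPattern-≤ : ∀ c ρ → All (_≤ c) (rcPattern c ρ)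
rcPattern-≤ c ρ = All-reverse⁺ (Allₚ.map⁺ (All.universal (λ r → ℕₚ.m∸n≤m c r) ρ))

avoids-rc : ∀ {k c ρ} {π : Word k} → All (_≤ c) ρ → Avoids π ρ → Avoids (rc π) (rcPattern c ρ)
avoids-rc {c = c} {ρ} {π} ρ≤c a con =
  a (subst₂ Contains (rc-involutive π) (rcPattern-involutive c ρ≤c) (contains-rc {π = rc π} (rcPattern-≤ c ρ) con))

av-rc : ∀ S {c d ρ σ} → All (_≤ c) ρ → All (_≤ d) σ →
        av S ｛ ρ , σ ｝ ≡ av (reverseMultiset S) ｛ rcPattern c ρ , rcPattern d σ ｝
av-rc S {c} {d} {ρ} {σ} ρ≤c σ≤d =
  av-bijection S (reverseMultiset S) rc rc rc-involutive rc-involutive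
    (λ π mp i → trans (occurrences-rc i π) (mp (opposite i)))
    (λ π mp i → trans (occurrences-rc i π) (trans (mp (opposite i)) (cong (mult S) (Finₚ.opposite-involutive i))))
    avoids⁺ avoids⁻
  where
  avoids⁺ : ∀ π → AvoidsAll ｛ ρ , σ ｝ π → AvoidsAll ｛ rcPattern c ρ , rcPattern d σ ｝ (rc π)
  avoids⁺ π (a ∷ b ∷ []) = avoids-rc {π = π} ρ≤c a ∷ avoids-rc {π = π} σ≤d b ∷ []
  avoids⁻ : ∀ π → AvoidsAll ｛ rcPattern c ρ , rcPattern d σ ｝ π → AvoidsAll ｛ ρ , σ ｝ (rc π)
  avoids⁻ π (a ∷ b ∷ []) =
    subst (Avoids (rc π)) (rcPattern-involutive c ρ≤c) (avoids-rc {π = π} (rcPattern-≤ c ρ) a)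
    ∷ subst (Avoids (rc π)) (rcPattern-involutive d σ≤d) (avoids-rc {π = π} (rcPattern-≤ d σ) b) ∷ []

av-comm : ∀ S ρ σ → av S ｛ ρ , σ ｝ ≡ av S ｛ σ , ρ ｝
av-comm S ρ σ = begin
  av S ｛ ρ , σ ｝
    ≡⟨ length-filter (avoidsAll? ｛ ρ , σ ｝) (multiperms S) ⟩
  ∑ (multiperms S) (λ π → ⟦ avoidsAll? ｛ ρ , σ ｝ π ⟧)
    ≡⟨ ∑-cong (multiperms S) (λ π → trans (⟦avoids-both⟧ ρ σ π)
         (trans (ℕₚ.*-comm ⟦ ¬? (contains? π σ) ⟧ _) (sym (⟦avoids-both⟧ σ ρ π)))) ⟩
  ∑ (multiperms S) (λ π → ⟦ avoidsAll? ｛ σ , ρ ｝ π ⟧)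
    ≡⟨ sym (length-filter (avoidsAll? ｛ σ , ρ ｝) (multiperms S)) ⟩
  av S ｛ σ , ρ ｝
    ∎
  where open ≡-Reasoning

-- As av computes, comparing two instances of ∼ may run it; a record type is compared by its arguments.
infix 4 _≋_
record _≋_ (P Q : List Pattern) : Set where
  constructor equivalent
  field av-≡ : P ∼ Q

open _≋_

≋-sym : ∀ {P Q} → P ≋ Q → Q ≋ P
≋-sym (equivalent e) = equivalent λ S → sym (e S)

≋-trans : ∀ {P Q R} → P ≋ Q → Q ≋ R → P ≋ R
≋-trans (equivalent e) (equivalent e′) = equivalent λ S → trans (e S) (e′ S)

≋-swap : ∀ {ρ ρ′ σ σ′} → ｛ ρ , σ ｝ ≋ ｛ ρ′ , σ′ ｝ → ｛ σ , ρ ｝ ≋ ｛ σ′ , ρ′ ｝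
≋-swap {ρ} {ρ′} {σ} {σ′} (equivalent e) = equivalent λ S → trans (av-comm S σ ρ) (trans (e S) (av-comm S ρ′ σ′))

∼-pairwise : ∀ {P Ps} → All (P ≋_) Ps → AllPairs _∼_ (P ∷ Ps)
∼-pairwise {P} es = All.map av-≡ es ∷ go es
  where
  go : ∀ {Qs} → All (P ≋_) Qs → AllPairs _∼_ Qs
  go []       = []
  go (e ∷ es) = All.map (λ e′ → av-≡ (≋-trans (≋-sym e) e′)) es ∷ go es

≤-all? : ∀ c ρ → Dec (All (_≤ c) ρ)
≤-all? c = All.all? (_≤? c)

≋-rc : ∀ c d ρ ρ′ σ {_ : True (≤-all? c ρ)} {_ : True (≤-all? c ρ′)} {_ : True (≤-all? d σ)} →
  ｛ rcPattern c ρ , rcPattern d σ ｝ ≋ ｛ rcPattern c ρ′ , rcPattern d σ ｝ → ｛ ρ , σ ｝ ≋ ｛ ρ′ , σ ｝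
≋-rc c d ρ ρ′ σ {p} {p′} {q} (equivalent e) = equivalent λ S →
  trans (av-rc S (toWitness p) (toWitness q)) (trans (e (reverseMultiset S)) (sym (av-rc S (toWitness p′) (toWitness q))))

_⋖?_ : ∀ ρ τ → Dec (ρ ⋖ τ)
ρ ⋖? τ = All.all? (λ r → All.all? (r <?_) τ) ρ

NonEmpty : Pattern → Set
NonEmpty ρ = True (¬? (Listₚ.≡-dec _≟_ ρ []))

nonEmpty : ∀ {ρ} → NonEmpty ρ → ρ ≢ []
nonEmpty = toWitness

Equinumerous : ℕ → Pattern → Pattern → Set
Equinumerous b ρ ρ′ = ∀ ω H → All (Bounded b) ω →
  backward (reverse ρ) ω (0 , []) (H , []) ≡ backward (reverse ρ′) ω (0 , []) (H , [])

module _ (b : ℕ) (ρ ρ′ : Pattern) {≢ : NonEmpty ρ} {≢′ : NonEmpty ρ′} where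

  ⊕-1ᵇ : ∀ τ {_ : True (ρ ⋖? τ)} {_ : True (ρ′ ⋖? τ)} → Equinumerous b ρ ρ′ →
         ｛ ρ ++ τ , replicate (suc b) 1 ｝ ≋ ｛ ρ′ ++ τ , replicate (suc b) 1 ｝
  ⊕-1ᵇ τ {p} {p′} e = equivalent
    (⊕-equivalent ρ ρ′ τ (replicate (suc b) 1) (toWitness p) (toWitness p′) (nonEmpty ≢) (nonEmpty ≢′)
      (λ S {π} {π′} mp mp′ _ → avoids-replicate-class b S {π} {π′} mp mp′)
      (λ S {π} mp a H → e (activeOps τ π) H (avoids-replicate-bounded b τ {π} a)))

  ⊕-1ᵇ2 : ∀ r {_ : True (ρ ⋖? [ r ])} {_ : True (ρ′ ⋖? [ r ])} → Equinumerous b ρ ρ′ →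
          ｛ ρ ++ [ r ] , replicate (suc b) 1 ++ [ 2 ] ｝ ≋ ｛ ρ′ ++ [ r ] , replicate (suc b) 1 ++ [ 2 ] ｝
  ⊕-1ᵇ2 r {p} {p′} e = equivalent
    (⊕-equivalent ρ ρ′ [ r ] (replicate (suc b) 1 ++ [ 2 ]) (toWitness p) (toWitness p′) (nonEmpty ≢) (nonEmpty ≢′)
      (λ S {π} {π′} mp mp′ eq → avoids-⊕1-class b r S {π} {π′} mp mp′ eq)
      (λ S {π} mp a H → e (activeOps [ r ] π) H (avoids-⊕1-bounded b r {π = π} a)))

12≃21 : ∀ {b} → Equinumerous b (1 ∷ 2 ∷ []) (2 ∷ 1 ∷ [])
12≃21 ω H _ = backward-12≡21 ω H

122≃212 : ∀ {b} → Equinumerous b (word₃ 1 2 2) (word₃ 2 1 2)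
122≃212 ω H _ = backward-122≡212 ω H

122≃221 : ∀ {b} → Equinumerous b (word₃ 1 2 2) (word₃ 2 2 1)
122≃221 ω H _ = backward-122≡221 ω H

bounded-≤ : ∀ {b c o} → b ≤ c → Bounded b o → Bounded c o
bounded-≤ {o = add}   b≤c _   = _
bounded-≤ {o = del m} b≤c m≤b = ℕₚ.≤-trans m≤b b≤c

123≃213 : ∀ {b} → b ≤ 2 → Equinumerous b (word₃ 1 2 3) (word₃ 2 1 3)
123≃213 b≤2 ω H bs = trans (backward-123≡walk ω H bs′) (sym (backward-213≡walk ω H bs′))
  where bs′ = All.map (bounded-≤ b≤2) bs

123≃321 : ∀ {b} → b ≤ 2 → Equinumerous b (word₃ 1 2 3) (word₃ 3 2 1)
123≃321 b≤2 ω H bs = trans (backward-123≡walk ω H bs′) (sym (backward-321≡walk ω H bs′))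
  where bs′ = All.map (bounded-≤ b≤2) bs

1223≋2123 : ｛ word₃ 1 1 1 , word₄ 1 2 2 3 ｝ ≋ ｛ word₃ 1 1 1 , word₄ 2 1 2 3 ｝
1223≋2123 = ≋-swap (⊕-1ᵇ 2 (word₃ 1 2 2) (word₃ 2 1 2) [ 3 ] 122≃212)

1223≋2213 : ｛ word₃ 1 1 1 , word₄ 1 2 2 3 ｝ ≋ ｛ word₃ 1 1 1 , word₄ 2 2 1 3 ｝
1223≋2213 = ≋-swap (⊕-1ᵇ 2 (word₃ 1 2 2) (word₃ 2 2 1) [ 3 ] 122≃221)

-- The pattern 2132 has no final letters above all the others that could be split off, so the whole
-- pattern is ρ and τ is empty.
2132≋2213 : ｛ word₃ 1 1 1 , word₄ 2 1 3 2 ｝ ≋ ｛ word₃ 1 1 1 , word₄ 2 2 1 3 ｝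
2132≋2213 = ≋-swap (go (word₄ 2 1 3 2) (word₄ 2 2 1 3) λ ω n H ds bs → backward-2132≡2213 ω n H ds bs)
  where
  go : ∀ ρ ρ′ {_ : NonEmpty ρ} {_ : NonEmpty ρ′} {_ : True (ρ ⋖? [])} {_ : True (ρ′ ⋖? [])} →
    (∀ ω n H → All IsDel ω → All (Bounded 2) ω → backward (reverse ρ) (ω ++ replicate n add) (0 , []) (H , []) ≡
                                                 backward (reverse ρ′) (ω ++ replicate n add) (0 , []) (H , [])) →
    ｛ ρ ++ [] , replicate 3 1 ｝ ≋ ｛ ρ′ ++ [] , replicate 3 1 ｝
  go ρ ρ′ {≢} {≢′} {p} {p′} e = equivalent
    (⊕-equivalent ρ ρ′ [] (replicate 3 1) (toWitness p) (toWitness p′) (nonEmpty ≢) (nonEmpty ≢′)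
      (λ S {π} {π′} mp mp′ _ → avoids-replicate-class 2 S {π} {π′} mp mp′)
      (λ S {π} mp a H → same {π = π} H (activeOps-[] π) (avoids-replicate-bounded 2 [] {π} a)))
    where
    same : ∀ {k} {π : Word k} H → (∃ λ ds → ∃ λ n → activeOps [] π ≡ ds ++ replicate n add × All IsDel ds) →
      All (Bounded 2) (activeOps [] π) →
      backward (reverse ρ) (activeOps [] π) (0 , []) (H , []) ≡ backward (reverse ρ′) (activeOps [] π) (0 , []) (H , [])
    same H (ds , n , eq , ds-del) bs rewrite eq = e ds n H ds-del (Allₚ.++⁻ˡ ds bs)

1234≋2134 : ｛ word₃ 1 1 1 , word₄ 1 2 3 4 ｝ ≋ ｛ word₃ 1 1 1 , word₄ 2 1 3 4 ｝
1234≋2134 = ≋-swap (⊕-1ᵇ 2 (1 ∷ 2 ∷ []) (2 ∷ 1 ∷ []) (3 ∷ 4 ∷ []) 12≃21)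

1243≋2143 : ｛ word₃ 1 1 1 , word₄ 1 2 4 3 ｝ ≋ ｛ word₃ 1 1 1 , word₄ 2 1 4 3 ｝
1243≋2143 = ≋-swap (⊕-1ᵇ 2 (1 ∷ 2 ∷ []) (2 ∷ 1 ∷ []) (4 ∷ 3 ∷ []) 12≃21)

1234≋3214 : ｛ word₃ 1 1 1 , word₄ 1 2 3 4 ｝ ≋ ｛ word₃ 1 1 1 , word₄ 3 2 1 4 ｝
1234≋3214 = ≋-swap (⊕-1ᵇ 2 (word₃ 1 2 3) (word₃ 3 2 1) [ 4 ] (123≃321 ℕₚ.≤-refl))

123≋213 : ｛ word₃ 1 2 3 , word₄ 1 1 1 1 ｝ ≋ ｛ word₃ 2 1 3 , word₄ 1 1 1 1 ｝
123≋213 = ⊕-1ᵇ 3 (1 ∷ 2 ∷ []) (2 ∷ 1 ∷ []) [ 3 ] 12≃21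

rc-111 : ∀ c ρ ρ′ {_ : True (≤-all? c ρ)} {_ : True (≤-all? c ρ′)} →
  ｛ word₃ 1 1 1 , rcPattern c ρ ｝ ≋ ｛ word₃ 1 1 1 , rcPattern c ρ′ ｝ → ｛ word₃ 1 1 1 , ρ ｝ ≋ ｛ word₃ 1 1 1 , ρ′ ｝
rc-111 c ρ ρ′ {p} {p′} e = ≋-swap (≋-rc c 2 ρ ρ′ (word₃ 1 1 1) {p} {p′} (≋-swap e))

proposition2p9 :
    AllPairs _∼_
      ( ｛ word₃ 1 2 2 , word₄ 1 1 1 1 ｝ ∷
        ｛ word₃ 2 1 2 , word₄ 1 1 1 1 ｝ ∷ [] ) ×
    AllPairs _∼_
      ( ｛ word₃ 1 1 1 , word₄ 1 2 2 3 ｝ ∷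
        ｛ word₃ 1 1 1 , word₄ 1 2 3 2 ｝ ∷
        ｛ word₃ 1 1 1 , word₄ 1 3 2 2 ｝ ∷
        ｛ word₃ 1 1 1 , word₄ 2 1 2 3 ｝ ∷
        ｛ word₃ 1 1 1 , word₄ 2 1 3 2 ｝ ∷
        ｛ word₃ 1 1 1 , word₄ 2 2 1 3 ｝ ∷ [] ) ×
    AllPairs _∼_
      ( ｛ word₃ 1 1 1 , word₄ 1 2 3 3 ｝ ∷
        ｛ word₃ 1 1 1 , word₄ 2 1 3 3 ｝ ∷ [] ) ×
    AllPairs _∼_
      ( ｛ word₃ 1 1 1 , word₄ 1 2 3 4 ｝ ∷
        ｛ word₃ 1 1 1 , word₄ 1 2 4 3 ｝ ∷
        ｛ word₃ 1 1 1 , word₄ 1 4 3 2 ｝ ∷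
        ｛ word₃ 1 1 1 , word₄ 2 1 3 4 ｝ ∷
        ｛ word₃ 1 1 1 , word₄ 2 1 4 3 ｝ ∷
        ｛ word₃ 1 1 1 , word₄ 3 2 1 4 ｝ ∷ [] ) ×
    AllPairs _∼_
      ( ｛ word₃ 1 2 3 , word₄ 1 1 1 1 ｝ ∷
        ｛ word₃ 1 3 2 , word₄ 1 1 1 1 ｝ ∷
        ｛ word₃ 2 1 3 , word₄ 1 1 1 1 ｝ ∷ [] ) ×
    AllPairs _∼_
      ( ｛ word₃ 1 2 3 , word₄ 1 1 1 2 ｝ ∷
        ｛ word₃ 2 1 3 , word₄ 1 1 1 2 ｝ ∷ [] ) ×
    AllPairs _∼_
      ( ｛ word₃ 1 1 2 , word₄ 1 2 3 4 ｝ ∷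
        ｛ word₃ 1 1 2 , word₄ 2 1 3 4 ｝ ∷
        ｛ word₃ 1 1 2 , word₄ 3 2 1 4 ｝ ∷ [] ) ×
    AllPairs _∼_
      ( ｛ word₃ 1 1 2 , word₄ 2 3 1 4 ｝ ∷
        ｛ word₃ 1 1 2 , word₄ 3 1 2 4 ｝ ∷ [] )
proposition2p9 =
    ∼-pairwise (⊕-1ᵇ 3 (word₃ 1 2 2) (word₃ 2 1 2) [] 122≃212 ∷ [])
  -- The reverse complement fixes 1223 and takes 1232 to 2123 and 1322 to 2213.
  , ∼-pairwise ( rc-111 4 (word₄ 1 2 2 3) (word₄ 1 2 3 2) 1223≋2123
               ∷ rc-111 4 (word₄ 1 2 2 3) (word₄ 1 3 2 2) 1223≋2213
               ∷ 1223≋2123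
               ∷ ≋-trans 1223≋2213 (≋-sym 2132≋2213)
               ∷ 1223≋2213 ∷ [])
  , ∼-pairwise (≋-swap (⊕-1ᵇ 2 (1 ∷ 2 ∷ []) (2 ∷ 1 ∷ []) (3 ∷ 3 ∷ []) 12≃21) ∷ [])
  , ∼-pairwise ( 1234≋1243
               -- The reverse complement fixes 1234 and takes 1432 to 3214.
               ∷ rc-111 5 (word₄ 1 2 3 4) (word₄ 1 4 3 2) 1234≋3214
               ∷ 1234≋2134
               ∷ ≋-trans 1234≋1243 1243≋2143
               ∷ 1234≋3214 ∷ [])
  -- The reverse complement fixes 123 and 1111 and takes 132 to 213.
  , ∼-pairwise (≋-rc 4 2 (word₃ 1 2 3) (word₃ 1 3 2) (word₄ 1 1 1 1) 123≋213 ∷ 123≋213 ∷ [])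
  , ∼-pairwise (⊕-1ᵇ2 2 (1 ∷ 2 ∷ []) (2 ∷ 1 ∷ []) 3 12≃21 ∷ [])
  , ∼-pairwise ( ≋-swap (⊕-1ᵇ2 1 (word₃ 1 2 3) (word₃ 2 1 3) 4 (123≃213 (ℕ.s≤s ℕ.z≤n)))
               ∷ ≋-swap (⊕-1ᵇ2 1 (word₃ 1 2 3) (word₃ 3 2 1) 4 (123≃321 (ℕ.s≤s ℕ.z≤n))) ∷ [])
  , ∼-pairwise (≋-swap (⊕-1ᵇ2 1 (word₃ 2 3 1) (word₃ 3 1 2) 4 backward-231≡312) ∷ [])
  where
  1234≋1243 : ｛ word₃ 1 1 1 , word₄ 1 2 3 4 ｝ ≋ ｛ word₃ 1 1 1 , word₄ 1 2 4 3 ｝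
  1234≋1243 = rc-111 5 (word₄ 1 2 3 4) (word₄ 1 2 4 3) 1234≋2134
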